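{- Let $k>1$ be an integer which is not a perfect square, and let $(x,y,z)$ be a solution in positive integers of $x^2+(2k-1)^y=k^z$ with $y\in\{3,5\}$. Let $(u_1,v_1)$ be the least solution of the Pell equation $u^2-kv^2=1$ (i.e. the positive integer solution minimizing $u+v\sqrt{k}$). Then $z$ is odd, and there exist positive integers $X_1,Y_1,Z_1$, a positive integer $t$, a sign $\lambda\in\{1,-1\}$, and integers $u,v$ with $u^2-kv^2=1$, such that $$X_1^2-kY_1^2=(-(2k-1))^{Z_1},\quad \gcd(X_1,Y_1)=1,\quad Z_1\mid h(4k),$$ $$1<\left\lvert \frac{X_1+Y_1\sqrt{k}}{X_1-Y_1\sqrt{k}}\right\rvert<u_1+v_1\sqrt{k},$$ and $$y=Z_1t,\qquad x+k^{(z-1)/2}\sqrt{k}=(X_1+\lambda Y_1\sqrt{k})^t(u+v\sqrt{k}).$$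
   Context: $h(4k)$ denotes the class number of binary quadratic primitive forms with discriminant $4k$. -}

module Defs where

open import Data.Nat as ℕ using (ℕ)
open import Data.Integer as ℤ using (ℤ; +_; -_; _+_; _-_; _*_; _^_; _<_; _≤_; 0ℤ; 1ℤ)
open import Data.Integer.Properties using (_<?_; _≤?_)
open import Data.Integer.GCD using (gcd)
open import Data.Fin using (Fin)
open import Data.Bool using (if_then_else_)
open import Data.Product using (Σ; ∃; _×_; _,_)
open import Data.Sum using (_⊎_)
open import Relation.Nullary using (Dec)
open import Relation.Nullary.Decidable using (⌊_⌋; _×-dec_; _⊎-dec_)
open import Relation.Binary.PropositionalEquality using (_≡_)

-- Elements a + b √k of ℤ[√k], represented as pairs (a , b).
-- (For k not a perfect square this representation is faithful.)

QZ : Set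
QZ = ℤ × ℤ

_+√k·_ : ℤ → ℤ → QZ
a +√k· b = a , b

qneg : QZ → QZ
qneg (a , b) = - a , - b

qsub : QZ → QZ → QZ
qsub (a , b) (c , d) = a - c , b - d

qmul : ℕ → QZ → QZ → QZ
qmul k (a , b) (c , d) = a * c + (+ k) * (b * d) , a * d + b * c

qpow : ℕ → QZ → ℕ → QZ
qpow k α ℕ.zero    = 1ℤ , 0ℤ
qpow k α (ℕ.suc n) = qmul k α (qpow k α n)

-- a + b√k > 0 (as a real number), for k ≥ 0
Pos : ℕ → QZ → Set
Pos k (a , b) =
    (0ℤ ≤ a × 0ℤ ≤ b × (0ℤ < a ⊎ 0ℤ < b))
  ⊎ (0ℤ < a × b < 0ℤ × (+ k) * (b * b) < a * a)
  ⊎ (a < 0ℤ × 0ℤ < b × a * a < (+ k) * (b * b))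

pos? : (k : ℕ) → (α : QZ) → Dec (Pos k α)
pos? k (a , b) =
     ((0ℤ ≤? a) ×-dec (0ℤ ≤? b) ×-dec ((0ℤ <? a) ⊎-dec (0ℤ <? b)))
  ⊎-dec ((0ℤ <? a) ×-dec (b <? 0ℤ) ×-dec ((+ k) * (b * b) <? a * a))
  ⊎-dec ((a <? 0ℤ) ×-dec (0ℤ <? b) ×-dec (a * a <? (+ k) * (b * b)))

QLt : ℕ → QZ → QZ → Set
QLt k α β = Pos k (qsub β α)

qabs : ℕ → QZ → QZ
qabs k α = if ⌊ pos? k (qneg α) ⌋ then qneg α else α

record Form : Set where
  constructor form
  field
    fa fb fc : ℤ
open Form public

disc : Form → ℤ
disc (form a b c) = b * b - (+ 4) * (a * c)

Primitive : Form → Set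
Primitive (form a b c) = gcd (gcd a b) c ≡ 1ℤ

-- f(p x + q y, r x + s y)
act : Form → ℤ → ℤ → ℤ → ℤ → Form
act (form a b c) p q r s =
  form (a * (p * p) + b * (p * r) + c * (r * r))
       ((+ 2) * a * (p * q) + b * (p * s + q * r) + (+ 2) * c * (r * s))
       (a * (q * q) + b * (q * s) + c * (s * s))

Equiv : Form → Form → Set
Equiv f g = Σ ℤ λ p → Σ ℤ λ q → Σ ℤ λ r → Σ ℤ λ s →
  (p * s - q * r ≡ 1ℤ) × (g ≡ act f p q r s)

IsClassNumber : ℤ → ℕ → Set
IsClassNumber D n = Σ (Fin n → Form) λ rep →
    (∀ i → Primitive (rep i) × disc (rep i) ≡ D)
  × (∀ i j → Equiv (rep i) (rep j) → i ≡ j)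
  × (∀ f → Primitive f → disc f ≡ D → ∃ λ i → Equiv f (rep i))

{-# OPTIONS --safe #-}
module Submission where

-- Write p = 2k − 1, an odd number prime to k.
--
-- If z = 2m, then p^y = (kᵐ − x)(kᵐ + x) with coprime factors a^y < b^y, so that ab = p and a^y + b^y = 2kᵐ.
-- Comparing sizes leaves a = 1, excluded by divisibility, or m = 2 for y = 3 and m = 3, 4 for y = 5.  In these
-- cases (ab + 1)ᵐ = 2ᵐ⁻¹(a^y + b^y) is a plane curve, whose points of odd coordinates are controlled by expanding
-- b in fractional powers of a.
--
-- If z is odd, then α = x + w√k has norm (−p)^y, where w is a power of k.  Put b = x/w, a square root of k modulo p^y.
-- If some β of norm −p is congruent to a multiple of b + √k modulo p, then β divides α exactly y times, and the
-- quotient is a unit: Z₁ = 1.  Otherwise multiplication by the class of the ideal (p, b − √k), twisted by the sign of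
-- its norm, acts on the forms of discriminant 4k without fixed points, since a fixed point provides such a β.
-- Its y-th power is trivial because of α.  As y is prime, all orbits have y elements, and y divides h(4k): Z₁ = y.
-- Dividing by powers of the fundamental unit achieves the bound on |β/β̄|.  Reduced elements of given norm
-- are bounded, which decides between the two cases.

-- The class number is given only as the length of a list of representatives, so its divisibility
-- cannot be read off from a class group by Lagrange's theorem; it has to come from a permutation of
-- the representatives. Only multiplication by one class and its powers is needed, and matrix
-- equations between forms express it without a composition law. Proper equivalence sees
-- orientation: the matrices have determinant -p instead of p because α has norm (-p)^y, and
-- multiplication by α must close up the y-th iterate. The number p need not be prime. Unique
-- factorisation of ideals is replaced by congruences modulo p and p^y, in which 2 and k are units
-- because p + 1 = 2k; hence b, with b² ≡ k, is a unit too. Cancelling 2b is the step that makes the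
-- relation between forms single-valued and composable.

module Naturals where

  open import Data.Nat
  open import Data.Nat.Properties
  open import Data.Nat.DivMod using (m≡m%n+[m/n]*n; m%n<n; [m+kn]%n≡m%n)
  open import Data.Nat.Divisibility
  open import Data.Nat.GCD using (gcd; gcd[m,n]∣m; gcd[m,n]∣n; c*gcd[m,n]≡gcd[cm,cn])
  open import Data.Nat.Primality using (Irreducible; irreducible?)
  open import Data.Nat.Coprimality as Coprimality using (Coprime; coprime-divisor; gcd≡1⇒coprime)
  open import Data.Nat.Tactic.RingSolver using (solve-∀)
  open import Data.Product using (Σ; ∃; ∃₂; _×_; _,_)
  open import Data.Sum using (_⊎_; inj₁; inj₂)
  open import Data.Empty using (⊥; ⊥-elim)
  open import Relation.Nullary using (¬_; Dec; yes; no)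
  open import Relation.Nullary.Decidable using (toWitness; from-yes; from-no; ¬?; _→-dec_)
  open import Relation.Binary.PropositionalEquality
    using (_≡_; _≢_; refl; sym; trans; cong; cong₂; subst; subst₂; module ≡-Reasoning)

  -- Coprimality and factors of perfect powers

  coprime-* : ∀ {a b c} → Coprime a b → Coprime a c → Coprime a (b * c)
  coprime-* ab ac (d∣a , d∣bc) =
    ac (d∣a , coprime-divisor (λ (e∣d , e∣b) → ab (∣-trans e∣d d∣a , e∣b)) d∣bc)

  coprime-^ : ∀ {a b} n → Coprime a b → Coprime a (b ^ n)
  coprime-^ zero    ab (d∣a , d∣1) = ∣1⇒≡1 d∣1
  coprime-^ (suc n) ab = coprime-* ab (coprime-^ n ab)

  coprime-∣ˡ : ∀ {a b c} → a ∣ b → Coprime b c → Coprime a c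
  coprime-∣ˡ a∣b bc (d∣a , d∣c) = bc (∣-trans d∣a a∣b , d∣c)

  coprime-^ˡ : ∀ {a b} n → Coprime a b → Coprime (a ^ n) b
  coprime-^ˡ n ab = Coprimality.sym (coprime-^ n (Coprimality.sym ab))

  -- The root of `u` is `a = gcd(u, p)`. With `u = u′a` and `p = ba`, the cofactor `u′` is prime to
  -- `b` and divides `b^(n+1) · a^n`, hence `a^n`, so `u` divides `a^(n+1)`. Conversely `a^(n+1)`
  -- divides `uv` and is prime to `v`.
  coprime-factors-of-power : ∀ {u v p} n → p ≢ 0 → Coprime u v → u * v ≡ p ^ suc n →
    ∃₂ λ a b → a * b ≡ p × u ≡ a ^ suc n × v ≡ b ^ suc n
  coprime-factors-of-power {u} {v} {p} n p≢0 uv-coprime uv≡pⁿ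
    with gcd u p in gcd≡ | gcd[m,n]∣m u p | gcd[m,n]∣n u p
  ... | a | divides-refl u′ | divides-refl b = a , b , *-comm a b , u≡aⁿ , v≡bⁿ
    where
    instance
      a≢0 : NonZero a
      a≢0 = ≢-nonZero λ a≡0 → p≢0 (trans (cong (b *_) a≡0) (*-zeroʳ b))
      aⁿ≢0 : NonZero (a ^ suc n)
      aⁿ≢0 = m^n≢0 a (suc n)
    gcd-u′-b : gcd u′ b ≡ 1
    gcd-u′-b = *-cancelˡ-≡ _ _ a (begin
      a * gcd u′ b           ≡⟨ c*gcd[m,n]≡gcd[cm,cn] a u′ b ⟩
      gcd (a * u′) (a * b)   ≡⟨ cong₂ gcd (*-comm a u′) (*-comm a b) ⟩
      gcd (u′ * a) (b * a)   ≡⟨ gcd≡ ⟩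
      a                      ≡⟨ *-identityʳ a ⟨
      a * 1                  ∎)
      where open ≡-Reasoning
    pⁿ≡ : (b * a) ^ suc n ≡ a ^ suc n * b ^ suc n
    pⁿ≡ = trans (^-distribʳ-* (suc n) b a) (*-comm (b ^ suc n) (a ^ suc n))
      where
      ^-distribʳ-* : ∀ m x y → (x * y) ^ m ≡ x ^ m * y ^ m
      ^-distribʳ-* zero    x y = refl
      ^-distribʳ-* (suc m) x y = trans (cong (x * y *_) (^-distribʳ-* m x y)) (*-interchange x y (x ^ m) (y ^ m))
        where
        *-interchange : ∀ c d e f → c * d * (e * f) ≡ c * e * (d * f)
        *-interchange = solve-∀
    uv≡ : u′ * a * v ≡ a ^ suc n * b ^ suc n
    uv≡ = trans uv≡pⁿ pⁿ≡
    u′v≡ : u′ * v ≡ b ^ suc n * a ^ n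
    u′v≡ = *-cancelˡ-≡ _ _ a (trans (rearrange₁ a u′ v) (trans uv≡ (rearrange₂ a (a ^ n) (b ^ suc n))))
      where
      rearrange₁ : ∀ a u v → a * (u * v) ≡ u * a * v
      rearrange₁ = solve-∀
      rearrange₂ : ∀ a c d → a * c * d ≡ a * (d * c)
      rearrange₂ = solve-∀
    u∣aⁿ : u′ * a ∣ a ^ suc n
    u∣aⁿ = subst (_∣ a ^ suc n) (*-comm a u′) (*-monoʳ-∣ a
      (coprime-divisor (coprime-^ (suc n) (gcd≡1⇒coprime gcd-u′-b))
                       (subst (u′ ∣_) u′v≡ (m∣m*n v))))
    aⁿ∣u : a ^ suc n ∣ u′ * a
    aⁿ∣u = coprime-divisor (coprime-^ˡ (suc n) (coprime-∣ˡ (n∣m*n u′) uv-coprime))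
                           (subst (a ^ suc n ∣_) (trans (sym uv≡) (*-comm (u′ * a) v)) (m∣m*n _))
    u≡aⁿ : u′ * a ≡ a ^ suc n
    u≡aⁿ = ∣-antisym u∣aⁿ aⁿ∣u
    v≡bⁿ : v ≡ b ^ suc n
    v≡bⁿ = *-cancelˡ-≡ _ _ (a ^ suc n) (trans (cong (_* v) (sym u≡aⁿ)) uv≡)

  -- Certificates over ℕ and parity

  -- Inequalities are certified without subtraction. A combination of known equations gives `l ≡ r`,
  -- while the ring solver proves `l ≡ r + suc d` once variables are written as a lower bound plus
  -- an offset; the long polynomials in the certificates are what this expansion leaves, with
  -- nonnegative coefficients only.
  overshoot : ∀ {l r} d → l ≡ r → l ≡ r + suc d → ⊥
  overshoot {l} {r} d l≡r l≡r+d = m≢1+m+n r (trans (sym l≡r) (trans l≡r+d (+-suc r d)))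

  -- Elimination without subtraction: `x` collects the terms that cancel between the two sides.
  transpose : ∀ {l r a b} x → l ≡ r → l ≡ a + x → r ≡ b + x → a ≡ b
  transpose {a = a} {b} x l≡r l≡a+x r≡b+x = +-cancelʳ-≡ x a b (trans (sym l≡a+x) (trans l≡r r≡b+x))

  even⊎odd : ∀ n → (∃ λ i → n ≡ 2 * i) ⊎ (∃ λ i → n ≡ 1 + 2 * i)
  even⊎odd zero = inj₁ (0 , refl)
  even⊎odd (suc n) with even⊎odd n
  ... | inj₁ (i , refl) = inj₂ (i , refl)
  ... | inj₂ (i , refl) = inj₁ (suc i , cong suc (sym (+-suc i (i + 0))))

  odd-* : ∀ i j → (1 + 2 * i) * (1 + 2 * j) ≡ 1 + 2 * (i + j + 2 * (i * j))
  odd-* = solve-∀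

  odd-factor : ∀ a {b k} → a * b + 1 ≡ 2 * k → ∃ λ i → a ≡ 1 + 2 * i
  odd-factor a {b} {k} eq with even⊎odd a
  ... | inj₂ odd = odd
  ... | inj₁ (i , refl) = ⊥-elim (even≢odd k (i * b) (trans (sym eq) (rearrange i b)))
    where
    rearrange : ∀ i b → 2 * i * b + 1 ≡ 1 + 2 * (i * b)
    rearrange = solve-∀

  -- The curve (ab + 1)² = 2(a³ + b³)

  -- The range of `b` comes from `b ≤ 2a`, which holds whenever `a² > 2b`, together with `a < 6`.
  twice-sum-of-cubes-small : ∀ {a} → a < 6 → ∀ {b} → b < 11 → a < b →
    (a * b + 1) * (a * b + 1) ≢ 2 * (a * a * a + b * b * b)
  twice-sum-of-cubes-small = toWitness {a? = allUpTo? (λ a → allUpTo? (λ b →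
    (a <? b) →-dec ¬? ((a * b + 1) * (a * b + 1) ≟ 2 * (a * a * a + b * b * b))) 11) 6} _

  odd² : ∀ {a} i → a ≡ 1 + 2 * i → a * a ≡ 1 + 2 * (i + i + 2 * (i * i))
  odd² i refl = odd-* i i

  odd³ : ∀ {a} i → a ≡ 1 + 2 * i → let i₂ = i + i + 2 * (i * i) in
    a * a * a ≡ 1 + 2 * (i₂ + i + 2 * (i₂ * i))
  odd³ i refl = trans (cong (_* (1 + 2 * i)) (odd-* i i)) (odd-* (i + i + 2 * (i * i)) i)

  -- Solving (ab + 1)² = 2(a³ + b³) for large b gives b ≈ a²/2, which for odd a is never close enough to an integer.
  square≢twice-sum-of-cubes : ∀ {a b} → (∃ λ i → a ≡ 1 + 2 * i) → 1 < a → a < b →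
    (a * b + 1) * (a * b + 1) ≢ 2 * (a * a * a + b * b * b)
  square≢twice-sum-of-cubes {a} {b} (i , a-odd) 1<a a<b eq with ≤-total (a * a) (2 * b)
  ... | inj₁ a²≤2b = above (m≤n⇒∃[o]m+o≡n a²≤2b) (m≤n⇒∃[o]m+o≡n 1<a) (m≤n⇒∃[o]m+o≡n a<b)
    where
    certificate : ∀ {a b} a′ d e → 2 + a′ ≡ a → 1 + a + d ≡ b →
      2 * (a * a * a + b * b * b) + b * b * (a * a + (1 + e)) ≡
      (a * b + 1) * (a * b + 1) + b * b * (2 * b) + (1 + (11 + 20 * a′ + 11 * (a′ * a′) + 2 * (a′ * a′ * a′) + d * d + 2 * d + e * (b * b)))
    certificate a′ d e refl refl = identity a′ d e
      where
      identity : ∀ a′ d e → let a = 2 + a′ ; b = 1 + a + d in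
        2 * (a * a * a + b * b * b) + b * b * (a * a + (1 + e)) ≡
        (a * b + 1) * (a * b + 1) + b * b * (2 * b) + (1 + (11 + 20 * a′ + 11 * (a′ * a′) + 2 * (a′ * a′ * a′) + d * d + 2 * d + e * (b * b)))
      identity = solve-∀
    above : (∃ λ e → a * a + e ≡ 2 * b) → (∃ λ a′ → 2 + a′ ≡ a) → (∃ λ d → 1 + a + d ≡ b) → ⊥
    above (zero  , a²≡2b) _ _ = even≢odd b (i + i + 2 * (i * i)) (trans (sym a²≡2b) (trans (+-identityʳ _) (odd² i a-odd)))
    above (suc e , a²+e≡2b) (a′ , a≡) (d , b≡) =
      overshoot _ (cong₂ _+_ (sym eq) (cong (b * b *_) a²+e≡2b)) (certificate a′ d e a≡ b≡)
  ... | inj₂ 2b≤a² with m≤n⇒∃[o]m+o≡n 2b≤a²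
  ... | e , 2b+e≡a² = by-size (6 ≤? a)
    where
    -- Substituting `a² = 2b + e` both in `a²b²` and in `2a³` cancels the cubes of `b`. The equation
    -- left is quadratic in `b`, and any `e ≥ 1` bounds `b` by `2a`.
    eb² : e * (b * b) + 1 ≡ 2 * (a * b) + 2 * (a * e)
    eb² = transpose _ (cong₂ _+_ eq (cong₂ (λ u v → b * b * u + 2 * a * v) 2b+e≡a² (sym 2b+e≡a²)))
      (lhs a b e) (rhs a b e)
      where
      lhs : ∀ a b e → (a * b + 1) * (a * b + 1) + (b * b * (2 * b + e) + 2 * a * (a * a))
        ≡ e * (b * b) + 1 + (a * a * (b * b) + 2 * (a * b) + 2 * (b * b * b) + 2 * (a * a * a))
      lhs = solve-∀
      rhs : ∀ a b e → 2 * (a * a * a + b * b * b) + (b * b * (a * a) + 2 * a * (2 * b + e))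
        ≡ 2 * (a * b) + 2 * (a * e) + (a * a * (b * b) + 2 * (a * b) + 2 * (b * b * b) + 2 * (a * a * a))
      rhs = solve-∀
    e≢0 : e ≢ 0
    e≢0 refl = even≢odd b (i + i + 2 * (i * i)) (trans (sym (+-identityʳ (2 * b))) (trans 2b+e≡a² (odd² i a-odd)))
    b≤2a : b ≤ 2 * a
    b≤2a = ≮⇒≥ λ 2a<b → too-large (m≤n⇒∃[o]m+o≡n 2a<b) e e≢0 eb²
      where
      certificate : ∀ a d e → let b = 1 + 2 * a + d in
        (1 + e) * (b * b) + 1 ≡ 2 * (a * b) + 2 * (a * (1 + e)) + (1 + (1 + (2 * a + 2) * d + d * d + e * (2 * (a * a) + 2 * a + 1 + 2 * (a * a) + 4 * (a * d) + 2 * d + d * d)))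
      certificate = solve-∀
      too-large : ∀ {b} → ∃ (λ o → 1 + 2 * a + o ≡ b) → ∀ e → e ≢ 0 → e * (b * b) + 1 ≢ 2 * (a * b) + 2 * (a * e)
      too-large _ zero e≢0 = ⊥-elim (e≢0 refl)
      too-large (d , refl) (suc e) _ eq = overshoot _ eq (certificate a d e)
    by-size : _ → ⊥
    by-size (no 6≰a) = twice-sum-of-cubes-small (≰⇒> 6≰a) b<11 a<b eq
      where
      b<11 : b < 11
      b<11 = s≤s (≤-trans b≤2a (*-monoʳ-≤ 2 (s≤s⁻¹ (≰⇒> 6≰a))))
    by-size (yes 6≤a) =
      too-large (m≤n⇒∃[o]m+o≡n 6≤a) (m≤n⇒∃[o]m+o≡n a<b) (m≤n⇒∃[o]m+o≡n 3≤e) eb²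
      where
      -- For `a ≥ 6`, `a² = 2b + e` and `b ≤ 2a` give `e ≥ a² − 4a ≥ 2a ≥ 12`; already `e ≥ 3` is
      -- too large when `b > a`.
      3≤e : 3 ≤ e
      3≤e = ≤-trans (m≤m+n 3 9) (≤-trans (*-monoʳ-≤ 2 6≤a) (+-cancelˡ-≤ (4 * a) _ _ (begin
        4 * a + 2 * a   ≡⟨ *-distribʳ-+ a 4 2 ⟨
        6 * a           ≤⟨ *-monoˡ-≤ a 6≤a ⟩
        a * a           ≡⟨ 2b+e≡a² ⟨
        2 * b + e       ≤⟨ +-monoˡ-≤ e (*-monoʳ-≤ 2 b≤2a) ⟩
        2 * (2 * a) + e ≡⟨ cong (_+ e) (*-assoc 2 2 a) ⟨
        4 * a + e       ∎)))
        where open ≤-Reasoning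
      certificate : ∀ c d e → let a = 6 + c ; b = 1 + a + d in
        (3 + e) * (b * b) + 1 ≡ 2 * (a * b) + 2 * (a * (3 + e)) + (1 + (27 + 10 * c + 30 * d + 37 * e + c * c
          + 4 * (c * d) + 12 * (c * e) + 3 * (d * d) + 14 * (d * e) + c * c * e + 2 * (c * d * e) + d * d * e))
      certificate = solve-∀
      too-large : ∀ {a b e} → ∃ (λ o → 6 + o ≡ a) → ∃ (λ o → 1 + a + o ≡ b) → ∃ (λ o → 3 + o ≡ e) →
        e * (b * b) + 1 ≢ 2 * (a * b) + 2 * (a * e)
      too-large (c , refl) (d , refl) (e , refl) eq = overshoot _ eq (certificate c d e)

  -- The curve (ab + 1)⁴ = 8(a⁵ + b⁵)

  fourth-power-small : ∀ {a b} → a ≡ 3 → b < 12 → a < b →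
    (a * b + 1) * (a * b + 1) * (a * b + 1) * (a * b + 1) ≢ 8 * (a * a * a * a * a + b * b * b * b * b)
  fourth-power-small {b = b} refl = checked
    where
    checked : ∀ {b} → b < 12 → 3 < b →
      (3 * b + 1) * (3 * b + 1) * (3 * b + 1) * (3 * b + 1) ≢ 8 * (3 * 3 * 3 * 3 * 3 + b * b * b * b * b)
    checked = toWitness {a? = allUpTo? (λ b → (3 <? b) →-dec
      ¬? ((3 * b + 1) * (3 * b + 1) * (3 * b + 1) * (3 * b + 1) ≟ 8 * (3 * 3 * 3 * 3 * 3 + b * b * b * b * b))) 12} _

  -- Here b ≈ a⁴/8, and e = 8b − a⁴ is at least 7 since a⁴ ≡ 1 (mod 8).
  fourth-power≢8-fold-sum : ∀ {a b} → (∃ λ i → a ≡ 1 + 2 * i) → 1 < a → a < b →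
    (a * b + 1) * (a * b + 1) * (a * b + 1) * (a * b + 1) ≢ 8 * (a * a * a * a * a + b * b * b * b * b)
  fourth-power≢8-fold-sum {a} {b} (i , a-odd) 1<a a<b eq with ≤-total (8 * b) (a * a * a * a)
  ... | inj₁ 8b≤a⁴ = below (m≤n⇒∃[o]m+o≡n 8b≤a⁴) (m≤n⇒∃[o]m+o≡n 1<a) (m≤n⇒∃[o]m+o≡n (<⇒≤ a<b))
    where
    certificate : ∀ {a b} f c d → 2 + c ≡ a → a + d ≡ b →
      (a * b + 1) * (a * b + 1) * (a * b + 1) * (a * b + 1) + b * b * b * b * (8 * b + f) ≡
      8 * (a * a * a * a * a + b * b * b * b * b) + b * b * b * b * (a * a * a * a)
      + (1 + (4 * (a * a * a) * (3 * (a * a * d) + 3 * (a * d * d) + d * d * d) + 4 * (c * (a * a * a * a * a))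
        + f * (b * b * b * b) + 6 * (a * a * b * b) + 4 * (a * b)))
    certificate f c d refl refl = identity f c d
      where
      identity : ∀ f c d → let a = 2 + c ; b = a + d in
        (a * b + 1) * (a * b + 1) * (a * b + 1) * (a * b + 1) + b * b * b * b * (8 * b + f) ≡
        8 * (a * a * a * a * a + b * b * b * b * b) + b * b * b * b * (a * a * a * a)
        + (1 + (4 * (a * a * a) * (3 * (a * a * d) + 3 * (a * d * d) + d * d * d) + 4 * (c * (a * a * a * a * a))
          + f * (b * b * b * b) + 6 * (a * a * b * b) + 4 * (a * b)))
      identity = solve-∀
    below : (∃ λ f → 8 * b + f ≡ a * a * a * a) → (∃ λ c → 2 + c ≡ a) → (∃ λ d → a + d ≡ b) → ⊥
    below (f , 8b+f≡a⁴) (c , a≡) (d , b≡) =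
      overshoot _ (cong₂ _+_ eq (cong (b * b * b * b *_) 8b+f≡a⁴)) (certificate f c d a≡ b≡)
  ... | inj₂ a⁴≤8b with m≤n⇒∃[o]m+o≡n a⁴≤8b
  ... | e , a⁴+e≡8b = by-size (5 ≤? a)
    where
    t = i + i * i + 2 * ((i + i * i) * (i + i * i))
    a⁴≡1+8t : a * a * a * a ≡ 1 + 8 * t
    a⁴≡1+8t = identity i a-odd
      where
      identity : ∀ {a} i → a ≡ 1 + 2 * i → a * a * a * a ≡ 1 + 8 * (i + i * i + 2 * ((i + i * i) * (i + i * i)))
      identity i refl = identity′ i
        where
        identity′ : ∀ i → (1 + 2 * i) * (1 + 2 * i) * (1 + 2 * i) * (1 + 2 * i) ≡ 1 + 8 * (i + i * i + 2 * ((i + i * i) * (i + i * i)))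
        identity′ = solve-∀
    8t+1+e≡8b : 8 * t + (1 + e) ≡ 8 * b
    8t+1+e≡8b = trans (+-suc (8 * t) e) (trans (cong (_+ e) (sym a⁴≡1+8t)) a⁴+e≡8b)
    7≤e : 7 ≤ e
    7≤e = s≤s⁻¹ (+-cancelˡ-≤ (8 * t) 8 (1 + e) (begin
      8 * t + 8        ≡⟨ *-distribˡ-+ 8 t 1 ⟨
      8 * (t + 1)      ≤⟨ *-monoʳ-≤ 8 (subst (_≤ b) (+-comm 1 t) t<b) ⟩
      8 * b            ≡⟨ 8t+1+e≡8b ⟨
      8 * t + (1 + e)  ∎))
      where
      open ≤-Reasoning
      t<b : t < b
      t<b = *-cancelˡ-< 8 t b (subst (8 * t <_) 8t+1+e≡8b (m<m+n (8 * t) (s≤s z≤n)))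
    eb⁴ : e * (b * b * b * b) + 8 * (a * a * a * a * a) ≡
      4 * (a * a * a * b * b * b) + 6 * (a * a * b * b) + 4 * (a * b) + 1
    eb⁴ = sym (transpose (a * a * a * a * (b * b * b * b) + 8 * (b * b * b * b * b) )
      (cong₂ _+_ eq (cong (b * b * b * b *_) (sym a⁴+e≡8b))) (lhs a b) (rhs a b e))
      where
      lhs : ∀ a b → (a * b + 1) * (a * b + 1) * (a * b + 1) * (a * b + 1) + b * b * b * b * (8 * b)
        ≡ 4 * (a * a * a * b * b * b) + 6 * (a * a * b * b) + 4 * (a * b) + 1
          + (a * a * a * a * (b * b * b * b) + 8 * (b * b * b * b * b))
      lhs = solve-∀
      rhs : ∀ a b e → 8 * (a * a * a * a * a + b * b * b * b * b) + b * b * b * b * (a * a * a * a + e)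
        ≡ e * (b * b * b * b) + 8 * (a * a * a * a * a) + (a * a * a * a * (b * b * b * b) + 8 * (b * b * b * b * b))
      rhs = solve-∀
    -- For `a ≥ 5`, `5a³ ≤ 8b` bounds the main term `4a³b³` by `32b⁴/5 < 7b⁴ ≤ eb⁴`. The gap absorbs
    -- the lower terms because `25a² ≤ 8b` and `b ≥ 6`.
    large : 5 ≤ a → ⊥
    large 5≤a = contradictory (m≤n⇒∃[o]m+o≡n 7≤e) (m≤n⇒∃[o]m+o≡n 5a³≤8b) (m≤n⇒∃[o]m+o≡n 25a²≤8b)
      (m≤n⇒∃[o]m+o≡n (<⇒≤ 1<a)) (m≤n⇒∃[o]m+o≡n (≤-trans (s≤s 5≤a) a<b))
      where
      open ≤-Reasoning
      5a³≤8b : 5 * (a * a * a) ≤ 8 * b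
      5a³≤8b = begin
        5 * (a * a * a)     ≤⟨ *-monoˡ-≤ (a * a * a) 5≤a ⟩
        a * (a * a * a)     ≡⟨ *-comm a (a * a * a) ⟩
        a * a * a * a       ≤⟨ a⁴≤8b ⟩
        8 * b               ∎
      25a²≤8b : 25 * (a * a) ≤ 8 * b
      25a²≤8b = begin
        25 * (a * a)        ≡⟨ *-assoc 5 5 (a * a) ⟩
        5 * (5 * (a * a))   ≤⟨ *-monoʳ-≤ 5 (*-monoˡ-≤ (a * a) 5≤a) ⟩
        5 * (a * (a * a))   ≡⟨ cong (5 *_) (*-assoc a a a) ⟨
        5 * (a * a * a)     ≤⟨ 5a³≤8b ⟩
        8 * b               ∎
      certificate : ∀ {a b e} g o q c h → 7 + g ≡ e → 1 + c ≡ a → 6 + h ≡ b → let w = 5 + h + 6 * c + c * h in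
        5 * (e * (b * b * b * b) + 8 * (a * a * a * a * a)) + (4 * (b * b * b) * (5 * (a * a * a) + o) + 2 * (b * b) * (25 * (a * a) + q)) ≡
        5 * (4 * (a * a * a * b * b * b) + 6 * (a * a * b * b) + 4 * (a * b) + 1) + (4 * (b * b * b) * (8 * b) + 2 * (b * b) * (8 * b))
        + (1 + (5 * (g * (b * b * b * b)) + 40 * (a * a * a * a * a) + 4 * (o * (b * b * b)) + 2 * (q * (b * b)) + 20 * (a * b * w)
          + 3 * (h * (b * b * b)) + 426 + 2 * (108 * h + 18 * (h * h) + h * h * h)))
      certificate g o q c h refl refl refl = identity g o q c h
        where
        identity : ∀ g o q c h → let e = 7 + g ; a = 1 + c ; b = 6 + h ; w = 5 + h + 6 * c + c * h in
          5 * (e * (b * b * b * b) + 8 * (a * a * a * a * a)) + (4 * (b * b * b) * (5 * (a * a * a) + o) + 2 * (b * b) * (25 * (a * a) + q)) ≡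
          5 * (4 * (a * a * a * b * b * b) + 6 * (a * a * b * b) + 4 * (a * b) + 1) + (4 * (b * b * b) * (8 * b) + 2 * (b * b) * (8 * b))
          + (1 + (5 * (g * (b * b * b * b)) + 40 * (a * a * a * a * a) + 4 * (o * (b * b * b)) + 2 * (q * (b * b)) + 20 * (a * b * w)
            + 3 * (h * (b * b * b)) + 426 + 2 * (108 * h + 18 * (h * h) + h * h * h)))
        identity = solve-∀
      contradictory : (∃ λ g → 7 + g ≡ e) → (∃ λ o → 5 * (a * a * a) + o ≡ 8 * b) → (∃ λ q → 25 * (a * a) + q ≡ 8 * b) →
        (∃ λ c → 1 + c ≡ a) → (∃ λ h → 6 + h ≡ b) → ⊥
      contradictory (g , e≡) (o , 8b≡₁) (q , 8b≡₂) (c , a≡) (h , b≡) =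
        overshoot _ (cong₂ _+_ (cong (5 *_) eb⁴) (cong₂ _+_ (cong (4 * (b * b * b) *_) 8b≡₁) (cong (2 * (b * b) *_) 8b≡₂)))
          (certificate g o q c h e≡ a≡ b≡)
    -- For `a = 3` the bound `e ≥ 7` is too weak. Here `e = 8b − 81`, which is at least 15 for
    -- `b ≥ 12`, and then `eb⁴` outgrows the main term `108b³`. Smaller `b` are enumerated.
    small : a ≡ 3 → Dec (12 ≤ b) → ⊥
    small a≡3 (no 12≰b) = fourth-power-small a≡3 (≰⇒> 12≰b) a<b eq
    small a≡3 (yes 12≤b) = contradictory a≡3 (m≤n⇒∃[o]m+o≡n 12≤b) (m≤n⇒∃[o]m+o≡n (≤-trans (m≤m+n 1 11) 12≤b)) (m≤n⇒∃[o]m+o≡n 15≤e) eb⁴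
      where
      15≤e : 15 ≤ e
      15≤e = +-cancelˡ-≤ 81 15 e (≤-trans (*-monoʳ-≤ 8 12≤b)
        (≤-reflexive (trans (sym a⁴+e≡8b) (cong (λ a → a * a * a * a + e) a≡3))))
      certificate : ∀ {b} c h g x → 1 + c ≡ b →
        (15 + g) * (b * b * b * b) + x + 15 * (b * b * b) * (12 + h) ≡
        4 * (27 * b * b * b) + 6 * (9 * b * b) + 4 * (3 * b) + 1 + 15 * (b * b * b) * b
        + (1 + (4 + 6 * (16 * c + 27 * (c * c) + 12 * (c * c * c)) + g * (b * b * b * b) + x + 15 * (h * (b * b * b))))
      certificate c h g x refl = identity c h g x
        where
        identity : ∀ c h g x → let b = 1 + c in
          (15 + g) * (b * b * b * b) + x + 15 * (b * b * b) * (12 + h) ≡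
          4 * (27 * b * b * b) + 6 * (9 * b * b) + 4 * (3 * b) + 1 + 15 * (b * b * b) * b
          + (1 + (4 + 6 * (16 * c + 27 * (c * c) + 12 * (c * c * c)) + g * (b * b * b * b) + x + 15 * (h * (b * b * b))))
        identity = solve-∀
      contradictory : ∀ {a b e} → a ≡ 3 → (∃ λ h → 12 + h ≡ b) → (∃ λ c → 1 + c ≡ b) → (∃ λ g → 15 + g ≡ e) →
        e * (b * b * b * b) + 8 * (a * a * a * a * a) ≢
        4 * (a * a * a * b * b * b) + 6 * (a * a * b * b) + 4 * (a * b) + 1
      contradictory {b = b} refl (h , 12+h≡b) (c , 1+c≡b) (g , refl) eq =
        overshoot _ (cong₂ _+_ eq (cong (15 * (b * b * b) *_) 12+h≡b)) (certificate c h g _ 1+c≡b)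
    by-size : _ → ⊥
    by-size (yes 5≤a) = large 5≤a
    by-size (no 5≰a) = small (odd-between i a-odd 1<a (≰⇒> 5≰a)) (12 ≤? b)
      where
      odd-between : ∀ {a} i → a ≡ 1 + 2 * i → 1 < a → a < 5 → a ≡ 3
      odd-between 0 refl (s≤s ()) _
      odd-between 1 refl _ _ = refl
      odd-between (suc (suc i)) refl _ a<5 = ⊥-elim (≤⇒≯ (+-monoʳ-≤ 1 (*-monoʳ-≤ 2 (s≤s (s≤s z≤n)))) a<5)

  -- The curve (ab + 1)³ = 4(a⁵ + b⁵)

  -- The ranges come from the branch `b < 7a`: there `a ≥ 197` would give
  -- `a³ − 4b² ≥ a³ − 196a² ≥ a²`, which is incompatible with the equation. So `a ≤ 196` and
  -- `b < 7 · 196 = 1372`.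
  cube-small : ∀ {a b} → (∃ λ i → a ≡ 1 + 2 * i) → 1 < a → a < 197 → b < 1372 →
    (a * b + 1) * (a * b + 1) * (a * b + 1) ≢ 4 * (a * a * a * a * a + b * b * b * b * b)
  cube-small (i , refl) 1<a a<197 b<1372 eq = checked i<98 b<1372 1<a eq
    where
    i<98 : i < 98
    i<98 = *-cancelˡ-< 2 i 98 (s<s⁻¹ a<197)
    checked : ∀ {i} → i < 98 → ∀ {b} → b < 1372 → let a = 1 + 2 * i in 1 < a →
      (a * b + 1) * (a * b + 1) * (a * b + 1) ≢ 4 * (a * a * a * a * a + b * b * b * b * b)
    checked = toWitness {a? = allUpTo? (λ i → allUpTo? (λ b → let a = 1 + 2 * i in (1 <? a) →-dec
      ¬? ((a * b + 1) * (a * b + 1) * (a * b + 1) ≟ 4 * (a * a * a * a * a + b * b * b * b * b))) 1372) 98} _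

  -- The modulus is `8 · 169`. An odd square is 1 modulo 8 and 676 is 4, so only 5, 13 and 21 are
  -- possible for `g`. Modulo 13 the first and the last are the nonresidues 5 and 8, while 13 is
  -- divisible by 13 but not by 169. The next candidate, 29, does occur, which fixes the width of
  -- the window.
  odd-square-mod-1352 : ∀ f i g → 0 < g → g < 29 →
    (1 + 2 * f) * (1 + 2 * f) ≢ 676 * (1 + 2 * i) + g
  odd-square-mod-1352 f i g 0<g g<29 eq = checked (m%n<n f 676) 0<g g<29 (begin
    ((1 + 2 * ρ) * (1 + 2 * ρ)) % 1352 ≡⟨ [m+kn]%n≡m%n ((1 + 2 * ρ) * (1 + 2 * ρ)) (2 * (q * (1 + 2 * ρ)) + q * q * 1352) 1352 ⟨
    ((1 + 2 * ρ) * (1 + 2 * ρ) + (2 * (q * (1 + 2 * ρ)) + q * q * 1352) * 1352) % 1352 ≡⟨ cong (_% 1352) (expand-square ρ q) ⟨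
    ((1 + 2 * (ρ + q * 676)) * (1 + 2 * (ρ + q * 676))) % 1352 ≡⟨ cong (λ f → ((1 + 2 * f) * (1 + 2 * f)) % 1352) (m≡m%n+[m/n]*n f 676) ⟨
    ((1 + 2 * f) * (1 + 2 * f)) % 1352 ≡⟨ cong (_% 1352) eq ⟩
    (676 * (1 + 2 * i) + g) % 1352     ≡⟨ cong (_% 1352) (split i g) ⟩
    (676 + g + i * 1352) % 1352        ≡⟨ [m+kn]%n≡m%n (676 + g) i 1352 ⟩
    (676 + g) % 1352                   ∎)
    where
    open ≡-Reasoning
    ρ = f % 676
    q = f / 676
    expand-square : ∀ ρ q → (1 + 2 * (ρ + q * 676)) * (1 + 2 * (ρ + q * 676)) ≡
      (1 + 2 * ρ) * (1 + 2 * ρ) + (2 * (q * (1 + 2 * ρ)) + q * q * 1352) * 1352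
    expand-square = solve-∀
    split : ∀ i g → 676 * (1 + 2 * i) + g ≡ 676 + g + i * 1352
    split = solve-∀
    checked : ∀ {ρ} → ρ < 676 → ∀ {g} → 0 < g → g < 29 → ((1 + 2 * ρ) * (1 + 2 * ρ)) % 1352 ≢ (676 + g) % 1352
    checked ρ< 0<g g< = checked′ ρ< g< 0<g
      where
      checked′ : ∀ {ρ} → ρ < 676 → ∀ {g} → g < 29 → 0 < g → ((1 + 2 * ρ) * (1 + 2 * ρ)) % 1352 ≢ (676 + g) % 1352
      checked′ = toWitness {a? = allUpTo? (λ ρ → allUpTo? (λ g → (0 <? g) →-dec
        ¬? (((1 + 2 * ρ) * (1 + 2 * ρ)) % 1352 ≟ (676 + g) % 1352)) 29) 676} _

  -- Splitting `(ab)⁴` as `ab · b³ · a³` and inserting `a³ = 4b² + F` expands `Q²` around `4c²ab⁶`.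
  -- As `Q ≈ Fb³` in the application, this is the source of `F² ≈ 4c²a`, that is `676a` for
  -- `c = 13`.
  square-of-quotient : ∀ c {a b F Q A B} → A ≡ a * a * a → B ≡ b * b * b → 4 * (b * b) + F ≡ A → Q ≡ c * (a * b * (a * b)) →
    Q * Q ≡ 4 * (c * c * (a * (B * B))) + c * c * (a * b * (B * F))
  square-of-quotient c {a} {b} {F} refl refl 4b²+F≡a³ refl =
    trans (regroup c a b) (trans (cong (λ A → c * c * (a * b * (b * b * b) * A)) (sym 4b²+F≡a³)) (distribute c a b F))
    where
    regroup : ∀ c a b → c * (a * b * (a * b)) * (c * (a * b * (a * b))) ≡ c * c * (a * b * (b * b * b) * (a * a * a))
    regroup = solve-∀
    distribute : ∀ c a b F → c * c * (a * b * (b * b * b) * (4 * (b * b) + F)) ≡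
      4 * (c * c * (a * (b * b * b * (b * b * b)))) + c * c * (a * b * (b * b * b * F))
    distribute = solve-∀

  -- With `g ≤ r/16` the coefficients add up to at most `45 + 168/16 + 208/256 < 57`.
  cubic-bound : ∀ {κ m g A r} → 16 * g ≤ r → 57 * (m * A) ≤ κ * r →
    m * (45 * (A * (r * r)) + 168 * (g * A * r) + 208 * (g * g * A)) ≤ κ * (r * r * r)
  cubic-bound {κ} {m} {g} {A} {r} 16g≤r 57mA≤κr = ≤-trans (quadratic (m≤n⇒∃[o]m+o≡n 16g≤r)) (begin
    57 * (m * A) * (r * r)   ≤⟨ *-monoˡ-≤ (r * r) 57mA≤κr ⟩
    κ * r * (r * r)          ≡⟨ regroup κ r ⟩
    κ * (r * r * r)          ∎)
    where
    open ≤-Reasoning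
    regroup : ∀ κ r → κ * r * (r * r) ≡ κ * (r * r * r)
    regroup = solve-∀
    quadratic : ∀ {r} → (∃ λ x → 16 * g + x ≡ r) →
      m * (45 * (A * (r * r)) + 168 * (g * A * r) + 208 * (g * g * A)) ≤ 57 * (m * A) * (r * r)
    quadratic (x , refl) = subst (m * (45 * (A * ((16 * g + x) * (16 * g + x))) + 168 * (g * A * (16 * g + x)) + 208 * (g * g * A)) ≤_) (identity m g A x) (m≤m+n _ _)
      where
      identity : ∀ m g A x → let r = 16 * g + x in
        m * (45 * (A * (r * r)) + 168 * (g * A * r) + 208 * (g * g * A)) + m * A * (176 * (g * g) + 216 * (g * x) + 12 * (x * x)) ≡
        57 * (m * A) * (r * r)
      identity = solve-∀

  -- For `F² = 4c²a + κ + n` the three relations are added with weights `r`, `r³` and `c²B`, so that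
  -- `r³F²`, `4c²ar³` and `c²BFrs` cancel. What is left bounds `κr³` by lower powers of `r`.
  eliminate : ∀ κ c {a r F s n} → let A = a * a * a ; B = 4 * (a * a) + r ; Q = F * r + 3 * s + 1 in
    4 * (c * c) * a + κ + n ≡ F * F → Q * Q ≡ 4 * (c * c * (a * (B * B))) + c * c * (s * (B * F)) → F * r * s + 3 * (s * s) + s ≡ c * (A * B) →
    κ * (r * r * r) + (r * (n * (r * r) + 2 * (F * (r * (3 * s + 1))) + 9 * (s * s) + 6 * s + 1) + c * c * (B * (3 * (s * s) + s))) ≡
    c * c * ((32 + c) * (A * (r * r)) + (64 + 8 * c) * (a * a * A * r) + 16 * (c * (a * a * (a * a) * A)))
  eliminate κ c {a} {r} {F} {s} {n} e Q² Frs = transpose _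
    (cong₂ _+_ (cong (r *_) Q²) (cong₂ _+_ (cong (r * r * r *_) e) (cong (c * c * (4 * (a * a) + r) *_) Frs)))
    (lhs κ c a r F s n) (rhs c a r F s)
    where
    lhs : ∀ κ c a r F s n → let B = 4 * (a * a) + r ; Q = F * r + 3 * s + 1 in
      r * (Q * Q) + (r * r * r * (4 * (c * c) * a + κ + n) + c * c * B * (F * r * s + 3 * (s * s) + s)) ≡
      κ * (r * r * r) + (r * (n * (r * r) + 2 * (F * (r * (3 * s + 1))) + 9 * (s * s) + 6 * s + 1) + c * c * (B * (3 * (s * s) + s)))
      + (r * r * r * (F * F) + 4 * (c * c * (a * (r * r * r))) + c * c * (B * (F * r * s)))
    lhs = solve-∀
    rhs : ∀ c a r F s → let A = a * a * a ; B = 4 * (a * a) + r in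
      r * (4 * (c * c * (a * (B * B))) + c * c * (s * (B * F))) + (r * r * r * (F * F) + c * c * B * (c * (A * B))) ≡
      c * c * ((32 + c) * (A * (r * r)) + (64 + 8 * c) * (a * a * A * r) + 16 * (c * (a * a * (a * a) * A)))
      + (r * r * r * (F * F) + 4 * (c * c * (a * (r * r * r))) + c * c * (B * (F * r * s)))
    rhs = solve-∀

  -- Runge's method at the point at infinity with b ≈ a^(3/2)/2: there F = a³ − 4b² satisfies F ≈ 26√a, and the
  -- integer F² − 676a tends to 0.  It lies strictly between 0 and 29 once b ≥ 7a, which is impossible modulo 1352.
  module Runge {a b F r} (a⁺ : 0 < a) (b⁺ : 0 < b)
    (4b²+F≡a³ : 4 * (b * b) + F ≡ a * a * a) (4a²+r≡b³ : 4 * (a * a) + r ≡ b * b * b)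
    (Fr : F * r + 3 * (a * b) + 1 ≡ 13 * (a * b * (a * b))) where

    squared : let s = a * b ; B = 4 * (a * a) + r ; Q = F * r + 3 * s + 1 in
      Q * Q ≡ 4 * (169 * (a * (B * B))) + 169 * (s * (B * F))
    squared = square-of-quotient 13 {a} {b} {F} refl 4a²+r≡b³ 4b²+F≡a³ Fr

    F²>676a : 676 * a < F * F
    F²>676a = ≰⇒> λ F²≤676a → contradictory (m≤n⇒∃[o]m+o≡n F²≤676a) (m≤n⇒∃[o]m+o≡n (*-mono-≤ a⁺ b⁺)) squared a²∙4b²+F
      where
      a²∙4b²+F : 4 * (a * b * (a * b)) + a * a * F ≡ a * a * (a * a * a)
      a²∙4b²+F = trans (factor a b F) (cong (a * a *_) 4b²+F≡a³)
        where
        factor : ∀ a b F → 4 * (a * b * (a * b)) + a * a * F ≡ a * a * (4 * (b * b) + F)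
        factor = solve-∀
      certificate : ∀ a r F n w → let s = 1 + w ; B = 4 * (a * a) + r ; Q = F * r + 3 * s + 1 in
        4 * (169 * (a * (B * B))) + 169 * (s * (B * F)) + (r * r * (F * F + n) + 16 * (4 * (s * s) + a * a * F)) ≡
        Q * Q + (r * r * (676 * a) + 16 * (a * a * (a * a * a)))
        + (1 + (47 + 104 * w + 161 * (F * r) + 55 * (w * w) + 692 * (F * a * a) + 163 * (F * r * w) + n * r * r
          + 676 * (F * a * a * w) + 5408 * (a * a * a * r) + 10800 * (a * a * a * a * a)))
      certificate = solve-∀
      contradictory : ∀ {s} → (∃ λ n → F * F + n ≡ 676 * a) → (∃ λ w → 1 + w ≡ s) →
        let B = 4 * (a * a) + r ; Q = F * r + 3 * s + 1 in
        Q * Q ≡ 4 * (169 * (a * (B * B))) + 169 * (s * (B * F)) → 4 * (s * s) + a * a * F ≡ a * a * (a * a * a) → ⊥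
      contradictory (n , F²+n≡676a) (w , refl) Q² a²∙ = overshoot _
        (cong₂ _+_ (sym Q²) (cong₂ _+_ (cong (r * r *_) F²+n≡676a) (cong (16 *_) a²∙)))
        (certificate a r F n w)

    F²<676a+29 : 7 * a ≤ b → F * F < 676 * a + 29
    F²<676a+29 7a≤b = ≰⇒> λ ≤F² → contradictory (m≤n⇒∃[o]m+o≡n ≤F²) squared Frs
      where
      open ≤-Reasoning
      a²≤a³ : a * a ≤ a * a * a
      a²≤a³ = m≤m*n (a * a) a {{>-nonZero a⁺}}
      cube-of-7a : ∀ a → 4 * (a * a * a) + 339 * (a * a * a) ≡ 7 * a * (7 * a) * (7 * a)
      cube-of-7a = solve-∀
      -- `339 = 7³ − 4`, and `cubic-bound` demands `57 · 169 = 9633 ≤ 29 · 339 = 9831`. The factor 7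
      -- in `b ≥ 7a` is the least integer for which this estimate succeeds.
      339a³≤r : 339 * (a * a * a) ≤ r
      339a³≤r = +-cancelˡ-≤ (4 * (a * a)) _ _ (begin
        4 * (a * a) + 339 * (a * a * a)     ≤⟨ +-monoˡ-≤ (339 * (a * a * a)) (*-monoʳ-≤ 4 a²≤a³) ⟩
        4 * (a * a * a) + 339 * (a * a * a) ≡⟨ cube-of-7a a ⟩
        7 * a * (7 * a) * (7 * a)           ≤⟨ *-mono-≤ (*-mono-≤ 7a≤b 7a≤b) 7a≤b ⟩
        b * b * b                           ≡⟨ 4a²+r≡b³ ⟨
        4 * (a * a) + r                     ∎)
      16a²≤r : 16 * (a * a) ≤ r
      16a²≤r = ≤-trans (*-mono-≤ (m≤m+n 16 323) a²≤a³) 339a³≤r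
      9633a³≤29r : 57 * (169 * (a * a * a)) ≤ 29 * r
      9633a³≤29r = begin
        57 * (169 * (a * a * a))  ≡⟨ *-assoc 57 169 (a * a * a) ⟨
        9633 * (a * a * a)        ≤⟨ *-monoˡ-≤ (a * a * a) (m≤m+n 9633 198) ⟩
        9831 * (a * a * a)        ≡⟨ *-assoc 29 339 (a * a * a) ⟩
        29 * (339 * (a * a * a))  ≤⟨ *-monoʳ-≤ 29 339a³≤r ⟩
        29 * r                    ∎
      r>0 : 0 < r
      r>0 = ≤-trans (*-mono-≤ (s≤s (z≤n {338})) (*-mono-≤ (*-mono-≤ a⁺ a⁺) a⁺)) 339a³≤r
      Frs : let s = a * b in F * r * s + 3 * (s * s) + s ≡ 13 * (a * a * a * (4 * (a * a) + r))
      Frs = trans (expand F r (a * b)) (trans (cong (_* (a * b)) Fr) (trans (regroup a b) (cong (λ B → 13 * (a * a * a * B)) (sym 4a²+r≡b³))))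
        where
        expand : ∀ F r s → F * r * s + 3 * (s * s) + s ≡ (F * r + 3 * s + 1) * s
        expand = solve-∀
        regroup : ∀ a b → 13 * (a * b * (a * b)) * (a * b) ≡ 13 * (a * a * a * (b * b * b))
        regroup = solve-∀
      contradictory : ∀ {s} → let A = a * a * a ; B = 4 * (a * a) + r ; Q = F * r + 3 * s + 1 in
        (∃ λ n → 676 * a + 29 + n ≡ F * F) → Q * Q ≡ 4 * (169 * (a * (B * B))) + 169 * (s * (B * F)) →
        F * r * s + 3 * (s * s) + s ≡ 13 * (A * B) → ⊥
      contradictory {s} (n , e) Q² Frs = <⇒≱ (≤-<-trans (cubic-bound {29} {169} {a * a} {a * a * a} 16a²≤r 9633a³≤29r) (m<m+n (29 * (r * r * r)) P>0)) (≤-reflexive eliminated)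
        where
        P = r * (n * (r * r) + 2 * (F * (r * (3 * s + 1))) + 9 * (s * s) + 6 * s + 1) + 169 * ((4 * (a * a) + r) * (3 * (s * s) + s))
        P>0 : 0 < P
        P>0 = ≤-trans (*-mono-≤ r>0 (m≤n+m 1 _)) (m≤m+n _ (169 * ((4 * (a * a) + r) * (3 * (s * s) + s))))
        eliminated : 29 * (r * r * r) + P ≡ 169 * (45 * (a * a * a * (r * r)) + 168 * (a * a * (a * a * a) * r) + 208 * (a * a * (a * a) * (a * a * a)))
        eliminated = trans (eliminate 29 13 {a} {r} {F} {s} {n} e Q² Frs)
          (cong (λ x → 169 * (45 * (a * a * a * (r * r)) + 168 * (a * a * (a * a * a) * r) + x)) (sym (*-assoc 16 13 (a * a * (a * a) * (a * a * a)))))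

  3≤odd : ∀ {a} → (∃ λ i → a ≡ 1 + 2 * i) → 1 < a → 3 ≤ a
  3≤odd (zero  , refl) (s≤s ())
  3≤odd (suc i , refl) _ = s≤s (*-monoʳ-≤ 2 (s≤s z≤n))

  gap : ∀ {l n c} → l < n → n < l + c → ∃ λ g → l + g ≡ n × 0 < g × g < c
  gap {l} {n} {c} l<n n<l+c with m≤n⇒∃[o]m+o≡n (<⇒≤ l<n)
  ... | g , refl = g , refl , +-cancelˡ-< l 0 g (subst (_< l + g) (sym (+-identityʳ l)) l<n) , +-cancelˡ-< l g c n<l+c

  odd-square-gap : ∀ {a F} → (∃ λ f → F ≡ 1 + 2 * f) → (∃ λ i → a ≡ 1 + 2 * i) → 676 * a < F * F → F * F < 676 * a + 29 → ⊥
  odd-square-gap {a} {F} (f , F-odd) (i , a-odd) 676a<F² F²<676a+29 with gap {676 * a} {F * F} {29} 676a<F² F²<676a+29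
  ... | g , 676a+g≡F² , 0<g , g<29 = odd-square-mod-1352 f i g 0<g g<29
    (trans (sym (cong₂ _*_ F-odd F-odd)) (trans (sym 676a+g≡F²) (cong (λ a → 676 * a + g) a-odd)))

  cube≢4-fold-sum : ∀ {a b} → (∃ λ i → a ≡ 1 + 2 * i) → 1 < a → a < b →
    (a * b + 1) * (a * b + 1) * (a * b + 1) ≢ 4 * (a * a * a * a * a + b * b * b * b * b)
  cube≢4-fold-sum {a} {b} odd@(i , a-odd) 1<a a<b eq
    with m≤n⇒∃[o]m+o≡n {4 * (a * a)} {b * b * b} (subst (_≤ b * b * b) (*-comm (a * a) 4) (*-mono-≤ (*-mono-≤ (<⇒≤ a<b) (<⇒≤ a<b)) (≤-trans (s≤s (3≤odd odd 1<a)) a<b)))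
  ... | r , 4a²+r≡b³ = by-sign (≤-total (a * a * a) (4 * (b * b)))
    where
    a⁺ : 0 < a
    a⁺ = <⇒≤ 1<a
    b⁺ : 0 < b
    b⁺ = ≤-<-trans z≤n a<b
    -- The equation is equivalent to `(a³ − 4b²)(b³ − 4a²) = 13(ab)² − 3ab − 1`, where
    -- `13 = 16 − 3`. The right side is positive and the second factor nonnegative, so the first
    -- factor must be positive.
    negative : (∃ λ E → a * a * a + E ≡ 4 * (b * b)) → (∃ λ w → 1 + w ≡ a * b) → ⊥
    negative (E , a³+E≡4b²) (w , 1+w≡ab) = contradictory 1+w≡ab
      (transpose _ (cong₂ _+_ (sym eq) (cong₂ _+_ (cong₂ _+_ (cong (b * b * b *_) a³+E≡4b²) (cong (4 * (a * a) *_) (sym a³+E≡4b²))) (cong (E *_) 4a²+r≡b³)))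
        (lhs a b E r) (rhs a b E))
      where
      lhs : ∀ a b E r → 4 * (a * a * a * a * a + b * b * b * b * b) + (b * b * b * (a * a * a + E) + 4 * (a * a) * (4 * (b * b)) + E * (4 * (a * a) + r)) ≡
        13 * (a * b * (a * b)) + E * r + (4 * (a * a * a * a * a) + 4 * (b * b * b * b * b) + a * a * a * (b * b * b) + b * b * b * E + 4 * (a * a * E) + 3 * (a * b * (a * b)))
      lhs = solve-∀
      rhs : ∀ a b E → (a * b + 1) * (a * b + 1) * (a * b + 1) + (b * b * b * (4 * (b * b)) + 4 * (a * a) * (a * a * a + E) + E * (b * b * b)) ≡
        3 * (a * b) + 1 + (4 * (a * a * a * a * a) + 4 * (b * b * b * b * b) + a * a * a * (b * b * b) + b * b * b * E + 4 * (a * a * E) + 3 * (a * b * (a * b)))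
      rhs = solve-∀
      certificate : ∀ w x → let s = 1 + w in 13 * (s * s) + x ≡ 3 * s + 1 + (1 + (8 + 23 * w + 13 * (w * w) + x))
      certificate = solve-∀
      contradictory : ∀ {s} → 1 + w ≡ s → 13 * (s * s) + E * r ≢ 3 * s + 1
      contradictory refl eq = overshoot _ eq (certificate w (E * r))
    positive : (∃ λ F → 4 * (b * b) + F ≡ a * a * a) → ⊥
    positive (F , 4b²+F≡a³) = by-size (7 * a ≤? b)
      where
      open ≤-Reasoning
      Fr : F * r + 3 * (a * b) + 1 ≡ 13 * (a * b * (a * b))
      Fr = transpose _ (cong₂ _+_ eq (cong₂ _+_ (cong₂ _+_ (cong (b * b * b *_) 4b²+F≡a³) (cong (4 * (a * a) *_) (sym 4b²+F≡a³))) (cong (F *_) 4a²+r≡b³)))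
        (lhs a b F r) (rhs a b F)
        where
        lhs : ∀ a b F r → (a * b + 1) * (a * b + 1) * (a * b + 1) + (b * b * b * (4 * (b * b) + F) + 4 * (a * a) * (a * a * a) + F * (4 * (a * a) + r)) ≡
          F * r + 3 * (a * b) + 1 + (a * a * a * (b * b * b) + 3 * (a * b * (a * b)) + 4 * (b * b * b * b * b) + b * b * b * F + 4 * (a * a * a * a * a) + 4 * (a * a * F))
        lhs = solve-∀
        rhs : ∀ a b F → 4 * (a * a * a * a * a + b * b * b * b * b) + (b * b * b * (a * a * a) + 4 * (a * a) * (4 * (b * b) + F) + F * (b * b * b)) ≡
          13 * (a * b * (a * b)) + (a * a * a * (b * b * b) + 3 * (a * b * (a * b)) + 4 * (b * b * b * b * b) + b * b * b * F + 4 * (a * a * a * a * a) + 4 * (a * a * F))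
        rhs = solve-∀
      open Runge a⁺ b⁺ 4b²+F≡a³ 4a²+r≡b³ Fr
      large : 7 * a ≤ b → ⊥
      large 7a≤b = by-parity (even⊎odd F)
        where
        by-parity : (∃ λ f → F ≡ 2 * f) ⊎ (∃ λ f → F ≡ 1 + 2 * f) → ⊥
        by-parity (inj₂ F-odd) = odd-square-gap F-odd odd F²>676a (F²<676a+29 7a≤b)
        by-parity (inj₁ (f , F≡2f)) = even≢odd (2 * (b * b) + f) (i₂ + i + 2 * (i₂ * i)) (trans (regroup b f)
          (trans (cong (4 * (b * b) +_) (sym F≡2f)) (trans 4b²+F≡a³ (odd³ i a-odd))))
          where
          i₂ = i + i + 2 * (i * i)
          regroup : ∀ b f → 2 * (2 * (b * b) + f) ≡ 4 * (b * b) + 2 * f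
          regroup = solve-∀
      a²≤F : b < 7 * a → 197 ≤ a → a * a ≤ F
      a²≤F b<7a 197≤a = +-cancelˡ-≤ (196 * (a * a)) _ _ (begin
        196 * (a * a) + a * a       ≡⟨ +-comm (196 * (a * a)) (a * a) ⟩
        197 * (a * a)               ≤⟨ *-monoˡ-≤ (a * a) 197≤a ⟩
        a * (a * a)                 ≡⟨ *-assoc a a a ⟨
        a * a * a                   ≡⟨ 4b²+F≡a³ ⟨
        4 * (b * b) + F             ≤⟨ +-monoˡ-≤ F (*-monoʳ-≤ 4 (*-mono-≤ (<⇒≤ b<7a) (<⇒≤ b<7a))) ⟩
        4 * (7 * a * (7 * a)) + F   ≡⟨ cong (_+ F) (square a) ⟩
        196 * (a * a) + F           ∎)
        where
        square : ∀ a → 4 * (7 * a * (7 * a)) ≡ 196 * (a * a)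
        square = solve-∀
      13b²≤r : 197 ≤ a → 13 * (b * b) ≤ r
      13b²≤r 197≤a = +-cancelˡ-≤ (4 * (a * a)) _ _ (begin
        4 * (a * a) + 13 * (b * b)  ≤⟨ +-monoˡ-≤ (13 * (b * b)) (*-monoʳ-≤ 4 (*-mono-≤ (<⇒≤ a<b) (<⇒≤ a<b))) ⟩
        4 * (b * b) + 13 * (b * b)  ≡⟨ *-distribʳ-+ (b * b) 4 13 ⟨
        17 * (b * b)                ≤⟨ *-monoˡ-≤ (b * b) (≤-trans (m≤m+n 17 180) (≤-trans 197≤a (<⇒≤ a<b))) ⟩
        b * (b * b)                 ≡⟨ *-assoc b b b ⟨
        b * b * b                   ≡⟨ 4a²+r≡b³ ⟨
        4 * (a * a) + r             ∎)
      a<197 : b < 7 * a → a < 197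
      a<197 b<7a = ≰⇒> λ 197≤a → <-irrefl refl (begin-strict
        13 * (a * b * (a * b))      ≡⟨ regroup a b ⟩
        a * a * (13 * (b * b))      ≤⟨ *-mono-≤ (a²≤F b<7a 197≤a) (13b²≤r 197≤a) ⟩
        F * r                       ≤⟨ m≤m+n (F * r) (3 * (a * b)) ⟩
        F * r + 3 * (a * b)         <⟨ m<m+n _ (s≤s z≤n) ⟩
        F * r + 3 * (a * b) + 1     ≡⟨ Fr ⟩
        13 * (a * b * (a * b))      ∎)
        where
        regroup : ∀ a b → 13 * (a * b * (a * b)) ≡ a * a * (13 * (b * b))
        regroup = solve-∀
      by-size : Dec (7 * a ≤ b) → ⊥
      by-size (yes 7a≤b) = large 7a≤b
      by-size (no 7a≰b) = cube-small odd 1<a (a<197 b<7a) (≤-trans b<7a (≤-trans (*-monoʳ-≤ 7 (s≤s⁻¹ (a<197 b<7a))) ≤-refl)) eq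
        where
        b<7a = ≰⇒> 7a≰b
    by-sign : _ → ⊥
    by-sign (inj₁ a³≤4b²) = negative (m≤n⇒∃[o]m+o≡n a³≤4b²) (m≤n⇒∃[o]m+o≡n (*-mono-≤ a⁺ b⁺))
    by-sign (inj₂ 4b²≤a³) = positive (m≤n⇒∃[o]m+o≡n 4b²≤a³)

  -- Size of the exponent, the case a = 1, and exclusion of even z

  ^-distribʳ-* : ∀ n a b → (a * b) ^ n ≡ a ^ n * b ^ n
  ^-distribʳ-* zero    a b = refl
  ^-distribʳ-* (suc n) a b = trans (cong (a * b *_) (^-distribʳ-* n a b)) (*-interchange a b (a ^ n) (b ^ n))
    where
    *-interchange : ∀ c d e f → c * d * (e * f) ≡ c * e * (d * f)
    *-interchange = solve-∀

  -- As `a ≥ 2`, `(2k)^(y+1) > (ab)^(y+1) ≥ 2^y (a^(y+1) + b^(y+1)) = 2^(y+1) kᵐ`, whence `m ≤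
  -- y`. As `2k ≤ b²`, `2m ≤ y` would give `2(2k)ᵐ ≤ b^(y+1) <
  -- 2kᵐ`. For the exponents 3 and 5 this leaves `m = 2` and `m = 3, 4`.
  module PowerSum {k a b y m} (1<k : 1 < k) (1<a : 1 < a) (a<b : a < b) (ab+1≡2k : a * b + 1 ≡ 2 * k)
    (sum : a ^ suc y + b ^ suc y ≡ 2 * k ^ m) where
    open ≤-Reasoning
    instance
      k≢0 : NonZero k
      k≢0 = >-nonZero (<⇒≤ 1<k)
      b≢0 : NonZero b
      b≢0 = >-nonZero (≤-<-trans z≤n a<b)

    exponent< : m < suc y
    exponent< = ≰⇒> λ y<m → <-irrefl refl (begin-strict
      2 ^ y * (2 * k ^ m)                     ≡⟨ cong (2 ^ y *_) sum ⟨
      2 ^ y * (a ^ suc y + b ^ suc y)         ≤⟨ *-monoʳ-≤ (2 ^ y) (+-monoˡ-≤ (b ^ suc y) (^-monoˡ-≤ (suc y) (<⇒≤ a<b))) ⟩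
      2 ^ y * (b ^ suc y + b ^ suc y)         ≡⟨ regroup (2 ^ y) (b ^ suc y) ⟩
      2 ^ suc y * b ^ suc y                   ≤⟨ *-monoˡ-≤ (b ^ suc y) (^-monoˡ-≤ (suc y) 1<a) ⟩
      a ^ suc y * b ^ suc y                   ≡⟨ ^-distribʳ-* (suc y) a b ⟨
      (a * b) ^ suc y                         <⟨ ^-monoˡ-< (suc y) (m<m+n (a * b) (s≤s z≤n)) ⟩
      (a * b + 1) ^ suc y                     ≡⟨ cong (_^ suc y) ab+1≡2k ⟩
      (2 * k) ^ suc y                         ≡⟨ ^-distribʳ-* (suc y) 2 k ⟩
      2 ^ suc y * k ^ suc y                   ≤⟨ *-monoʳ-≤ (2 ^ suc y) (^-monoʳ-≤ k y<m) ⟩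
      2 ^ suc y * k ^ m                       ≡⟨ regroup′ (2 ^ y) (k ^ m) ⟩
      2 ^ y * (2 * k ^ m)                     ∎)
      where
      regroup : ∀ t u → t * (u + u) ≡ 2 * t * u
      regroup = solve-∀
      regroup′ : ∀ t u → 2 * t * u ≡ t * (2 * u)
      regroup′ = solve-∀

    ab+1≤b² : a * b + 1 ≤ b * b
    ab+1≤b² = begin
      a * b + 1   ≤⟨ +-monoʳ-≤ (a * b) (≤-<-trans z≤n a<b) ⟩
      a * b + b   ≡⟨ +-comm (a * b) b ⟩
      suc a * b   ≤⟨ *-monoˡ-≤ b a<b ⟩
      b * b       ∎

    bʸ<2kᵐ : b ^ suc y < 2 * k ^ m
    bʸ<2kᵐ = subst (b ^ suc y <_) sum (m<n+m (b ^ suc y) (m^n>0 a {{>-nonZero (<⇒≤ 1<a)}} (suc y)))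

    2*exponent>y : y < 2 * m
    2*exponent>y = ≰⇒> λ 2m≤y → <-irrefl refl (begin-strict
      2 ^ m * (2 * k ^ m)     ≡⟨ regroup (2 ^ m) (k ^ m) ⟩
      2 * (2 ^ m * k ^ m)     ≡⟨ cong (2 *_) (^-distribʳ-* m 2 k) ⟨
      2 * (2 * k) ^ m         ≡⟨ cong (λ n → 2 * n ^ m) ab+1≡2k ⟨
      2 * (a * b + 1) ^ m     ≤⟨ *-monoʳ-≤ 2 (^-monoˡ-≤ m ab+1≤b²) ⟩
      2 * (b * b) ^ m         ≡⟨ cong (2 *_) (trans (^-distribʳ-* m b b) (sym (^-distribˡ-+-* b m m))) ⟩
      2 * b ^ (m + m)         ≡⟨ cong (λ n → 2 * b ^ (m + n)) (+-identityʳ m) ⟨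
      2 * b ^ (2 * m)         ≤⟨ *-monoʳ-≤ 2 (^-monoʳ-≤ b 2m≤y) ⟩
      2 * b ^ y               ≤⟨ *-monoˡ-≤ (b ^ y) (≤-trans 1<a (<⇒≤ a<b)) ⟩
      b ^ suc y               <⟨ bʸ<2kᵐ ⟩
      2 * k ^ m               ≤⟨ m≤n*m (2 * k ^ m) (2 ^ m) {{m^n≢0 2 m}} ⟩
      2 ^ m * (2 * k ^ m)     ∎)
      where
      regroup : ∀ t u → t * (2 * u) ≡ 2 * (t * u)
      regroup = solve-∀

  cube-form : ∀ n → n ^ 3 ≡ n * n * n
  cube-form = identity
    where
    identity : ∀ n → n * (n * (n * 1)) ≡ n * n * n
    identity = solve-∀

  fifth-power-form : ∀ n → n ^ 5 ≡ n * n * n * n * n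
  fifth-power-form = identity
    where
    identity : ∀ n → n * (n * (n * (n * (n * 1)))) ≡ n * n * n * n * n
    identity = solve-∀

  -- Applied to the cofactor V of 1 + b in 1 + bʸ, with q = y: V ≡ y modulo 1 + b = 2k.
  only-power : ∀ {q k V} → Irreducible q → 1 < k → ∀ n {c c′} → V + k * c ≡ k * c′ + q → 1 < V → k ^ n ≡ V → k ≡ q
  only-power q-irr 1<k zero _ 1<V 1≡V = ⊥-elim (<-irrefl 1≡V 1<V)
  only-power {q} {k} {V} q-irr 1<k (suc n) {c} {c′} V≡q _ kⁿ≡V with q-irr k∣q
    where
    k∣q : k ∣ q
    k∣q = ∣m+n∣m⇒∣n (subst (k ∣_) V≡q (∣m∣n⇒∣m+n (subst (k ∣_) kⁿ≡V (m∣m*n (k ^ n))) (m∣m*n c))) (m∣m*n c′)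
  ... | inj₁ k≡1 = ⊥-elim (<-irrefl (sym k≡1) 1<k)
  ... | inj₂ k≡q = k≡q

  power-through-k : ∀ {k V N} → 1 < k → N ≡ 2 * (k * V) → ∀ m → N ≡ 2 * k ^ m → ∃ λ n → k ^ n ≡ V
  power-through-k {k} {V} 1<k N≡ zero N≡2 =
    ⊥-elim (<-irrefl (sym (m*n≡1⇒m≡1 k V (*-cancelˡ-≡ _ _ 2 (trans (sym N≡) N≡2)))) 1<k)
  power-through-k {k} {V} 1<k N≡ (suc n) N≡2k¹⁺ⁿ =
    n , *-cancelˡ-≡ _ _ k {{>-nonZero (<⇒≤ 1<k)}} (*-cancelˡ-≡ _ _ 2 (trans (sym N≡2k¹⁺ⁿ) N≡))

  -- `21 = (1 + 5³)/6` is the cofactor of `1 + b` at the exceptional `k = y = 3`, `b = 5`.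
  3ⁿ≢21 : ∀ n → 3 ^ n ≢ 21
  3ⁿ≢21 (suc (suc n)) eq = from-no (9 ∣? 21) (divides (3 ^ n) (trans (sym eq) (trans (sym (*-assoc 3 3 (3 ^ n))) (*-comm 9 (3 ^ n)))))

  -- `5905 = (1 + 9⁵)/10` is the cofactor of `1 + b` at the exceptional `k = y = 5`, `b = 9`.
  5ⁿ≢5905 : ∀ n → 5 ^ n ≢ 5905
  5ⁿ≢5905 (suc (suc n)) eq = from-no (25 ∣? 5905) (divides (5 ^ n) (trans (sym eq) (trans (sym (*-assoc 5 5 (5 ^ n))) (*-comm 25 (5 ^ n)))))

  predecessor-of-double : ∀ {b} j → b + 1 ≡ 2 * suc j → b ≡ 1 + 2 * j
  predecessor-of-double {b} j b+1≡ = suc-injective (trans (+-comm 1 b) (trans b+1≡ (*-suc 2 j)))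

  1+cube≢ : ∀ {k b} m → 1 < k → b + 1 ≡ 2 * k → 1 + b ^ 3 ≢ 2 * k ^ m
  1+cube≢ {suc j} m 1<k b+1≡2k sum = by-predecessor (predecessor-of-double j b+1≡2k) sum
    where
    V = 1 + (2 * j + 4 * (j * j))
    factor : ∀ {b} j → b ≡ 1 + 2 * j → 1 + b * b * b ≡ 2 * (suc j * (1 + (2 * j + 4 * (j * j))))
    factor j refl = identity j
      where
      identity : ∀ j → let b = 1 + 2 * j in 1 + b * b * b ≡ 2 * (suc j * (1 + (2 * j + 4 * (j * j))))
      identity = solve-∀
    remainder : ∀ j → 1 + (2 * j + 4 * (j * j)) + suc j * 2 ≡ suc j * (4 * j) + 3
    remainder = solve-∀
    1<V : 1 < V
    1<V = s≤s (≤-trans (s<s⁻¹ 1<k) (≤-trans (m≤m+n j (j + 0)) (m≤m+n (2 * j) (4 * (j * j)))))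
    impossible : ∀ {j} n → suc j ^ n ≡ 1 + (2 * j + 4 * (j * j)) → suc j ≢ 3
    impossible n kⁿ≡V refl = 3ⁿ≢21 n kⁿ≡V
    by-predecessor : ∀ {b} → b ≡ 1 + 2 * j → 1 + b ^ 3 ≢ 2 * suc j ^ m
    by-predecessor {b} b≡ sum with n , kⁿ≡V ← power-through-k {V = V} 1<k (trans (cong (1 +_) (cube-form b)) (factor j b≡)) m sum =
      impossible n kⁿ≡V (only-power (from-yes (irreducible? 3)) 1<k n (remainder j) 1<V kⁿ≡V)

  1+fifth-power≢ : ∀ {k b} m → 1 < k → b + 1 ≡ 2 * k → 1 + b ^ 5 ≢ 2 * k ^ m
  1+fifth-power≢ {suc j} m 1<k b+1≡2k sum = by-predecessor (predecessor-of-double j b+1≡2k) sum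
    where
    W = 16 * (j * j) + 24 * (j * j * j) + 16 * (j * j * j * j)
    V = 1 + (4 * j + W)
    factor : ∀ {b} j → b ≡ 1 + 2 * j → 1 + b * b * b * b * b ≡ 2 * (suc j * (1 + (4 * j + (16 * (j * j) + 24 * (j * j * j) + 16 * (j * j * j * j)))))
    factor j refl = identity j
      where
      identity : ∀ j → let b = 1 + 2 * j in 1 + b * b * b * b * b ≡ 2 * (suc j * (1 + (4 * j + (16 * (j * j) + 24 * (j * j * j) + 16 * (j * j * j * j)))))
      identity = solve-∀
    remainder : ∀ j → 1 + (4 * j + (16 * (j * j) + 24 * (j * j * j) + 16 * (j * j * j * j))) + suc j * 4 ≡ suc j * (16 * (j * j * j) + 8 * (j * j) + 8 * j) + 5
    remainder = solve-∀
    1<V : 1 < V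
    1<V = s≤s (≤-trans (s<s⁻¹ 1<k) (≤-trans (m≤m+n j (3 * j)) (m≤m+n (4 * j) W)))
    impossible : ∀ {j} n → suc j ^ n ≡ 1 + (4 * j + (16 * (j * j) + 24 * (j * j * j) + 16 * (j * j * j * j))) → suc j ≢ 5
    impossible n kⁿ≡V refl = 5ⁿ≢5905 n kⁿ≡V
    by-predecessor : ∀ {b} → b ≡ 1 + 2 * j → 1 + b ^ 5 ≢ 2 * suc j ^ m
    by-predecessor {b} b≡ sum with n , kⁿ≡V ← power-through-k {V = V} 1<k (trans (cong (1 +_) (fifth-power-form b)) (factor j b≡)) m sum =
      impossible n kⁿ≡V (only-power (from-yes (irreducible? 5)) 1<k n (remainder j) 1<V kⁿ≡V)

  0∨1∨>1 : ∀ a → a ≡ 0 ⊎ a ≡ 1 ⊎ 1 < a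
  0∨1∨>1 0 = inj₁ refl
  0∨1∨>1 1 = inj₂ (inj₁ refl)
  0∨1∨>1 (suc (suc a)) = inj₂ (inj₂ (s≤s (s≤s z≤n)))

  sum-of-cubes≢-by-a : ∀ {k a b m} → 1 < k → a < b → a * b + 1 ≡ 2 * k → a ^ 3 + b ^ 3 ≡ 2 * k ^ m →
    a ≡ 0 ⊎ a ≡ 1 ⊎ 1 < a → ⊥
  sum-of-cubes≢-by-a {k} 1<k a<b 1≡2k sum (inj₁ refl) = even≢odd k 0 (sym 1≡2k)
  sum-of-cubes≢-by-a {k} {b = b} {m} 1<k a<b b+1≡2k sum (inj₂ (inj₁ refl)) =
    1+cube≢ m 1<k (trans (cong (_+ 1) (sym (*-identityˡ b))) b+1≡2k) sum
  sum-of-cubes≢-by-a {k} {a} {b} {m} 1<k a<b ab+1≡2k sum (inj₂ (inj₂ 1<a)) =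
    by-exponent m (s≤s⁻¹ exponent<) (*-cancelˡ-< 2 1 m 2*exponent>y) sum
    where
    open PowerSum {y = 2} {m = m} 1<k 1<a a<b ab+1≡2k sum
    by-exponent : ∀ m → m ≤ 2 → 1 < m → a ^ 3 + b ^ 3 ≢ 2 * k ^ m
    by-exponent 1 _ (s≤s ()) _
    by-exponent 2 _ _ sum = square≢twice-sum-of-cubes (odd-factor a {b} {k} ab+1≡2k) 1<a a<b
      (trans (cong₂ _*_ ab+1≡2k ab+1≡2k) (trans (regroup k) (cong (2 *_) (trans (sym sum) (cong₂ _+_ (cube-form a) (cube-form b))))))
      where
      regroup : ∀ k → 2 * k * (2 * k) ≡ 2 * (2 * (k * (k * 1)))
      regroup = solve-∀
    by-exponent (suc (suc (suc _))) (s≤s (s≤s ())) _ _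

  sum-of-cubes≢ : ∀ {k a b m} → 1 < k → a < b → a * b + 1 ≡ 2 * k → a ^ 3 + b ^ 3 ≢ 2 * k ^ m
  sum-of-cubes≢ {k} {a} {b} {m} 1<k a<b ab+1≡2k sum = sum-of-cubes≢-by-a {k} {a} {b} {m} 1<k a<b ab+1≡2k sum (0∨1∨>1 a)

  sum-of-fifth-powers≢-by-a : ∀ {k a b m} → 1 < k → a < b → a * b + 1 ≡ 2 * k → a ^ 5 + b ^ 5 ≡ 2 * k ^ m →
    a ≡ 0 ⊎ a ≡ 1 ⊎ 1 < a → ⊥
  sum-of-fifth-powers≢-by-a {k} 1<k a<b 1≡2k sum (inj₁ refl) = even≢odd k 0 (sym 1≡2k)
  sum-of-fifth-powers≢-by-a {k} {b = b} {m} 1<k a<b b+1≡2k sum (inj₂ (inj₁ refl)) =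
    1+fifth-power≢ m 1<k (trans (cong (_+ 1) (sym (*-identityˡ b))) b+1≡2k) sum
  sum-of-fifth-powers≢-by-a {k} {a} {b} {m} 1<k a<b ab+1≡2k sum (inj₂ (inj₂ 1<a)) =
    by-exponent m (s≤s⁻¹ exponent<) (*-cancelˡ-< 2 2 m 2*exponent>y) sum
    where
    open PowerSum {y = 4} {m = m} 1<k 1<a a<b ab+1≡2k sum
    sum′ : ∀ {m} → a ^ 5 + b ^ 5 ≡ 2 * k ^ m → 2 * k ^ m ≡ a * a * a * a * a + b * b * b * b * b
    sum′ sum = trans (sym sum) (cong₂ _+_ (fifth-power-form a) (fifth-power-form b))
    by-exponent : ∀ m → m ≤ 4 → 2 < m → a ^ 5 + b ^ 5 ≢ 2 * k ^ m
    by-exponent 1 _ (s≤s ()) _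
    by-exponent 2 _ (s≤s (s≤s ())) _
    by-exponent 3 _ _ sum = cube≢4-fold-sum (odd-factor a {b} {k} ab+1≡2k) 1<a a<b
      (trans (cong (λ n → n * n * n) ab+1≡2k) (trans (regroup k) (cong (4 *_) (sum′ {3} sum))))
      where
      regroup : ∀ k → 2 * k * (2 * k) * (2 * k) ≡ 4 * (2 * (k * (k * (k * 1))))
      regroup = solve-∀
    by-exponent 4 _ _ sum = fourth-power≢8-fold-sum (odd-factor a {b} {k} ab+1≡2k) 1<a a<b
      (trans (cong (λ n → n * n * n * n) ab+1≡2k) (trans (regroup k) (cong (8 *_) (sum′ {4} sum))))
      where
      regroup : ∀ k → 2 * k * (2 * k) * (2 * k) * (2 * k) ≡ 8 * (2 * (k * (k * (k * (k * 1)))))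
      regroup = solve-∀
    by-exponent (suc (suc (suc (suc (suc _))))) (s≤s (s≤s (s≤s (s≤s ())))) _ _

  sum-of-fifth-powers≢ : ∀ {k a b m} → 1 < k → a < b → a * b + 1 ≡ 2 * k → a ^ 5 + b ^ 5 ≢ 2 * k ^ m
  sum-of-fifth-powers≢ {k} {a} {b} {m} 1<k a<b ab+1≡2k sum = sum-of-fifth-powers≢-by-a {k} {a} {b} {m} 1<k a<b ab+1≡2k sum (0∨1∨>1 a)

  coprime-suc : ∀ p → Coprime p (suc p)
  coprime-suc p {d} (d∣p , d∣1+p) = ∣1⇒≡1 (∣m+n∣m⇒∣n (subst (d ∣_) (+-comm 1 p) d∣1+p) d∣p)

  -- The factors kᵐ ± x of pʸ, p = 2k − 1, are coprime, hence they are y-th powers.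
  even-exponent-splitting : ∀ {k p} x y m → 0 < x → p ≢ 0 → p + 1 ≡ 2 * k → x ^ 2 + p ^ suc y ≡ k ^ (2 * m) →
    ∃₂ λ a b → a < b × a * b ≡ p × a ^ suc y + b ^ suc y ≡ 2 * k ^ m
  even-exponent-splitting {k} {p} x y m 0<x p≢0 p+1≡2k eq with m≤n⇒∃[o]m+o≡n x≤kᵐ
    where
    x≤kᵐ : x ≤ k ^ m
    x≤kᵐ = ≮⇒≥ λ kᵐ<x → <-irrefl (sym eq) (begin-strict
      k ^ (2 * m)          ≡⟨ cong (k ^_) (*-comm 2 m) ⟩
      k ^ (m * 2)          ≡⟨ ^-*-assoc k m 2 ⟨
      (k ^ m) ^ 2          <⟨ ^-monoˡ-< 2 kᵐ<x ⟩
      x ^ 2                ≤⟨ m≤m+n (x ^ 2) (p ^ suc y) ⟩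
      x ^ 2 + p ^ suc y    ∎)
      where open ≤-Reasoning
  ... | u , x+u≡kᵐ with coprime-factors-of-power {u} {u + 2 * x} {p} y p≢0 u-v-coprime product
    where
    kᵐ∙kᵐ : k ^ (2 * m) ≡ (x + u) * (x + u)
    kᵐ∙kᵐ = trans (^-distribˡ-+-* k m (m + 0)) (trans (cong (λ n → k ^ m * k ^ n) (+-identityʳ m)) (sym (cong₂ _*_ x+u≡kᵐ x+u≡kᵐ)))
    product : u * (u + 2 * x) ≡ p ^ suc y
    product = +-cancelˡ-≡ (x ^ 2) _ _ (trans (difference-of-squares x u) (sym (trans eq kᵐ∙kᵐ)))
      where
      difference-of-squares : ∀ x u → x * (x * 1) + u * (u + 2 * x) ≡ (x + u) * (x + u)
      difference-of-squares = solve-∀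
    p-2k : Coprime p (2 * k)
    p-2k = subst (Coprime p) (trans (+-comm 1 p) p+1≡2k) (coprime-suc p)
    coprime-∣ʳ : ∀ {a b c} → c ∣ b → Coprime a b → Coprime a c
    coprime-∣ʳ c∣b ab = Coprimality.sym (coprime-∣ˡ c∣b (Coprimality.sym ab))
    pʸ-2kᵐ : Coprime (p ^ suc y) (2 * k ^ m)
    pʸ-2kᵐ = coprime-^ˡ (suc y) (coprime-* {p} {2} {k ^ m} (coprime-∣ʳ {p} {2 * k} {2} (m∣m*n k) p-2k)
      (coprime-^ m (coprime-∣ʳ {p} {2 * k} {k} (n∣m*n 2) p-2k)))
    u-v-coprime : Coprime u (u + 2 * x)
    u-v-coprime {d} (d∣u , d∣v) = pʸ-2kᵐ (subst (d ∣_) product (∣m⇒∣m*n _ d∣u) ,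
      subst (d ∣_) (trans (regroup u x) (cong (2 *_) x+u≡kᵐ)) (∣m∣n⇒∣m+n d∣u d∣v))
      where
      regroup : ∀ u x → u + (u + 2 * x) ≡ 2 * (x + u)
      regroup = solve-∀
  ... | a , b , ab≡p , u≡aʸ , v≡bʸ = a , b , a<b , ab≡p ,
    trans (cong₂ _+_ (sym u≡aʸ) (sym v≡bʸ)) (trans (regroup u x) (cong (2 *_) x+u≡kᵐ))
    where
    regroup : ∀ u x → u + (u + 2 * x) ≡ 2 * (x + u)
    regroup = solve-∀
    a<b : a < b
    a<b = ≰⇒> λ b≤a → <⇒≱ (subst₂ _<_ u≡aʸ v≡bʸ (m<m+n u (*-mono-≤ {1} {2} {1} {x} (s≤s z≤n) 0<x))) (^-monoˡ-≤ (suc y) b≤a)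

  exponent-not-even : ∀ {k p} x y m → 1 < k → 0 < x → p + 1 ≡ 2 * k → y ≡ 3 ⊎ y ≡ 5 → x ^ 2 + p ^ y ≢ k ^ (2 * m)
  exponent-not-even {k} {p} x y m 1<k 0<x p+1≡2k 3∨5 eq = by-y 3∨5 eq
    where
    p≢0 : p ≢ 0
    p≢0 refl = even≢odd k 0 (sym p+1≡2k)
    by-y : ∀ {y} → y ≡ 3 ⊎ y ≡ 5 → x ^ 2 + p ^ y ≢ k ^ (2 * m)
    by-y (inj₁ refl) eq =
      let a , b , a<b , ab≡p , sum = even-exponent-splitting {k} {p} x 2 m 0<x p≢0 p+1≡2k eq in
      sum-of-cubes≢ {k} {a} {b} {m} 1<k a<b (trans (cong (_+ 1) ab≡p) p+1≡2k) sum
    by-y (inj₂ refl) eq =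
      let a , b , a<b , ab≡p , sum = even-exponent-splitting {k} {p} x 4 m 0<x p≢0 p+1≡2k eq in
      sum-of-fifth-powers≢ {k} {a} {b} {m} 1<k a<b (trans (cong (_+ 1) ab≡p) p+1≡2k) sum

open import Defs
open import Data.Nat as ℕ using (ℕ; _∸_; _/_; _%_)
import Data.Nat.Properties as ℕ
open import Data.Nat.Divisibility using (_∣_)
import Data.Nat.Divisibility as ℕ
open import Data.Nat.DivMod using ([m+kn]%n≡m%n; m*n/n≡m)
open import Data.Nat.Coprimality using (Coprime; coprime-Bézout; coprime⇒gcd≡1; prime⇒coprime)
open import Data.Nat.GCD using (gcd; module Bézout)
open import Data.Nat.Primality using (Prime; prime?; prime⇒nonZero)
open import Data.Nat.Tactic.RingSolver using () renaming (solve-∀ to solveℕ-∀)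
open import Data.Integer as ℤ using (ℤ; +_; -_; _*_; _-_; _^_; 1ℤ; -1ℤ; 0ℤ; ∣_∣; _+_)
import Data.Integer.Properties as ℤ
import Data.Integer.DivMod as ℤ
import Data.Integer.GCD as ℤ
import Data.Integer.Divisibility.Signed as ℤ
open import Data.Integer.Tactic.RingSolver using (solve; solve-∀)
open import Data.Fin as Fin using (Fin)
open import Data.List.Base using (List; []; _∷_; _++_; length; filter; applyUpTo; allFin)
open import Data.List.Properties using (length-applyUpTo; length-++; length-tabulate)
open import Data.List.Membership.Propositional using (_∈_)
open import Data.List.Membership.Propositional.Properties using (∈-applyUpTo⁺; ∈-applyUpTo⁻; ∈-filter⁺; ∈-filter⁻; ∈-++⁺ˡ; ∈-++⁺ʳ; ∈-++⁻; ∈-allFin)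
open import Data.List.Membership.Propositional.Properties.WithK using (unique∧set⇒bag)
import Data.List.Membership.DecPropositional as Membership
open import Data.List.Relation.Unary.Any using (here)
open import Data.List.Relation.Unary.Unique.Propositional using (Unique)
import Data.List.Relation.Unary.Unique.Propositional.Properties as Unique
open import Data.List.Relation.Binary.BagAndSetEquality using (∼bag⇒↭)
open import Data.List.Relation.Binary.Permutation.Propositional.Properties using (↭-length)
open import Data.Product using (Σ; _×_; _,_; proj₁; proj₂)
open import Data.Sum using (_⊎_; inj₁; inj₂)
open import Data.Empty using (⊥; ⊥-elim)
open import Function.Base using (_∘_; id)
open import Function.Bundles using (mk⇔)
open import Induction.WellFounded using (Acc; acc)
open import Data.Nat.Induction using (<-wellFounded)
open import Relation.Nullary using (¬_; Dec; yes; no)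
open import Relation.Nullary.Decidable using (¬?; _×-dec_; _⊎-dec_; from-yes)
open import Relation.Binary.PropositionalEquality using (_≡_; _≢_; refl; sym; trans; cong; cong₂; subst; subst₂)
open import Relation.Binary.Definitions using (tri<; tri≈; tri>)
open import Algebra.Properties.AbelianGroup ℤ.+-0-abelianGroup using (∙-cancelʳ)

open Naturals using (exponent-not-even; even⊎odd)

-- Comaximality and Bézout relations over ℤ

-- A combination `c ≡ d` of the hypotheses yields `a ≡ b` when `a − b` and `c − d` agree as
-- polynomials. The choice of this combination is the content of each such proof; the rest is left
-- to the ring solver.
combine : ∀ {a b c d : ℤ} → c ≡ d → a + d ≡ b + c → a ≡ b
combine {a} {b} {c} refl a+c≡b+c = ∙-cancelʳ c a b a+c≡b+c

Comaximal : ℤ → ℤ → Set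
Comaximal a n = Σ ℤ λ r → Σ ℤ λ s → r * a + s * n ≡ 1ℤ

infix 4 _divides_
_divides_ : ℤ → ℤ → Set
n divides a = Σ ℤ λ j → a ≡ n * j

comaximal-sym : ∀ {a n} → Comaximal a n → Comaximal n a
comaximal-sym {a} {n} (r , s , e) = s , r , trans (ℤ.+-comm (s * n) (r * a)) e

comaximal-neg : ∀ {a n} → Comaximal a n → Comaximal a (- n)
comaximal-neg {a} {n} (r , s , e) = r , - s , combine e (solve (a ∷ n ∷ r ∷ s ∷ []))

comaximal-* : ∀ {a b n} → Comaximal a n → Comaximal b n → Comaximal (a * b) n
comaximal-* {a} {b} {n} (r , s , e) (r′ , s′ , e′) = r * r′ , r * a * s′ + s * (r′ * b + s′ * n) ,
  combine (cong₂ _*_ e e′) (solve (a ∷ b ∷ n ∷ r ∷ s ∷ r′ ∷ s′ ∷ []))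

comaximal-^ : ∀ {a n} m → Comaximal a n → Comaximal (a ^ m) n
comaximal-^ ℕ.zero    _ = 1ℤ , 0ℤ , refl
comaximal-^ (ℕ.suc m) c = comaximal-* c (comaximal-^ m c)

comaximal-^ʳ : ∀ {a n} m → Comaximal a n → Comaximal a (n ^ m)
comaximal-^ʳ m c = comaximal-sym (comaximal-^ m (comaximal-sym c))

comaximal-factor : ∀ {a b n} → Comaximal (a * b) n → Comaximal a n
comaximal-factor {a} {b} {n} (r , s , e) = r * b , s , combine e (solve (a ∷ b ∷ n ∷ r ∷ s ∷ []))

comaximal-cong : ∀ {a b n} → n divides a - b → Comaximal a n → Comaximal b n
comaximal-cong {a} {b} {n} (j , a-b≡nj) (r , s , e) = r , s + r * j ,
  combine (cong₂ _+_ e (cong (r *_) (sym a-b≡nj))) (solve (a ∷ b ∷ n ∷ r ∷ s ∷ j ∷ []))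

comaximal-cancel : ∀ {a b n} → Comaximal a n → n divides a * b → n divides b
comaximal-cancel {a} {b} {n} (r , s , e) (j , ab≡nj) = r * j + s * b ,
  combine (cong₂ _+_ (cong (b *_) (sym e)) (cong (r *_) ab≡nj)) (solve (a ∷ b ∷ n ∷ r ∷ s ∷ j ∷ []))

-- The relation is recorded for the cofactors: it survives `a = b = 0`, and it makes `(a′, b′)` a
-- primitive vector that can be completed to a basis. `d` is a gcd up to sign.
record Bezout (a b : ℤ) : Set where
  field
    {d a′ b′ α β} : ℤ
    a≡   : a ≡ d * a′
    b≡   : b ≡ d * b′
    unit : α * a′ + β * b′ ≡ 1ℤ

bezout-step : ∀ {a b r} q → a ≡ r + q * b → Bezout b r → Bezout a b
bezout-step q a≡ record { d = d ; a′ = x ; b′ = y ; α = α ; β = β ; a≡ = b≡dx ; b≡ = r≡dy ; unit = u } = record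
  { d = d ; a′ = y + q * x ; b′ = x ; α = β ; β = α - β * q
  ; a≡ = trans a≡ (trans (cong₂ (λ r b → r + q * b) r≡dy b≡dx) (solve (d ∷ x ∷ y ∷ q ∷ [])))
  ; b≡ = b≡dx ; unit = combine u (solve (α ∷ β ∷ x ∷ y ∷ q ∷ [])) }

bezout : ∀ a b → Bezout a b
bezout a b = go a b (<-wellFounded ∣ b ∣)
  where
  go : ∀ a b → Acc ℕ._<_ ∣ b ∣ → Bezout a b
  go a (+ 0) _ = record { d = a ; a′ = 1ℤ ; b′ = 0ℤ ; α = 1ℤ ; β = 0ℤ
    ; a≡ = sym (ℤ.*-identityʳ a) ; b≡ = sym (ℤ.*-zeroʳ a) ; unit = refl }
  go a b@(ℤ.+[1+ _ ]) (acc rec) = bezout-step (a ℤ./ b) (ℤ.a≡a%n+[a/n]*n a b) (go b (+ (a ℤ.% b)) (rec (ℤ.n%d<d a b)))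
  go a b@(ℤ.-[1+ _ ]) (acc rec) = bezout-step (a ℤ./ b) (ℤ.a≡a%n+[a/n]*n a b) (go b (+ (a ℤ.% b)) (rec (ℤ.n%d<d a b)))

-- Integer matrices of size two

record Mat : Set where
  constructor mat
  field m₁₁ m₁₂ m₂₁ m₂₂ : ℤ
open Mat

mat-≡ : ∀ {a b c d a′ b′ c′ d′} → a ≡ a′ → b ≡ b′ → c ≡ c′ → d ≡ d′ → mat a b c d ≡ mat a′ b′ c′ d′
mat-≡ refl refl refl refl = refl

infixl 7 _⊗_
_⊗_ : Mat → Mat → Mat
mat a b c d ⊗ mat a′ b′ c′ d′ = mat (a * a′ + b * c′) (a * b′ + b * d′) (c * a′ + d * c′) (c * b′ + d * d′)

infixl 6 _⊕_
_⊕_ : Mat → Mat → Mat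
mat a b c d ⊕ mat a′ b′ c′ d′ = mat (a + a′) (b + b′) (c + c′) (d + d′)

infixr 8 _·_
_·_ : ℤ → Mat → Mat
x · mat a b c d = mat (x * a) (x * b) (x * c) (x * d)

det : Mat → ℤ
det (mat a b c d) = a * d - b * c

adj : Mat → Mat
adj (mat a b c d) = mat d (- b) (- c) a

⊗-assoc : ∀ X Y Z → (X ⊗ Y) ⊗ Z ≡ X ⊗ (Y ⊗ Z)
⊗-assoc (mat a b c d) (mat e f g h) (mat i j k l) =
  mat-≡ (entry a b e f g h i k) (entry a b e f g h j l) (entry c d e f g h i k) (entry c d e f g h j l)
  where
  entry : ∀ a b e f g h i k → (a * e + b * g) * i + (a * f + b * h) * k ≡ a * (e * i + f * k) + b * (g * i + h * k)
  entry = solve-∀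

⊗-· : ∀ x X Y → X ⊗ (x · Y) ≡ x · (X ⊗ Y)
⊗-· x (mat a b c d) (mat e f g h) = mat-≡ (entry x a e b g) (entry x a f b h) (entry x c e d g) (entry x c f d h)
  where
  entry : ∀ x a e b g → a * (x * e) + b * (x * g) ≡ x * (a * e + b * g)
  entry = solve-∀

·-⊗ : ∀ x X Y → (x · X) ⊗ Y ≡ x · (X ⊗ Y)
·-⊗ x (mat a b c d) (mat e f g h) = mat-≡ (entry x a e b g) (entry x a f b h) (entry x c e d g) (entry x c f d h)
  where
  entry : ∀ x a e b g → x * a * e + x * b * g ≡ x * (a * e + b * g)
  entry = solve-∀

det-⊗ : ∀ X Y → det (X ⊗ Y) ≡ det X * det Y
det-⊗ (mat a b c d) (mat e f g h) = identity a b c d e f g h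
  where
  identity : ∀ a b c d e f g h → (a * e + b * g) * (c * f + d * h) - (a * f + b * h) * (c * e + d * g) ≡ (a * d - b * c) * (e * h - f * g)
  identity = solve-∀

adj-⊗ : ∀ N X → adj N ⊗ (N ⊗ X) ≡ det N · X
adj-⊗ (mat a b c d) (mat e f g h) =
  mat-≡ (upper a b c d e g) (upper a b c d f h) (lower a b c d e g) (lower a b c d f h)
  where
  upper : ∀ a b c d e g → d * (a * e + b * g) + - b * (c * e + d * g) ≡ (a * d - b * c) * e
  upper = solve-∀
  lower : ∀ a b c d e g → - c * (a * e + b * g) + a * (c * e + d * g) ≡ (a * d - b * c) * g
  lower = solve-∀

⊗-adj : ∀ N X → N ⊗ (adj N ⊗ X) ≡ det N · X
⊗-adj (mat a b c d) (mat e f g h) =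
  mat-≡ (upper a b c d e g) (upper a b c d f h) (lower a b c d e g) (lower a b c d f h)
  where
  upper : ∀ a b c d e g → a * (d * e + - b * g) + b * (- c * e + a * g) ≡ (a * d - b * c) * e
  upper = solve-∀
  lower : ∀ a b c d e g → c * (d * e + - b * g) + d * (- c * e + a * g) ≡ (a * d - b * c) * g
  lower = solve-∀

·-cancel : ∀ x X Y .{{_ : ℤ.NonZero x}} → x · X ≡ x · Y → X ≡ Y
·-cancel x (mat a b c d) (mat a′ b′ c′ d′) eq = mat-≡ (cancel (cong m₁₁ eq)) (cancel (cong m₁₂ eq)) (cancel (cong m₂₁ eq)) (cancel (cong m₂₂ eq))
  where
  cancel : ∀ {a b} → x * a ≡ x * b → a ≡ b
  cancel {a} {b} = ℤ.*-cancelˡ-≡ x a b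

⊗-cancel : ∀ N X Y .{{_ : ℤ.NonZero (det N)}} → N ⊗ X ≡ N ⊗ Y → X ≡ Y
⊗-cancel N X Y eq = ·-cancel (det N) X Y (trans (sym (adj-⊗ N X)) (trans (cong (adj N ⊗_) eq) (adj-⊗ N Y)))

·-solve : ∀ {x D r s X Y} → r * x + s * D ≡ 1ℤ → x · X ≡ D · Y → X ≡ D · (r · Y ⊕ s · X)
·-solve {x} {D} {r} {s} {mat a b c d} {mat a′ b′ c′ d′} unit eq =
  mat-≡ (entry (cong m₁₁ eq)) (entry (cong m₁₂ eq)) (entry (cong m₂₁ eq)) (entry (cong m₂₂ eq))
  where
  entry : ∀ {a b} → x * a ≡ D * b → a ≡ D * (r * b + s * a)
  entry {a} {b} eq = combine (cong₂ _+_ (cong (a *_) (sym unit)) (cong (r *_) eq)) (solve (a ∷ b ∷ x ∷ D ∷ r ∷ s ∷ []))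

-- Forms, multiplication by √k, and neighbours

-- The form `AX² + 2BXY + CY²`: discriminant `4k` forces an even middle coefficient, and
-- `discriminant` is then `k` itself.
record HalfForm : Set where
  constructor half
  field A B C : ℤ

-- This matrix `M` squares to the scalar `discriminant f`, and the form is recovered as
-- `f(v) = det(v, Mv)`. Hence `MN = NM′` means `f(Nv) = det N · g(v)`: proper equivalence for
-- determinant 1, and a change of class including its sign for determinant -p.
⟦_⟧ : HalfForm → Mat
⟦ half A B C ⟧ = mat (- B) (- C) A B

to-form : HalfForm → Form
to-form (half A B C) = form A (+ 2 * B) C

discriminant : HalfForm → ℤ
discriminant (half A B C) = B * B - A * C

shift : HalfForm → ℤ → Mat
shift (half A B C) b = mat (- B - b) (- C) A (B - b)

shift-⊗ : ∀ f b X → shift f b ⊗ X ≡ ⟦ f ⟧ ⊗ X ⊕ (- b) · X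
shift-⊗ (half A B C) b (mat x y z w) =
  mat-≡ (first (- B) (- C) b x z) (first (- B) (- C) b y w) (second A B b x z) (second A B b y w)
  where
  first : ∀ p q b x z → (p - b) * x + q * z ≡ p * x + q * z + - b * x
  first = solve-∀
  second : ∀ p q b x z → p * x + (q - b) * z ≡ p * x + q * z + - b * z
  second = solve-∀

⊗-shift : ∀ f b X → X ⊗ shift f b ≡ X ⊗ ⟦ f ⟧ ⊕ (- b) · X
⊗-shift (half A B C) b (mat x y z w) =
  mat-≡ (first (- B) A b x y) (second (- C) B b x y) (first (- B) A b z w) (second (- C) B b z w)
  where
  first : ∀ p q b x y → x * (p - b) + y * q ≡ x * p + y * q + - b * x
  first = solve-∀
  second : ∀ p q b x y → x * p + y * (q - b) ≡ x * p + y * q + - b * y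
  second = solve-∀

shift-shift : ∀ f b X → shift f b ⊗ (shift f b ⊗ X) ≡ (- (+ 2 * b)) · (shift f b ⊗ X) ⊕ (discriminant f - b * b) · X
shift-shift (half A B C) b (mat x y z w) =
  mat-≡ (upper A B C b x z) (upper A B C b y w) (lower A B C b x z) (lower A B C b y w)
  where
  upper : ∀ A B C b x z → (- B - b) * ((- B - b) * x + - C * z) + - C * (A * x + (B - b) * z) ≡
    - (+ 2 * b) * ((- B - b) * x + - C * z) + (B * B - A * C - b * b) * x
  upper = solve-∀
  lower : ∀ A B C b x z → A * ((- B - b) * x + - C * z) + (B - b) * (A * x + (B - b) * z) ≡
    - (+ 2 * b) * (A * x + (B - b) * z) + (B * B - A * C - b * b) * z
  lower = solve-∀

-- adj (M − b) = −(M + b), so that 2b = (M + b) − (M − b) splits along N.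
2b-adj-⊗ : ∀ f b N N′ → (+ 2 * b) · (adj N ⊗ N′) ≡ (-1ℤ) · (adj (shift f b ⊗ N) ⊗ N′ ⊕ adj N ⊗ (shift f b ⊗ N′))
2b-adj-⊗ (half A B C) b (mat x y z w) (mat x′ y′ z′ w′) =
  mat-≡ (upper A B C b x y z w x′ z′) (upper A B C b x y z w y′ w′) (lower A B C b x y z w x′ z′) (lower A B C b x y z w y′ w′)
  where
  upper : ∀ A B C b x y z w x′ z′ → + 2 * b * (w * x′ + - y * z′) ≡
    -1ℤ * ((A * y + (B - b) * w) * x′ + - ((- B - b) * y + - C * w) * z′
      + (w * ((- B - b) * x′ + - C * z′) + - y * (A * x′ + (B - b) * z′)))
  upper = solve-∀
  lower : ∀ A B C b x y z w x′ z′ → + 2 * b * (- z * x′ + x * z′) ≡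
    -1ℤ * (- (A * x + (B - b) * z) * x′ + ((- B - b) * x + - C * z) * z′
      + (- z * ((- B - b) * x′ + - C * z′) + x * (A * x′ + (B - b) * z′)))
  lower = solve-∀

-- The ideal class of g is obtained from that of f by multiplication with the class of the ideal (D, b − √k):
-- N is the inclusion matrix of the sublattice generated by D and M − b, where M is the matrix of √k.
record Neighbour (b D : ℤ) (f g : HalfForm) : Set where
  constructor neighbour
  field
    N J        : Mat
    det-N      : det N ≡ D
    intertwine : ⟦ f ⟧ ⊗ N ≡ N ⊗ ⟦ g ⟧
    image      : shift f b ⊗ N ≡ D · J

intertwine-shift : ∀ {f g} b {N} → ⟦ f ⟧ ⊗ N ≡ N ⊗ ⟦ g ⟧ → shift f b ⊗ N ≡ N ⊗ shift g b
intertwine-shift {f} {g} b {N} e = trans (shift-⊗ f b N) (trans (cong (_⊕ (- b) · N) e) (sym (⊗-shift g b N)))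

-- The quotient `W = N⁻¹N′` is integral: `2b-adj-⊗` writes `2b · adj N · N′` as a sum of two terms
-- with a factor `(M − b)N` or `(M − b)N′`, so `D` divides it, and `2b` is a unit modulo `D`. Its
-- determinant is `D/D = 1`.
neighbour-unique : ∀ {b D f g g′} .{{_ : ℤ.NonZero D}} → Comaximal (+ 2 * b) D →
  Neighbour b D f g → Neighbour b D f g′ → Neighbour b 1ℤ g g′
neighbour-unique {b} {D} {f} {g} {g′} (r , s , unit) (neighbour N J refl MN≡ N-b≡) (neighbour N′ J′ det-N′ MN′≡ N′-b≡) = neighbour
  W (shift g b ⊗ W) det-W (⊗-cancel N (⟦ g ⟧ ⊗ W) (W ⊗ ⟦ g′ ⟧) (trans (sym (⊗-assoc N ⟦ g ⟧ W)) (trans (cong (_⊗ W) (sym MN≡))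
    (trans (⊗-assoc ⟦ f ⟧ N W) (trans (cong (⟦ f ⟧ ⊗_) NW≡N′) (trans MN′≡ (trans (cong (_⊗ ⟦ g′ ⟧) (sym NW≡N′)) (⊗-assoc N W ⟦ g′ ⟧)))))))) (sym (1· (shift g b ⊗ W)))
  where
  Y = (-1ℤ) · (adj J ⊗ N′ ⊕ adj N ⊗ J′)
  W = r · Y ⊕ s · (adj N ⊗ N′)
  adj-· : ∀ x X → adj (x · X) ≡ x · adj X
  adj-· x (mat a b c d) = mat-≡ refl (neg x b) (neg x c) refl
    where
    neg : ∀ x b → - (x * b) ≡ x * - b
    neg = solve-∀
  pull : ∀ x X Z → (-1ℤ) · (x · X ⊕ x · Z) ≡ x · ((-1ℤ) · (X ⊕ Z))
  pull x (mat a b c d) (mat a′ b′ c′ d′) = mat-≡ (entry x a a′) (entry x b b′) (entry x c c′) (entry x d d′)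
    where
    entry : ∀ x a a′ → -1ℤ * (x * a + x * a′) ≡ x * (-1ℤ * (a + a′))
    entry = solve-∀
  1· : ∀ X → 1ℤ · X ≡ X
  1· (mat a b c d) = mat-≡ (ℤ.*-identityˡ a) (ℤ.*-identityˡ b) (ℤ.*-identityˡ c) (ℤ.*-identityˡ d)
  2bX : (+ 2 * b) · (adj N ⊗ N′) ≡ D · Y
  2bX = trans (2b-adj-⊗ f b N N′) (trans (cong₂ (λ U V → (-1ℤ) · (U ⊕ V))
    (trans (cong (λ Z → adj Z ⊗ N′) N-b≡) (trans (cong (_⊗ N′) (adj-· D J)) (·-⊗ D (adj J) N′)))
    (trans (cong (adj N ⊗_) N′-b≡) (⊗-· D (adj N) J′))) (pull D (adj J ⊗ N′) (adj N ⊗ J′)))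
  NW≡N′ : N ⊗ W ≡ N′
  NW≡N′ = ·-cancel D (N ⊗ W) N′ (trans (sym (⊗-· D N W)) (trans (cong (N ⊗_) (sym (·-solve {+ 2 * b} {D} {r} {s} {adj N ⊗ N′} {Y} unit 2bX))) (⊗-adj N N′)))
  det-W : det W ≡ 1ℤ
  det-W = ℤ.*-cancelˡ-≡ D (det W) 1ℤ (trans (sym (det-⊗ N W)) (trans (cong det NW≡N′) (trans det-N′ (sym (ℤ.*-identityʳ D)))))

-- Only `(M − b)²NN′` is visibly divisible by `DD′`, through `(M − b)N = N(M′ − b)`. As
-- `(M − b)² = −2b(M − b) + (k − b²)` and `DD′` divides `k − b²`, cancelling the unit `2b` gives the
-- same for `(M − b)NN′`.
neighbour-compose : ∀ {b D D′ f g h} → Comaximal (+ 2 * b) (D * D′) → D * D′ divides discriminant f - b * b →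
  Neighbour b D f g → Neighbour b D′ g h → Neighbour b (D * D′) f h
neighbour-compose {b} {D} {D′} {f} {g} {h} (r , s , unit) (e , k-b²≡) (neighbour N J refl MN≡ N-b≡) (neighbour N′ J′ refl MN′≡ N′-b≡) =
  neighbour (N ⊗ N′) (r · Y ⊕ s · (shift f b ⊗ X)) (det-⊗ N N′)
    (trans (sym (⊗-assoc ⟦ f ⟧ N N′)) (trans (cong (_⊗ N′) MN≡) (trans (⊗-assoc N ⟦ g ⟧ N′) (trans (cong (N ⊗_) MN′≡) (sym (⊗-assoc N N′ ⟦ h ⟧))))))
    (·-solve {+ 2 * b} {D * D′} {r} {s} {shift f b ⊗ X} {Y} unit
      (rearrange {+ 2 * b} {D * D′} {e} {discriminant f - b * b} {shift f b ⊗ X} {X} {J ⊗ J′} k-b²≡ (trans (sym (shift-shift f b X)) squared)))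
  where
  X = N ⊗ N′
  Y = e · X ⊕ (-1ℤ) · (J ⊗ J′)
  squared : shift f b ⊗ (shift f b ⊗ X) ≡ (D * D′) · (J ⊗ J′)
  squared = trans (cong (shift f b ⊗_) (trans (sym (⊗-assoc (shift f b) N N′)) (trans (cong (_⊗ N′) (intertwine-shift {f} {g} b {N} MN≡)) (⊗-assoc N (shift g b) N′))))
    (trans (sym (⊗-assoc (shift f b) N (shift g b ⊗ N′))) (trans (cong₂ _⊗_ N-b≡ N′-b≡)
    (trans (·-⊗ D J (D′ · J′)) (trans (cong (D ·_) (⊗-· D′ J J′)) (·-· D D′ (J ⊗ J′))))))
    where
    ·-· : ∀ x y X → x · (y · X) ≡ (x * y) · X
    ·-· x y (mat a b c d) = mat-≡ (sym (ℤ.*-assoc x y a)) (sym (ℤ.*-assoc x y b)) (sym (ℤ.*-assoc x y c)) (sym (ℤ.*-assoc x y d))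
  rearrange : ∀ {t D e n S X K} → n ≡ D * e → (- t) · S ⊕ n · X ≡ D · K → t · S ≡ D · (e · X ⊕ (-1ℤ) · K)
  rearrange {t} {D} {e} {n} {mat s₁ s₂ s₃ s₄} {mat x₁ x₂ x₃ x₄} {mat k₁ k₂ k₃ k₄} n≡ eq =
    mat-≡ (entry (cong m₁₁ eq)) (entry (cong m₁₂ eq)) (entry (cong m₂₁ eq)) (entry (cong m₂₂ eq))
    where
    entry : ∀ {s x k} → - t * s + n * x ≡ D * k → t * s ≡ D * (e * x + -1ℤ * k)
    entry {s} {x} {k} eq = combine (cong₂ _+_ (sym eq) (cong (x *_) n≡)) (solve (s ∷ x ∷ k ∷ t ∷ D ∷ e ∷ n ∷ []))

equivalent : ∀ {b f g} → Neighbour b 1ℤ f g → Equiv (to-form f) (to-form g)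
equivalent {b} {half A B C} {half A′ B′ C′} (neighbour (mat p q r s) _ ps-qr≡1 MS≡SM′ _) =
  p , q , r , s , ps-qr≡1 , form-≡ A′≡ B′≡ C′≡
  where
  form-≡ : ∀ {a b c a′ b′ c′} → a ≡ a′ → b ≡ b′ → c ≡ c′ → form a b c ≡ form a′ b′ c′
  form-≡ refl refl refl = refl
  e₁₁ : - B * p + - C * r ≡ p * - B′ + q * A′
  e₁₁ = cong m₁₁ MS≡SM′
  e₁₂ : - B * q + - C * s ≡ p * - C′ + q * B′
  e₁₂ = cong m₁₂ MS≡SM′
  e₂₁ : A * p + B * r ≡ r * - B′ + s * A′
  e₂₁ = cong m₂₁ MS≡SM′
  e₂₂ : A * q + B * s ≡ r * - C′ + s * B′
  e₂₂ = cong m₂₂ MS≡SM′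
  unit : 1ℤ ≡ p * s - q * r
  unit = sym ps-qr≡1
  A′≡ : A′ ≡ A * (p * p) + + 2 * B * (p * r) + C * (r * r)
  A′≡ = combine (cong₂ _+_ (cong (A′ *_) unit) (cong₂ _+_ (cong (p *_) (sym e₂₁)) (cong (r *_) e₁₁)))
    (solve (A ∷ B ∷ C ∷ A′ ∷ B′ ∷ p ∷ q ∷ r ∷ s ∷ []))
  B′≡ : + 2 * B′ ≡ + 2 * A * (p * q) + + 2 * B * (p * s + q * r) + + 2 * C * (r * s)
  B′≡ = combine (cong₂ _+_ (cong (+ 2 * B′ *_) unit) (cong₂ _+_ (cong (+ 2 * s *_) e₁₁) (cong (+ 2 * q *_) (sym e₂₁))))
    (solve (A ∷ B ∷ C ∷ A′ ∷ B′ ∷ p ∷ q ∷ r ∷ s ∷ []))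
  C′≡ : C′ ≡ A * (q * q) + + 2 * B * (q * s) + C * (s * s)
  C′≡ = combine (cong₂ _+_ (cong (C′ *_) unit) (cong₂ _+_ (cong (s *_) e₁₂) (cong (q *_) (sym e₂₂))))
    (solve (A ∷ B ∷ C ∷ B′ ∷ C′ ∷ p ∷ q ∷ r ∷ s ∷ []))

matrix-of-equivalence : ∀ {A B C A′ B′ C′ p q r s} → p * s - q * r ≡ 1ℤ → form A′ (+ 2 * B′) C′ ≡ act (form A (+ 2 * B) C) p q r s →
  ⟦ half A B C ⟧ ⊗ mat p q r s ≡ mat p q r s ⊗ ⟦ half A′ B′ C′ ⟧
matrix-of-equivalence {A} {B} {C} {A′} {B′} {C′} {p} {q} {r} {s} unit act≡ = mat-≡ e₁₁ e₁₂ e₂₁ e₂₂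
  where
  A′≡ : A′ ≡ A * (p * p) + + 2 * B * (p * r) + C * (r * r)
  A′≡ = cong fa act≡
  C′≡ : C′ ≡ A * (q * q) + + 2 * B * (q * s) + C * (s * s)
  C′≡ = cong fc act≡
  B′≡ : B′ ≡ A * (p * q) + B * (p * s + q * r) + C * (r * s)
  B′≡ = ℤ.*-cancelˡ-≡ (+ 2) _ _ (trans (cong fb act≡) (factor A B C p q r s))
    where
    factor : ∀ A B C p q r s → + 2 * A * (p * q) + + 2 * B * (p * s + q * r) + + 2 * C * (r * s) ≡
      + 2 * (A * (p * q) + B * (p * s + q * r) + C * (r * s))
    factor = solve-∀
  e₁₁ : - B * p + - C * r ≡ p * - B′ + q * A′
  e₁₁ = combine (cong₂ _+_ (cong (p *_) B′≡) (cong₂ _+_ (cong (q *_) (sym A′≡)) (cong ((B * p + C * r) *_) unit)))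
    (solve (A ∷ B ∷ C ∷ A′ ∷ B′ ∷ p ∷ q ∷ r ∷ s ∷ []))
  e₁₂ : - B * q + - C * s ≡ p * - C′ + q * B′
  e₁₂ = combine (cong₂ _+_ (cong (p *_) C′≡) (cong₂ _+_ (cong (q *_) (sym B′≡)) (cong ((B * q + C * s) *_) unit)))
    (solve (A ∷ B ∷ C ∷ B′ ∷ C′ ∷ p ∷ q ∷ r ∷ s ∷ []))
  e₂₁ : A * p + B * r ≡ r * - B′ + s * A′
  e₂₁ = combine (cong₂ _+_ (cong (r *_) B′≡) (cong₂ _+_ (cong (s *_) (sym A′≡)) (cong ((A * p + B * r) *_) (sym unit))))
    (solve (A ∷ B ∷ C ∷ A′ ∷ B′ ∷ p ∷ q ∷ r ∷ s ∷ []))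
  e₂₂ : A * q + B * s ≡ r * - C′ + s * B′
  e₂₂ = combine (cong₂ _+_ (cong (r *_) C′≡) (cong₂ _+_ (cong (s *_) (sym B′≡)) (cong ((A * q + B * s) *_) (sym unit))))
    (solve (A ∷ B ∷ C ∷ B′ ∷ C′ ∷ p ∷ q ∷ r ∷ s ∷ []))

neighbour-of-equivalence : ∀ b f g → Equiv (to-form f) (to-form g) → Neighbour b 1ℤ f g
neighbour-of-equivalence b f@(half A B C) g@(half A′ B′ C′) (p , q , r , s , ps-qr≡1 , act≡) =
  neighbour (mat p q r s) (shift f b ⊗ mat p q r s) ps-qr≡1 (matrix-of-equivalence {A} {B} {C} {A′} {B′} {C′} {p} {q} {r} {s} ps-qr≡1 act≡) (sym (1· _))
  where
  1· : ∀ X → 1ℤ · X ≡ X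
  1· (mat a b c d) = mat-≡ (ℤ.*-identityˡ a) (ℤ.*-identityˡ b) (ℤ.*-identityˡ c) (ℤ.*-identityˡ d)

-- Fixed-point-free maps of prime period

iterate : ∀ {A : Set} → (A → A) → ℕ → A → A
iterate f ℕ.zero    x = x
iterate f (ℕ.suc n) x = iterate f n (f x)

iterate-+ : ∀ {A : Set} (f : A → A) m n x → iterate f (m ℕ.+ n) x ≡ iterate f n (iterate f m x)
iterate-+ f ℕ.zero    n x = refl
iterate-+ f (ℕ.suc m) n x = iterate-+ f m n (f x)

iterate-suc : ∀ {A : Set} (f : A → A) n x → iterate f (ℕ.suc n) x ≡ f (iterate f n x)
iterate-suc f ℕ.zero    x = refl
iterate-suc f (ℕ.suc n) x = iterate-suc f n (f x)

iterate-* : ∀ {A : Set} (f : A → A) m n {x} → iterate f n x ≡ x → iterate f (m ℕ.* n) x ≡ x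
iterate-* f ℕ.zero    n     e = refl
iterate-* f (ℕ.suc m) n {x} e = trans (iterate-+ f n (m ℕ.* n) x) (trans (cong (iterate f (m ℕ.* n)) e) (iterate-* f m n e))

iterate-coprime : ∀ {A : Set} (f : A → A) {m n x} → Coprime m n → iterate f m x ≡ x → iterate f n x ≡ x → f x ≡ x
iterate-coprime f {m} {n} {x} m-n fᵐ fⁿ with coprime-Bézout m-n
... | Bézout.+- a b e = trans (trans (cong f (sym (iterate-* f b n fⁿ))) (sym (iterate-suc f (b ℕ.* n) x))) (trans (cong (λ i → iterate f i x) e) (iterate-* f a m fᵐ))
... | Bézout.-+ a b e = trans (trans (cong f (sym (iterate-* f a m fᵐ))) (sym (iterate-suc f (a ℕ.* m) x))) (trans (cong (λ i → iterate f i x) e) (iterate-* f b n fⁿ))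

module FreeAction {h y} (y-prime : Prime y) (T : Fin h → Fin h) (Tʸ≡id : ∀ i → iterate T y i ≡ i) (T-free : ∀ i → T i ≢ i) where
  open Membership {A = Fin h} Fin._≟_ using (_∈?_)

  instance
    y≢0 : ℕ.NonZero y
    y≢0 = prime⇒nonZero y-prime

  y≡1+ : y ≡ ℕ.suc (ℕ.pred y)
  y≡1+ = sym (ℕ.suc-pred y)

  T-injective : ∀ n {i j} → iterate T n i ≡ iterate T n j → i ≡ j
  T-injective n {i} {j} e = trans (sym (returns i)) (trans (cong (iterate T (ℕ.pred y ℕ.* n)) e) (returns j))
    where
    returns : ∀ i → iterate T (ℕ.pred y ℕ.* n) (iterate T n i) ≡ i
    returns i = trans (sym (iterate-+ T n (ℕ.pred y ℕ.* n) i)) (trans (cong (λ m → iterate T m i) (trans (cong (ℕ._* n) (sym y≡1+)) (ℕ.*-comm y n))) (iterate-* T n y (Tʸ≡id i)))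

  orbit : Fin h → List (Fin h)
  orbit i = applyUpTo (λ n → iterate T n i) y

  orbit-unique : ∀ i → Unique (orbit i)
  orbit-unique i = Unique.applyUpTo⁺₁ (λ n → iterate T n i) y distinct
    where
    distinct : ∀ {a b} → a ℕ.< b → b ℕ.< y → iterate T a i ≢ iterate T b i
    distinct {a} {b} a<b b<y e = T-free i (iterate-coprime T (prime⇒coprime y-prime {{ℕ.>-nonZero (ℕ.m<n⇒0<n∸m a<b)}} (ℕ.≤-<-trans (ℕ.m∸n≤m b a) b<y)) (Tʸ≡id i)
      (T-injective a (trans (sym (iterate-+ T (b ∸ a) a i)) (trans (cong (λ n → iterate T n i) (ℕ.m∸n+n≡m (ℕ.<⇒≤ a<b))) (sym e)))))

  -- Closure under preimages is what makes the complement of an orbit stable under `T`.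
  orbit-closed : ∀ i {j} → T j ∈ orbit i → j ∈ orbit i
  orbit-closed i {j} Tj∈ with ∈-applyUpTo⁻ (λ n → iterate T n i) Tj∈
  ... | ℕ.zero , _ , Tj≡i = subst (_∈ orbit i) (T-injective 1 (trans (trans (sym (iterate-suc T (ℕ.pred y) i)) (trans (cong (λ n → iterate T n i) (sym y≡1+)) (Tʸ≡id i))) (sym Tj≡i)))
    (∈-applyUpTo⁺ (λ n → iterate T n i) (subst (ℕ.pred y ℕ.<_) (sym y≡1+) (ℕ.n<1+n _)))
  ... | ℕ.suc n , n<y , Tj≡ = subst (_∈ orbit i) (T-injective 1 (sym (trans Tj≡ (iterate-suc T n i)))) (∈-applyUpTo⁺ (λ n → iterate T n i) (ℕ.<-trans (ℕ.n<1+n n) n<y))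

  -- Stable lists without repetition are general enough for removing one orbit at a time.
  closed-length : ∀ xs → Acc ℕ._<_ (length xs) → Unique xs → (∀ {i} → i ∈ xs → T i ∈ xs) → y ∣ length xs
  closed-length [] _ _ _ = y ℕ.∣0
  closed-length (x ∷ xs) (acc rec) unique closed =
    subst (y ∣_) (sym |xs|) (ℕ.∣m∣n⇒∣m+n ℕ.∣-refl (closed-length rest (rec smaller) (Unique.filter⁺ ∉? unique) rest-closed))
    where
    ∉? = λ i → ¬? (i ∈? orbit x)
    rest = filter ∉? (x ∷ xs)
    orbit⊆ : ∀ n → iterate T n x ∈ x ∷ xs
    orbit⊆ ℕ.zero    = here refl
    orbit⊆ (ℕ.suc n) = subst (_∈ x ∷ xs) (sym (iterate-suc T n x)) (closed (orbit⊆ n))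
    to : ∀ {i} → i ∈ x ∷ xs → i ∈ orbit x ++ rest
    to {i} i∈ with i ∈? orbit x
    ... | yes i∈orbit = ∈-++⁺ˡ i∈orbit
    ... | no  i∉orbit = ∈-++⁺ʳ (orbit x) (∈-filter⁺ ∉? i∈ i∉orbit)
    from : ∀ {i} → i ∈ orbit x ++ rest → i ∈ x ∷ xs
    from i∈ with ∈-++⁻ (orbit x) i∈
    ... | inj₂ i∈rest = proj₁ (∈-filter⁻ ∉? i∈rest)
    ... | inj₁ i∈orbit with n , _ , refl ← ∈-applyUpTo⁻ (λ n → iterate T n x) i∈orbit = orbit⊆ n
    |xs| : length (x ∷ xs) ≡ y ℕ.+ length rest
    |xs| = trans (↭-length (∼bag⇒↭ (unique∧set⇒bag unique
        (Unique.++⁺ (orbit-unique x) (Unique.filter⁺ ∉? unique) (λ (i∈orbit , i∈rest) → proj₂ (∈-filter⁻ ∉? {xs = x ∷ xs} i∈rest) i∈orbit))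
        (mk⇔ to from))))
      (trans (length-++ (orbit x)) (cong (ℕ._+ length rest) (length-applyUpTo (λ n → iterate T n x) y)))
    smaller : length rest ℕ.< length (x ∷ xs)
    smaller = subst (length rest ℕ.<_) (sym |xs|) (ℕ.m<n+m (length rest) (ℕ.>-nonZero⁻¹ y))
    rest-closed : ∀ {i} → i ∈ rest → T i ∈ rest
    rest-closed i∈rest with i∈ , i∉orbit ← ∈-filter⁻ ∉? {xs = x ∷ xs} i∈rest = ∈-filter⁺ ∉? (closed i∈) (i∉orbit ∘ orbit-closed x)

  order-divides : y ∣ h
  order-divides = subst (y ∣_) (length-tabulate id) (closed-length (allFin h) (<-wellFounded _) (Unique.allFin⁺ h) (λ _ → ∈-allFin _))

-- Existence of neighbours

comaximal-factorʳ : ∀ {a n s} → s divides n → Comaximal a n → Comaximal a s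
comaximal-factorʳ {a} {n} {s} (j , n≡sj) (x , y , e) = x , y * j , combine (cong₂ _+_ e (cong (y *_) (sym n≡sj))) (solve (a ∷ n ∷ s ∷ x ∷ y ∷ j ∷ []))

unit-square : ∀ d → ∣ d ∣ ≡ 1 → d * d ≡ 1ℤ
unit-square (+ .1)          refl = refl
unit-square (ℤ.-[1+ .0 ])   refl = refl

-- Splits off the part of P coprime to c.
Splitting : ℤ → Set
Splitting P = ∀ c → Σ ℤ λ t → Σ ℤ λ s → Σ ℕ λ m → P ≡ t * s × s divides c ^ m × Comaximal t c

coprime-part : ∀ n .{{_ : ℕ.NonZero n}} → Splitting (+ n)
coprime-part n c = go n (<-wellFounded n)
  where
  go : ∀ n .{{_ : ℕ.NonZero n}} → Acc ℕ._<_ n → Σ ℤ λ t → Σ ℤ λ s → Σ ℕ λ m → + n ≡ t * s × s divides c ^ m × Comaximal t c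
  go n (acc rec) with bezout c (+ n)
  ... | record { d = d ; a′ = c′ ; b′ = n′ ; α = α ; β = β ; a≡ = c≡dc′ ; b≡ = n≡dn′ ; unit = u } = by-gcd (∣ d ∣ ℕ.≟ 1)
    where
    |n| : n ≡ ∣ d ∣ ℕ.* ∣ n′ ∣
    |n| = trans (cong ∣_∣ n≡dn′) (ℤ.abs-* d n′)
    instance
      n′≢0 : ℕ.NonZero ∣ n′ ∣
      n′≢0 = ℕ.≢-nonZero λ n′≡0 → ℕ.≢-nonZero⁻¹ n (trans |n| (trans (cong (∣ d ∣ ℕ.*_) n′≡0) (ℕ.*-zeroʳ ∣ d ∣)))
    d≢0 : ∣ d ∣ ≢ 0
    d≢0 d≡0 = ℕ.≢-nonZero⁻¹ n (trans |n| (cong (ℕ._* ∣ n′ ∣) d≡0))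
    by-gcd : _ → _
    by-gcd (yes |d|≡1) = + n , 1ℤ , 0 , sym (ℤ.*-identityʳ (+ n)) , (1ℤ , refl) , d * β , d * α , comax (unit-square d |d|≡1)
      where
      comax : d * d ≡ 1ℤ → d * β * + n + d * α * c ≡ 1ℤ
      comax dd≡1 = trans (cong₂ (λ n c → d * β * n + d * α * c) n≡dn′ c≡dc′)
        (combine (cong₂ _+_ dd≡1 (cong (d * d *_) u)) (solve (d ∷ β ∷ n′ ∷ α ∷ c′ ∷ [])))
    by-gcd (no |d|≢1) = extend (go ∣ n′ ∣ (rec n′<n))
      where
      n′<n : ∣ n′ ∣ ℕ.< n
      n′<n = subst (∣ n′ ∣ ℕ.<_) (trans (ℕ.*-comm ∣ n′ ∣ ∣ d ∣) (sym |n|)) (ℕ.m<m*n ∣ n′ ∣ ∣ d ∣ (ℕ.≤∧≢⇒< (ℕ.n≢0⇒n>0 d≢0) (|d|≢1 ∘ sym)))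
      signed : ∀ i → Σ ℤ λ ε → i ≡ ε * + ∣ i ∣ × ε * ε ≡ 1ℤ
      signed (+ m) = 1ℤ , sym (ℤ.*-identityˡ (+ m)) , refl
      signed (ℤ.-[1+ m ]) = -1ℤ , sym (ℤ.-1*i≡-i (+ ℕ.suc m)) , refl
      extend : (Σ ℤ λ t → Σ ℤ λ s → Σ ℕ λ m → + ∣ n′ ∣ ≡ t * s × s divides c ^ m × Comaximal t c) →
        Σ ℤ λ t → Σ ℤ λ s → Σ ℕ λ m → + n ≡ t * s × s divides c ^ m × Comaximal t c
      extend (t , s , m , n′≡ts , (j , cᵐ≡sj) , t-c) with signed n′
      ... | ε , n′≡ , ε² = t , d * (ε * s) , ℕ.suc m , trans n≡dn′ (trans (cong (d *_) (trans n′≡ (cong (ε *_) n′≡ts))) (regroup d ε t s)) ,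
        (c′ * (ε * j) , trans (cong₂ _*_ c≡dc′ (trans cᵐ≡sj (sign-square ε s j ε²))) (regroup′ d c′ ε s j)) , t-c
        where
        regroup : ∀ d ε t s → d * (ε * (t * s)) ≡ t * (d * (ε * s))
        regroup = solve-∀
        regroup′ : ∀ d c ε s j → d * c * (ε * s * (ε * j)) ≡ d * (ε * s) * (c * (ε * j))
        regroup′ = solve-∀
        sign-square : ∀ ε s j → ε * ε ≡ 1ℤ → s * j ≡ ε * s * (ε * j)
        sign-square ε s j e = combine (cong (s * j *_) (sym e)) (solve (ε ∷ s ∷ j ∷ []))

Prim : HalfForm → Set
Prim (half A B C) = Σ ℤ λ l → Σ ℤ λ m → Σ ℤ λ n → l * A + m * (+ 2 * B) + n * C ≡ 1ℤ

infix 4 _∈⟨_,_⟩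
_∈⟨_,_⟩ : ℤ → ℤ → ℤ → Set
z ∈⟨ x , y ⟩ = Σ ℤ λ m → Σ ℤ λ n → m * x + n * y ≡ z

∈ʳ : ∀ x y → y ∈⟨ x , y ⟩
∈ʳ x y = 0ℤ , 1ℤ , solve (x ∷ y ∷ [])

+∈ : ∀ {x y a b} → a ∈⟨ x , y ⟩ → b ∈⟨ x , y ⟩ → a + b ∈⟨ x , y ⟩
+∈ {x} {y} (m , n , refl) (m′ , n′ , refl) = m + m′ , n + n′ , solve (x ∷ y ∷ m ∷ n ∷ m′ ∷ n′ ∷ [])

*∈ : ∀ {x y a} c → a ∈⟨ x , y ⟩ → c * a ∈⟨ x , y ⟩
*∈ {x} {y} c (m , n , refl) = c * m , c * n , solve (x ∷ y ∷ m ∷ n ∷ c ∷ [])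

difference∈ : ∀ {a t c d x} → a - t * c ≡ d * x → a ∈⟨ d , t ⟩
difference∈ {a} {t} {c} {d} {x} e = x , c , combine (sym e) (solve (a ∷ t ∷ c ∷ d ∷ x ∷ []))

coprime∈ : ∀ {a t c d y r r′ g} → r * t + r′ * g ≡ 1ℤ → a + t * c ≡ d * y → a ∈⟨ d , g ⟩ → c ∈⟨ d , g ⟩
coprime∈ {a} {t} {c} {d} {y} {r} {r′} {g} unit e (m , n , a≡) = r * y - r * m , r′ * c - r * n ,
  combine (cong₂ _+_ (cong (c *_) unit) (cong (r *_) (cong₂ _+_ (sym e) (sym a≡)))) (solve (a ∷ t ∷ c ∷ d ∷ y ∷ r ∷ r′ ∷ g ∷ m ∷ n ∷ []))

gcd-combination : ∀ {a b d a′ b′ α β} → a ≡ d * a′ → b ≡ d * b′ → α * a′ + β * b′ ≡ 1ℤ → d ≡ α * a + β * b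
gcd-combination {d = d} {a′} {b′} {α} {β} refl refl unit = combine (cong (d *_) (sym unit)) (solve (d ∷ a′ ∷ b′ ∷ α ∷ β ∷ []))

KernelVector : ℤ → ℤ → ℤ → ℤ → ℤ → Set
KernelVector A B C b P = Σ ℤ λ x → Σ ℤ λ y → Σ ℤ λ α → Σ ℤ λ β → α * x + β * y ≡ 1ℤ ×
  P divides (- B - b) * x + - C * y × P divides A * x + (B - b) * y

-- The kernel of M − b modulo p contains the columns of M + b.  A combination v = (M + b)(1, t) of them is
-- unimodular modulo p when t is divisible by exactly those primes of p not dividing the whole first column.
kernel-vector : ∀ {A B C b P} → Splitting P → P divides B * B - A * C - b * b → Comaximal (+ 2 * b) P →
  KernelVector A B C b P
kernel-vector {A} {B} {C} {b} {P} split (e , k-b²≡) (R , S , 2b-unit) with bezout (b - B) A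
... | record { d = d₁ ; a′ = k₁ ; b′ = k₂ ; α = α₁ ; β = β₁ ; a≡ = c₁≡ ; b≡ = A≡ ; unit = u₁ } with bezout d₁ P
... | record { d = g ; a′ = k₃ ; b′ = p′ ; α = α₂ ; β = β₂ ; a≡ = d₁≡ ; b≡ = P≡ ; unit = u₂ } with split g
... | t , s , m , P≡ts , s∣gᵐ , (r , r′ , t-g-unit) with bezout (b - B - t * C) (A + t * (b + B))
... | record { d = d ; a′ = x ; b′ = y ; α = α ; β = β ; a≡ = v₁≡ ; b≡ = v₂≡ ; unit = u } =
  x , y , α , β , u , comaximal-cancel d-P first , comaximal-cancel d-P second
  where
  g≡ : g ≡ α₂ * (α₁ * (b - B) + β₁ * A) + β₂ * P
  g≡ = trans (gcd-combination {d₁} {P} {g} {k₃} {p′} {α₂} {β₂} d₁≡ P≡ u₂)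
    (cong (λ d → α₂ * d + β₂ * P) (gcd-combination {b - B} {A} {d₁} {k₁} {k₂} {α₁} {β₁} c₁≡ A≡ u₁))
  c₁∈ : b - B ∈⟨ d , t ⟩
  c₁∈ = difference∈ {b - B} {t} {C} {d} {x} v₁≡
  A∈ : A ∈⟨ d , t ⟩
  A∈ = difference∈ {A} {t} { - (b + B)} {d} {y} (trans (minus-neg A t (b + B)) v₂≡)
    where
    minus-neg : ∀ a t c → a - t * - c ≡ a + t * c
    minus-neg = solve-∀
  P∈ : P ∈⟨ d , t ⟩
  P∈ = subst (_∈⟨ d , t ⟩) (trans (ℤ.*-comm s t) (sym P≡ts)) (*∈ s (∈ʳ d t))
  -- Modulo `t` the vector `v` is the first column, so the ideal of `d` and `t` contains that
  -- column; as `P = ts` it contains `P`, hence `g`, which is prime to `t`.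
  d-t : Comaximal d t
  d-t = subst (_∈⟨ d , t ⟩) t-g-unit (+∈ (*∈ r (∈ʳ d t)) (*∈ r′ (subst (_∈⟨ d , t ⟩) (sym g≡)
    (+∈ (*∈ α₂ (+∈ (*∈ α₁ c₁∈) (*∈ β₁ A∈))) (*∈ β₂ P∈)))))
  d₁∈ : ∀ {k c} → c ≡ d₁ * k → c ∈⟨ d , g ⟩
  d₁∈ {k} {c} c≡ = subst (_∈⟨ d , g ⟩) (sym (trans c≡ (trans (ℤ.*-comm d₁ k) (cong (k *_) (trans d₁≡ (ℤ.*-comm g k₃)))))) (*∈ k (*∈ k₃ (∈ʳ d g)))
  c₄∈ : b + B ∈⟨ d , g ⟩
  c₄∈ = coprime∈ {A} {t} {b + B} {d} {y} {r} {r′} {g} t-g-unit v₂≡ (d₁∈ A≡)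
  -- Modulo `g` the first column vanishes and `t` is a unit, so the ideal of `d` and `g` contains
  -- `b + B` besides `b − B`. It contains their sum `2b` and also `P`, which are comaximal.
  d-g : Comaximal d g
  d-g = subst (_∈⟨ d , g ⟩) (trans (cong (λ c → R * c + S * P) (sum b B)) 2b-unit)
    (+∈ (*∈ R (+∈ (d₁∈ c₁≡) c₄∈)) (*∈ S (subst (_∈⟨ d , g ⟩) (trans (ℤ.*-comm p′ g) (sym P≡)) (*∈ p′ (∈ʳ d g)))))
    where
    sum : ∀ b B → b - B + (b + B) ≡ + 2 * b
    sum = solve-∀
  d-P : Comaximal d P
  d-P = subst (Comaximal d) (sym P≡ts) (comaximal-sym (comaximal-* (comaximal-sym d-t)
    (comaximal-sym (comaximal-factorʳ s∣gᵐ (comaximal-^ʳ m d-g)))))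
  -- `(M − b)v = (M − b)(M + b)(1, t) = (k − b²)(1, t)` is divisible by `P`, and `v = d(x,
  -- y)` with `d` a unit modulo `P`.
  first : P divides d * ((- B - b) * x + - C * y)
  first = e , trans (identity d B b x C y) (trans (cong₂ (λ v w → (- B - b) * v + - C * w) (sym v₁≡) (sym v₂≡)) (trans (identity′ A B C b t) k-b²≡))
    where
    identity : ∀ d B b x C y → d * ((- B - b) * x + - C * y) ≡ (- B - b) * (d * x) + - C * (d * y)
    identity = solve-∀
    identity′ : ∀ A B C b t → (- B - b) * (b - B - t * C) + - C * (A + t * (b + B)) ≡ B * B - A * C - b * b
    identity′ = solve-∀
  second : P divides d * (A * x + (B - b) * y)
  second = t * e , trans (identity d A B b x y) (trans (cong₂ (λ v w → A * v + (B - b) * w) (sym v₁≡) (sym v₂≡)) (trans (identity′ A B C b t) (trans (cong (t *_) k-b²≡) (regroup t P e))))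
    where
    identity : ∀ d A B b x y → d * (A * x + (B - b) * y) ≡ A * (d * x) + (B - b) * (d * y)
    identity = solve-∀
    identity′ : ∀ A B C b t → A * (b - B - t * C) + (B - b) * (A + t * (b + B)) ≡ t * (B * B - A * C - b * b)
    identity′ = solve-∀
    regroup : ∀ t P e → t * (P * e) ≡ P * (t * e)
    regroup = solve-∀

discriminant-neighbour : ∀ {b D f g} .{{_ : ℤ.NonZero D}} → Neighbour b D f g → discriminant g ≡ discriminant f
discriminant-neighbour {D = D} {f} {g} (neighbour N _ refl MN≡NM _) = ℤ.neg-injective (ℤ.*-cancelˡ-≡ D _ _
  (trans (cong (D *_) (sym (det-⟦⟧ g))) (trans (sym (det-⊗ N ⟦ g ⟧)) (trans (cong det (sym MN≡NM)) (trans (det-⊗ ⟦ f ⟧ N)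
  (trans (ℤ.*-comm (det ⟦ f ⟧) D) (cong (D *_) (det-⟦⟧ f))))))))
  where
  det-⟦⟧ : ∀ f → det ⟦ f ⟧ ≡ - discriminant f
  det-⟦⟧ (half A B C) = identity A B C
    where
    identity : ∀ A B C → - B * B - - C * A ≡ - (B * B - A * C)
    identity = solve-∀

infix 4 _∈⟪_,_,_⟫
_∈⟪_,_,_⟫ : ℤ → ℤ → ℤ → ℤ → Set
w ∈⟪ x , y , z ⟫ = Σ ℤ λ l → Σ ℤ λ m → Σ ℤ λ n → l * x + m * y + n * z ≡ w

combination₃ : ∀ {x y z a b c} p q r → a ∈⟪ x , y , z ⟫ → b ∈⟪ x , y , z ⟫ → c ∈⟪ x , y , z ⟫ → p * a + q * b + r * c ∈⟪ x , y , z ⟫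
combination₃ {x} {y} {z} p q r (l₁ , m₁ , n₁ , refl) (l₂ , m₂ , n₂ , refl) (l₃ , m₃ , n₃ , refl) =
  p * l₁ + q * l₂ + r * l₃ , p * m₁ + q * m₂ + r * m₃ , p * n₁ + q * n₂ + r * n₃ , identity x y z p q r l₁ m₁ n₁ l₂ m₂ n₂ l₃ m₃ n₃
  where
  identity : ∀ x y z p q r l₁ m₁ n₁ l₂ m₂ n₂ l₃ m₃ n₃ → (p * l₁ + q * l₂ + r * l₃) * x + (p * m₁ + q * m₂ + r * m₃) * y + (p * n₁ + q * n₂ + r * n₃) * z
    ≡ p * (l₁ * x + m₁ * y + n₁ * z) + q * (l₂ * x + m₂ * y + n₂ * z) + r * (l₃ * x + m₃ * y + n₃ * z)
  identity = solve-∀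

-- In the basis v = (x , y), w = (−β , α) the form becomes (−Pa, 2B′, C′), and its neighbour is (a, 2B′, −PC′).
module NeighbourStep {A B C b P x y α β j₁ j₂ a B′ C′ : ℤ} (u : α * x + β * y ≡ 1ℤ)
  (e₁ : (- B - b) * x + - C * y ≡ P * j₁) (e₂ : A * x + (B - b) * y ≡ P * j₂)
  (a≡ : a ≡ y * j₁ - x * j₂) (B′≡ : B′ ≡ - (b + P * (α * j₁ + β * j₂))) (C′≡ : C′ ≡ A * (β * β) - + 2 * B * (β * α) + C * (α * α)) where

  B′≡′ : B′ ≡ α * (B * x + C * y) - β * (A * x + B * y)
  B′≡′ = combine (cong₂ _+_ B′≡ (cong₂ _+_ (cong (b *_) u) (cong₂ _+_ (cong (α *_) e₁) (cong (β *_) e₂))))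
    (solve (A ∷ B ∷ C ∷ b ∷ P ∷ x ∷ y ∷ α ∷ β ∷ j₁ ∷ j₂ ∷ B′ ∷ []))

  i₁₁ : - B * x + - C * y ≡ x * - B′ + P * β * a
  i₁₁ = combine (cong₂ _+_ e₁ (cong₂ _+_ (cong (x *_) B′≡) (cong₂ _+_ (cong (P * β *_) (sym a≡)) (cong (P * j₁ *_) (sym u)))))
    (solve (B ∷ C ∷ b ∷ P ∷ x ∷ y ∷ α ∷ β ∷ j₁ ∷ j₂ ∷ a ∷ B′ ∷ []))

  i₂₁ : A * x + B * y ≡ y * - B′ + - (P * α) * a
  i₂₁ = combine (cong₂ _+_ e₂ (cong₂ _+_ (cong (y *_) B′≡) (cong₂ _+_ (cong (P * α *_) a≡) (cong (P * j₂ *_) (sym u)))))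
    (solve (A ∷ B ∷ b ∷ P ∷ x ∷ y ∷ α ∷ β ∷ j₁ ∷ j₂ ∷ a ∷ B′ ∷ []))

  w₁₂ : C * α - B * β ≡ x * C′ + β * B′
  w₁₂ = combine (cong₂ _+_ (cong (x *_) (sym C′≡)) (cong₂ _+_ (cong (β *_) (sym B′≡′)) (cong ((C * α - B * β) *_) (sym u))))
    (solve (A ∷ B ∷ C ∷ x ∷ y ∷ α ∷ β ∷ B′ ∷ C′ ∷ []))

  w₂₂ : A * β - B * α ≡ y * C′ - α * B′
  w₂₂ = combine (cong₂ _+_ (cong (y *_) (sym C′≡)) (cong₂ _+_ (cong (α *_) B′≡′) (cong ((A * β - B * α) *_) (sym u))))
    (solve (A ∷ B ∷ C ∷ x ∷ y ∷ α ∷ β ∷ B′ ∷ C′ ∷ []))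

  i₁₂ : - B * (P * β) + - C * - (P * α) ≡ x * - - (P * C′) + P * β * B′
  i₁₂ = combine (cong (P *_) w₁₂) (solve (B ∷ C ∷ P ∷ x ∷ α ∷ β ∷ B′ ∷ C′ ∷ []))

  i₂₂ : A * (P * β) + B * - (P * α) ≡ y * - - (P * C′) + - (P * α) * B′
  i₂₂ = combine (cong (P *_) w₂₂) (solve (A ∷ B ∷ P ∷ y ∷ α ∷ β ∷ B′ ∷ C′ ∷ []))

  f = half A B C
  g = half a B′ (- (P * C′))

  neighbour-step : Neighbour b (- P) f g
  neighbour-step = neighbour (mat x (P * β) y (- (P * α))) (mat (- j₁) ((- B - b) * - β + - C * α) (- j₂) (A * - β + (B - b) * α))
    det-N
    (mat-≡ i₁₁ i₁₂ i₂₁ i₂₂)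
    (mat-≡ (trans e₁ (neg-neg P j₁)) (second-column (- B - b) (- C) P α β) (trans e₂ (neg-neg P j₂)) (second-column A (B - b) P α β))
    where
    det-N : x * - (P * α) - P * β * y ≡ - P
    det-N = combine (cong (- P *_) u) (solve (x ∷ P ∷ α ∷ β ∷ y ∷ []))
    neg-neg : ∀ P j → P * j ≡ - P * - j
    neg-neg = solve-∀
    second-column : ∀ v w P α β → v * (P * β) + w * - (P * α) ≡ - P * (v * - β + w * α)
    second-column = solve-∀

  A≡ : A ≡ α * α * - (P * a) + - (α * y) * (+ 2 * B′) + y * y * C′
  A≡ = combine (cong₂ _+_ (cong (A *_) (sym u)) (cong₂ _+_ (cong (α *_) i₂₁) (cong (y *_) w₂₂)))
    (solve (A ∷ B ∷ P ∷ x ∷ y ∷ α ∷ β ∷ a ∷ B′ ∷ C′ ∷ []))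

  2B≡ : + 2 * B ≡ + 2 * (α * β) * - (P * a) + (α * x - β * y) * (+ 2 * B′) + - (+ 2 * (x * y)) * C′
  2B≡ = combine (cong (+ 2 *_) (cong₂ _+_ (cong (B *_) (sym u)) (cong₂ _+_ (cong (β *_) i₂₁) (cong (x *_) (sym w₂₂)))))
    (solve (A ∷ B ∷ P ∷ x ∷ y ∷ α ∷ β ∷ a ∷ B′ ∷ C′ ∷ []))

  C≡ : C ≡ β * β * - (P * a) + x * β * (+ 2 * B′) + x * x * C′
  C≡ = combine (cong₂ _+_ (cong (C *_) (sym u)) (cong₂ _+_ (cong (β *_) (sym i₁₁)) (cong (x *_) w₁₂)))
    (solve (B ∷ C ∷ P ∷ x ∷ y ∷ α ∷ β ∷ a ∷ B′ ∷ C′ ∷ []))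

  prim-step : Comaximal (+ 2 * b) P → Prim f → Prim g
  prim-step (R , S , 2b-unit) (l , m , n , prim) = subst (_∈⟪ a , + 2 * B′ , - (P * C′) ⟫) (trans (sym (cong₂ _+_ (cong₂ _+_ (cong (l *_) A≡) (cong (m *_) 2B≡)) (cong (n *_) C≡))) prim)
    (combination₃ l m n (combination₃ (α * α) (- (α * y)) (y * y) Pa∈ 2B′∈ C′∈)
      (combination₃ (+ 2 * (α * β)) (α * x - β * y) (- (+ 2 * (x * y))) Pa∈ 2B′∈ C′∈)
      (combination₃ (β * β) (x * β) (x * x) Pa∈ 2B′∈ C′∈))
    where
    X = α * j₁ + β * j₂
    Pa∈ : - (P * a) ∈⟪ a , + 2 * B′ , - (P * C′) ⟫
    Pa∈ = - P , 0ℤ , 0ℤ , identity P a (+ 2 * B′) (- (P * C′))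
      where
      identity : ∀ P a v w → - P * a + 0ℤ * v + 0ℤ * w ≡ - (P * a)
      identity = solve-∀
    2B′∈ : + 2 * B′ ∈⟪ a , + 2 * B′ , - (P * C′) ⟫
    2B′∈ = 0ℤ , 1ℤ , 0ℤ , identity a (+ 2 * B′) (- (P * C′))
      where
      identity : ∀ a v w → 0ℤ * a + 1ℤ * v + 0ℤ * w ≡ v
      identity = solve-∀
    -- 2B′ is a unit modulo P because B′ ≡ −b.
    C′∈ : C′ ∈⟪ a , + 2 * B′ , - (P * C′) ⟫
    C′∈ = 0ℤ , - (R * C′) , - (S - + 2 * (R * X)) ,
      trans (cong (λ B′ → 0ℤ * a + - (R * C′) * (+ 2 * B′) + - (S - + 2 * (R * X)) * - (P * C′)) B′≡)
      (trans (identity a R C′ b P X S) (trans (cong (C′ *_) 2b-unit) (ℤ.*-identityʳ C′)))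
      where
      identity : ∀ a R C′ b P X S → 0ℤ * a + - (R * C′) * (+ 2 * - (b + P * X)) + - (S - + 2 * (R * X)) * - (P * C′) ≡ C′ * (R * (+ 2 * b) + S * P)
      identity = solve-∀

  result : .{{_ : ℤ.NonZero (- P)}} → Comaximal (+ 2 * b) P → Prim f →
    Σ HalfForm λ g → discriminant g ≡ discriminant f × Prim g × Neighbour b (- P) f g
  result 2b-P prim = g , discriminant-neighbour neighbour-step , prim-step 2b-P prim , neighbour-step

neighbour-exists : ∀ {b P} f .{{_ : ℤ.NonZero (- P)}} → Splitting P → P divides discriminant f - b * b → Comaximal (+ 2 * b) P → Prim f →
  Σ HalfForm λ g → discriminant g ≡ discriminant f × Prim g × Neighbour b (- P) f g
neighbour-exists {b} {P} (half A B C) split k-b² 2b-P prim = from-kernel (kernel-vector {A} {B} {C} {b} {P} split k-b² 2b-P)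
  where
  from-kernel : KernelVector A B C b P → Σ HalfForm λ g → discriminant g ≡ B * B - A * C × Prim g × Neighbour b (- P) (half A B C) g
  from-kernel (x , y , α , β , u , (j₁ , e₁) , (j₂ , e₂)) =
    NeighbourStep.result {A} {B} {C} {b} {P} {x} {y} {α} {β} {j₁} {j₂} u e₁ e₂ refl refl refl 2b-P prim

-- Neighbours of a form by itself

-- `N = x + wM` is multiplication by `x + w√k`. It commutes with `M`, and
-- `(M − b)N = w(k − b²) + (x − bw)(M − b)`.
self-neighbour : ∀ {b D} f x w i e → x * x - discriminant f * (w * w) ≡ D → x - b * w ≡ D * i → discriminant f - b * b ≡ D * e →
  Neighbour b D f f
self-neighbour {b} {D} f@(half A B C) x w i e norm x-bw k-b² = neighbour
  (mat (x - w * B) (- (w * C)) (w * A) (x + w * B)) (mat (w * e - i * b - i * B) (- (i * C)) (i * A) (w * e - i * b + i * B))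
  (trans (det≡ A B C x w) norm)
  (mat-≡ (c₁₁ A B C x w) (c₁₂ A B C x w) (c₂₁ A B C x w) (c₂₂ A B C x w))
  (mat-≡ j₁₁ j₁₂ j₂₁ j₂₂)
  where
  det≡ : ∀ A B C x w → (x - w * B) * (x + w * B) - - (w * C) * (w * A) ≡ x * x - (B * B - A * C) * (w * w)
  det≡ = solve-∀
  c₁₁ : ∀ A B C x w → - B * (x - w * B) + - C * (w * A) ≡ (x - w * B) * - B + - (w * C) * A
  c₁₁ = solve-∀
  c₁₂ : ∀ A B C x w → - B * - (w * C) + - C * (x + w * B) ≡ (x - w * B) * - C + - (w * C) * B
  c₁₂ = solve-∀
  c₂₁ : ∀ A B C x w → A * (x - w * B) + B * (w * A) ≡ w * A * - B + (x + w * B) * A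
  c₂₁ = solve-∀
  c₂₂ : ∀ A B C x w → A * - (w * C) + B * (x + w * B) ≡ w * A * - C + (x + w * B) * B
  c₂₂ = solve-∀
  k-b²′ : B * B - A * C - b * b ≡ D * e
  k-b²′ = k-b²
  j₁₁ : (- B - b) * (x - w * B) + - C * (w * A) ≡ D * (w * e - i * b - i * B)
  j₁₁ = combine (cong₂ _+_ (cong (w *_) k-b²′) (cong ((- b - B) *_) x-bw)) (solve (A ∷ B ∷ C ∷ b ∷ x ∷ w ∷ D ∷ i ∷ e ∷ []))
  j₁₂ : (- B - b) * - (w * C) + - C * (x + w * B) ≡ D * - (i * C)
  j₁₂ = combine (cong (- C *_) x-bw) (solve (B ∷ C ∷ b ∷ x ∷ w ∷ D ∷ i ∷ []))
  j₂₁ : A * (x - w * B) + (B - b) * (w * A) ≡ D * (i * A)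
  j₂₁ = combine (cong (A *_) x-bw) (solve (A ∷ B ∷ b ∷ x ∷ w ∷ D ∷ i ∷ []))
  j₂₂ : A * - (w * C) + (B - b) * (x + w * B) ≡ D * (w * e - i * b + i * B)
  j₂₂ = combine (cong₂ _+_ (cong (w *_) k-b²′) (cong ((B - b) *_) x-bw)) (solve (A ∷ B ∷ C ∷ b ∷ x ∷ w ∷ D ∷ i ∷ e ∷ []))

-- The matrices commuting with that of a primitive form are X + YM.
fixed-point : ∀ {b D} f → Prim f → Neighbour b D f f → Σ ℤ λ X → Σ ℤ λ Y → X * X - discriminant f * (Y * Y) ≡ D × D divides X - b * Y
fixed-point {b} {D} (half A B C) (l , m , n , unit) (neighbour (mat n₁ n₂ n₃ n₄) (mat j₁ j₂ j₃ j₄) det≡ MN≡NM image) = X , Y , norm , divisible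
  where
  -- For `N = X + YM` the entries satisfy `n₃ = YA`, `n₄ − n₁ = 2YB` and `−n₂ = YC`; the primitivity
  -- relation combines these into `Y`.
  Y = l * n₃ - m * (n₁ - n₄) - n * n₂
  X = n₄ - Y * B
  c₁₁ : - B * n₁ + - C * n₃ ≡ n₁ * - B + n₂ * A
  c₁₁ = cong m₁₁ MN≡NM
  c₁₂ : - B * n₂ + - C * n₄ ≡ n₁ * - C + n₂ * B
  c₁₂ = cong m₁₂ MN≡NM
  c₂₁ : A * n₁ + B * n₃ ≡ n₃ * - B + n₄ * A
  c₂₁ = cong m₂₁ MN≡NM
  n₃≡ : n₃ ≡ (l * n₃ - m * (n₁ - n₄) - n * n₂) * A
  n₃≡ = combine (cong₂ _+_ (cong (n₃ *_) (sym unit)) (cong₂ _+_ (cong (m *_) c₂₁) (cong (n *_) (sym c₁₁))))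
    (solve (A ∷ B ∷ C ∷ l ∷ m ∷ n ∷ n₁ ∷ n₂ ∷ n₃ ∷ n₄ ∷ []))
  n₁-n₄≡ : n₁ - n₄ ≡ - ((l * n₃ - m * (n₁ - n₄) - n * n₂) * (+ 2 * B))
  n₁-n₄≡ = combine (cong₂ _+_ (cong ((n₁ - n₄) *_) (sym unit)) (cong₂ _+_ (cong (l *_) c₂₁) (cong (n *_) c₁₂)))
    (solve (A ∷ B ∷ C ∷ l ∷ m ∷ n ∷ n₁ ∷ n₂ ∷ n₃ ∷ n₄ ∷ []))
  n₂≡ : n₂ ≡ - ((l * n₃ - m * (n₁ - n₄) - n * n₂) * C)
  n₂≡ = combine (cong₂ _+_ (cong (n₂ *_) (sym unit)) (cong₂ _+_ (cong (l *_) (sym c₁₁)) (cong (m *_) (sym c₁₂))))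
    (solve (A ∷ B ∷ C ∷ l ∷ m ∷ n ∷ n₁ ∷ n₂ ∷ n₃ ∷ n₄ ∷ []))
  norm-identity : ∀ {A B C Y n₁ n₂ n₃ n₄} → n₃ ≡ Y * A → n₁ - n₄ ≡ - (Y * (+ 2 * B)) → n₂ ≡ - (Y * C) →
    (n₄ - Y * B) * (n₄ - Y * B) - (B * B - A * C) * (Y * Y) ≡ n₁ * n₄ - n₂ * n₃
  norm-identity {A} {B} {C} {Y} {n₁} {n₄ = n₄} refl e refl = combine (cong (n₄ *_) (sym e)) (solve (A ∷ B ∷ C ∷ Y ∷ n₁ ∷ n₄ ∷ []))
  norm : X * X - (B * B - A * C) * (Y * Y) ≡ D
  norm = trans (norm-identity {A} {B} {C} {Y} {n₁} {n₂} {n₃} {n₄} n₃≡ n₁-n₄≡ n₂≡) det≡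
  i₁₁ : (- B - b) * n₁ + - C * n₃ ≡ D * j₁
  i₁₁ = cong m₁₁ image
  i₁₂ : (- B - b) * n₂ + - C * n₄ ≡ D * j₂
  i₁₂ = cong m₁₂ image
  i₂₁ : A * n₁ + (B - b) * n₃ ≡ D * j₃
  i₂₁ = cong m₂₁ image
  i₂₂ : A * n₂ + (B - b) * n₄ ≡ D * j₄
  i₂₂ = cong m₂₂ image
  divisible-identity : ∀ {A B C b D l m n Y n₁ n₂ n₃ n₄} → l * A + m * (+ 2 * B) + n * C ≡ 1ℤ →
    n₃ ≡ Y * A → n₁ ≡ n₄ - Y * (+ 2 * B) → n₂ ≡ - (Y * C) →
    (- B - b) * n₁ + - C * n₃ ≡ D * j₁ → (- B - b) * n₂ + - C * n₄ ≡ D * j₂ → A * n₁ + (B - b) * n₃ ≡ D * j₃ → A * n₂ + (B - b) * n₄ ≡ D * j₄ →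
    n₄ - Y * B - b * Y ≡ D * (l * j₃ + m * (j₄ - j₁) - n * j₂)
  divisible-identity {A} {B} {C} {b} {D} {l} {m} {n} {Y} {n₄ = n₄} unit refl refl refl i₁₁ i₁₂ i₂₁ i₂₂ =
    trans (times-unit unit) (trans (cong₂ _+_ (cong₂ _+_ (cong (l *_) (trans (a₂₁ A B b Y n₄) i₂₁)) (cong (m *_) (trans (a₂₂ A B C b Y n₄) (cong₂ _-_ i₂₂ i₁₁)))) (cong (n *_) (trans (a₁₂ B C b Y n₄) (cong -_ i₁₂))))
      (collect D l m n j₁ j₂ j₃ j₄))
    where
    times-unit : l * A + m * (+ 2 * B) + n * C ≡ 1ℤ → n₄ - Y * B - b * Y ≡ l * (A * (n₄ - Y * B - b * Y)) + m * (+ 2 * B * (n₄ - Y * B - b * Y)) + n * (C * (n₄ - Y * B - b * Y))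
    times-unit unit = trans (sym (ℤ.*-identityʳ _)) (trans (cong ((n₄ - Y * B - b * Y) *_) (sym unit)) (spread l m n A (+ 2 * B) C (n₄ - Y * B - b * Y)))
      where
      spread : ∀ l m n A B C z → z * (l * A + m * B + n * C) ≡ l * (A * z) + m * (B * z) + n * (C * z)
      spread = solve-∀
    a₂₁ : ∀ A B b Y n → A * (n - Y * B - b * Y) ≡ A * (n - Y * (+ 2 * B)) + (B - b) * (Y * A)
    a₂₁ = solve-∀
    a₂₂ : ∀ A B C b Y n → + 2 * B * (n - Y * B - b * Y) ≡ A * - (Y * C) + (B - b) * n - ((- B - b) * (n - Y * (+ 2 * B)) + - C * (Y * A))
    a₂₂ = solve-∀
    a₁₂ : ∀ B C b Y n → C * (n - Y * B - b * Y) ≡ - ((- B - b) * - (Y * C) + - C * n)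
    a₁₂ = solve-∀
    collect : ∀ D l m n j₁ j₂ j₃ j₄ → l * (D * j₃) + m * (D * j₄ - D * j₁) + n * - (D * j₂) ≡ D * (l * j₃ + m * (j₄ - j₁) - n * j₂)
    collect = solve-∀
  -- `(M − b)(X + YM)` has the non-scalar part `(X − bY)M`, so `D` divides `X − bY` times each of
  -- `A`, `2B` and `C`; primitivity removes these factors.
  divisible : D divides X - b * Y
  divisible = l * j₃ + m * (j₄ - j₁) - n * j₂ ,
    divisible-identity {A} {B} {C} {b} {D} {l} {m} {n} {Y} {n₁} {n₂} {n₃} {n₄} unit n₃≡ (from-difference n₁-n₄≡) n₂≡ i₁₁ i₁₂ i₂₁ i₂₂
    where
    from-difference : ∀ {u v w} → u - v ≡ - w → u ≡ v - w
    from-difference {u} {v} {w} e = combine e (solve (u ∷ v ∷ w ∷ []))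

-- The permutation of the class representatives

abs-unit : ∀ i j → i * j ≡ 1ℤ → ∣ i ∣ ≡ 1
abs-unit i j e = ℕ.m*n≡1⇒m≡1 ∣ i ∣ ∣ j ∣ (trans (sym (ℤ.abs-* i j)) (cong ∣_∣ e))

primitive⇒prim : ∀ f → Primitive (to-form f) → Prim f
primitive⇒prim (half A B C) = go (bezout A (+ 2 * B))
  where
  divides-abs : ∀ {a d c} → a ≡ d * c → ∣ d ∣ ℕ.∣ ∣ a ∣
  divides-abs {a} {d} {c} a≡ = ℕ.divides ∣ c ∣ (trans (cong ∣_∣ a≡) (trans (ℤ.abs-* d c) (ℕ.*-comm ∣ d ∣ ∣ c ∣)))
  go : Bezout A (+ 2 * B) → ℤ.gcd (ℤ.gcd A (+ 2 * B)) C ≡ 1ℤ → Prim (half A B C)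
  go record { d = d ; a′ = a′ ; b′ = b′ ; α = α ; β = β ; a≡ = A≡ ; b≡ = 2B≡ ; unit = u } gcd≡1 = go′ (bezout d C)
    where
    go′ : Bezout d C → Prim (half A B C)
    go′ record { d = e ; a′ = d′ ; b′ = c′ ; α = α′ ; β = β′ ; a≡ = d≡ ; b≡ = C≡ ; unit = u′ } =
      e * α′ * α , e * α′ * β , e * β′ , trans (regroup e α′ α β β′ A (+ 2 * B) C)
        (trans (cong (e *_) (trans (cong (λ d → α′ * d + β′ * C) (sym (gcd-combination {A} {+ 2 * B} {d} {a′} {b′} {α} {β} A≡ 2B≡ u)))
          (sym (gcd-combination {d} {C} {e} {d′} {c′} {α′} {β′} d≡ C≡ u′)))) (unit-square e (ℕ.∣1⇒≡1 e∣1)))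
      where
      regroup : ∀ e α′ α β β′ A B C → e * α′ * α * A + e * α′ * β * B + e * β′ * C ≡ e * (α′ * (α * A + β * B) + β′ * C)
      regroup = solve-∀
      e∣d : ∣ e ∣ ℕ.∣ ∣ d ∣
      e∣d = divides-abs {d} {e} {d′} d≡
      e∣1 : ∣ e ∣ ℕ.∣ 1
      e∣1 = subst (λ g → ∣ e ∣ ℕ.∣ ∣ g ∣) gcd≡1 (ℤ.gcd-greatest {ℤ.gcd A (+ 2 * B)} {C} {e}
        (ℤ.gcd-greatest {A} {+ 2 * B} {e} (ℕ.∣-trans e∣d (divides-abs {A} {d} {a′} A≡)) (ℕ.∣-trans e∣d (divides-abs {+ 2 * B} {d} {b′} 2B≡)))
        (divides-abs {C} {e} {c′} C≡))

prim⇒primitive : ∀ f → Prim f → Primitive (to-form f)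
prim⇒primitive (half A B C) (l , m , n , unit) = cong +_ (abs-unit g (l * q₁ + m * q₂ + n * q₃)
  (trans (factor g l m n q₁ q₂ q₃) (trans (cong₂ _+_ (cong₂ _+_ (cong (l *_) (sym A≡)) (cong (m *_) (sym 2B≡))) (cong (n *_) (sym C≡))) unit)))
  where
  h = ℤ.gcd A (+ 2 * B)
  g = ℤ.gcd h C
  g∣A = ℤ.∣ᵤ⇒∣ {g} {A} (ℕ.∣-trans (ℤ.gcd[i,j]∣i h C) (ℤ.gcd[i,j]∣i A (+ 2 * B)))
  g∣2B = ℤ.∣ᵤ⇒∣ {g} {+ 2 * B} (ℕ.∣-trans (ℤ.gcd[i,j]∣i h C) (ℤ.gcd[i,j]∣j A (+ 2 * B)))
  g∣C = ℤ.∣ᵤ⇒∣ {g} {C} (ℤ.gcd[i,j]∣j h C)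
  q₁ = ℤ._∣_.quotient g∣A
  q₂ = ℤ._∣_.quotient g∣2B
  q₃ = ℤ._∣_.quotient g∣C
  A≡ : A ≡ q₁ * g
  A≡ = ℤ._∣_.equality g∣A
  2B≡ : + 2 * B ≡ q₂ * g
  2B≡ = ℤ._∣_.equality g∣2B
  C≡ : C ≡ q₃ * g
  C≡ = ℤ._∣_.equality g∣C
  factor : ∀ g l m n q₁ q₂ q₃ → g * (l * q₁ + m * q₂ + n * q₃) ≡ l * (q₁ * g) + m * (q₂ * g) + n * (q₃ * g)
  factor = solve-∀

half-form : ∀ {k} f → disc f ≡ + 4 * k → Σ HalfForm λ g → to-form g ≡ f × discriminant g ≡ k
half-form {k} (form a b c) disc≡ = by-remainder (b ℤ.%ℕ 2) (b ℤ./ℕ 2) (ℤ.n%ℕd<d b 2) (ℤ.a≡a%ℕn+[a/ℕn]*n b 2) disc≡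
  where
  by-remainder : ∀ r q → r ℕ.< 2 → b ≡ + r + q * + 2 → b * b - + 4 * (a * c) ≡ + 4 * k → Σ HalfForm λ g → to-form g ≡ form a b c × discriminant g ≡ k
  by-remainder 0 q _ b≡ disc≡ = half a q c , cong (λ b → form a b c) (sym b≡2q) , ℤ.*-cancelˡ-≡ (+ 4) _ _ (trans (factor a q c) (trans (cong (λ b → b * b - + 4 * (a * c)) (sym b≡2q)) disc≡))
    where
    b≡2q : b ≡ + 2 * q
    b≡2q = trans b≡ (trans (ℤ.+-identityˡ (q * + 2)) (ℤ.*-comm q (+ 2)))
    factor : ∀ a q c → + 4 * (q * q - a * c) ≡ + 2 * q * (+ 2 * q) - + 4 * (a * c)
    factor = solve-∀
  by-remainder 1 q _ b≡ disc≡ = ⊥-elim (4≢1 (abs-unit (+ 4) (k + a * c - q - q * q) (unit a q c k b≡ disc≡)))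
    where
    4≢1 : 4 ≢ 1
    4≢1 ()
    unit : ∀ {b} a q c k → b ≡ 1ℤ + q * + 2 → b * b - + 4 * (a * c) ≡ + 4 * k → + 4 * (k + a * c - q - q * q) ≡ 1ℤ
    unit a q c k refl e = combine (sym e) (solve (a ∷ q ∷ c ∷ k ∷ []))
  by-remainder (ℕ.suc (ℕ.suc _)) q (ℕ.s≤s (ℕ.s≤s ())) _ _

power-divides : ∀ {n a} i j → i ℕ.≤ j → n ^ j divides a → n ^ i divides a
power-divides {n} {a} i j i≤j (c , a≡) = n ^ (j ∸ i) * c ,
  trans a≡ (trans (cong (λ j → n ^ j * c) (sym (ℕ.m+[n∸m]≡n i≤j))) (trans (cong (_* c) (ℤ.^-distribˡ-+-* n i (j ∸ i))) (ℤ.*-assoc (n ^ i) (n ^ (j ∸ i)) c)))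

module ClassAction {y k P b} (y-prime : Prime y) .{{P≢0 : ℤ.NonZero (- P)}} (split : Splitting P) (2b-P : Comaximal (+ 2 * b) P)
  (k-b² : (- P) ^ y divides k - b * b)
  (self : ∀ f → discriminant f ≡ k → Neighbour b ((- P) ^ y) f f)
  (free : ∀ f → discriminant f ≡ k → Prim f → ¬ Neighbour b (- P) f f) where

  2b-[-P] : Comaximal (+ 2 * b) (- P)
  2b-[-P] = comaximal-neg 2b-P

  power-nonzero : ∀ n → ℤ.NonZero ((- P) ^ n)
  power-nonzero n = ℤ.≢-nonZero λ Pⁿ≡0 → ℕ.≢-nonZero⁻¹ ∣ - P ∣ (cong ∣_∣ (ℤ.i^n≡0⇒i≡0 (- P) n Pⁿ≡0))

  module _ {h} (class-number : IsClassNumber (+ 4 * k) h) where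
    rep : Fin h → Form
    rep = proj₁ class-number

    rep-half : ∀ i → Σ HalfForm λ g → to-form g ≡ rep i × discriminant g ≡ k
    rep-half i = half-form {k} (rep i) (proj₂ (proj₁ (proj₂ class-number) i))

    F : Fin h → HalfForm
    F i = proj₁ (rep-half i)

    to-form-F : ∀ i → to-form (F i) ≡ rep i
    to-form-F i = proj₁ (proj₂ (rep-half i))

    discriminant-F : ∀ i → discriminant (F i) ≡ k
    discriminant-F i = proj₂ (proj₂ (rep-half i))

    prim-F : ∀ i → Prim (F i)
    prim-F i = primitive⇒prim (F i) (subst Primitive (sym (to-form-F i)) (proj₁ (proj₁ (proj₂ class-number) i)))

    disc-to-form : ∀ g → discriminant g ≡ k → disc (to-form g) ≡ + 4 * k
    disc-to-form (half A B C) disc≡ = trans (identity A B C) (cong (+ 4 *_) disc≡)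
      where
      identity : ∀ A B C → + 2 * B * (+ 2 * B) - + 4 * (A * C) ≡ + 4 * (B * B - A * C)
      identity = solve-∀

    compose : ∀ {f g l} m n → m ℕ.+ n ℕ.≤ y → discriminant f ≡ k → Neighbour b ((- P) ^ m) f g → Neighbour b ((- P) ^ n) g l → Neighbour b ((- P) ^ (m ℕ.+ n)) f l
    compose {f} {g} {l} m n m+n≤y disc≡ fg gl = subst (λ D → Neighbour b D f l) (sym (ℤ.^-distribˡ-+-* (- P) m n))
      (neighbour-compose {b} {(- P) ^ m} {(- P) ^ n} {f} {g} {l} (subst (Comaximal (+ 2 * b)) (ℤ.^-distribˡ-+-* (- P) m n) (comaximal-^ʳ (m ℕ.+ n) 2b-[-P]))
        (subst (_divides discriminant f - b * b) (ℤ.^-distribˡ-+-* (- P) m n) (power-divides (m ℕ.+ n) y m+n≤y (subst (λ k → (- P) ^ y divides k - b * b) (sym disc≡) k-b²))) fg gl)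

    1≤y : 1 ℕ.≤ y
    1≤y = ℕ.>-nonZero⁻¹ y {{prime⇒nonZero y-prime}}

    step : ∀ i → Σ (Fin h) λ j → Neighbour b ((- P) ^ 1) (F i) (F j)
    step i = from-neighbour (neighbour-exists (F i) split (subst (λ k → P divides k - b * b) (sym (discriminant-F i)) P∣k-b²) 2b-P (prim-F i))
      where
      P∣k-b² : P divides k - b * b
      P∣k-b² = negate {P} {k - b * b} (power-divides 1 y 1≤y k-b²)
        where
        negate : ∀ {n a} → (- n) ^ 1 divides a → n divides a
        negate {n} {a} (j , a≡) = - j , trans a≡ (identity n j)
          where
          identity : ∀ n j → - n * 1ℤ * j ≡ n * - j
          identity = solve-∀
      from-neighbour : (Σ HalfForm λ g → discriminant g ≡ discriminant (F i) × Prim g × Neighbour b (- P) (F i) g) → Σ (Fin h) λ j → Neighbour b ((- P) ^ 1) (F i) (F j)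
      from-neighbour (g , disc≡ , prim-g , Fi-g) = from-class (proj₂ (proj₂ (proj₂ class-number)) (to-form g) (prim⇒primitive g prim-g) (disc-to-form g (trans disc≡ (discriminant-F i))))
        where
        from-class : (Σ (Fin h) λ j → Equiv (to-form g) (rep j)) → Σ (Fin h) λ j → Neighbour b ((- P) ^ 1) (F i) (F j)
        -- The passage from `g` to its representative is composed as a neighbour of exponent 0.
        from-class (j , g∼rep) = j , compose {F i} {g} {F j} 1 0 1≤y (discriminant-F i) (subst (λ D → Neighbour b D (F i) g) (sym (ℤ.*-identityʳ (- P))) Fi-g)
          (neighbour-of-equivalence b g (F j) (subst (Equiv (to-form g)) (sym (to-form-F j)) g∼rep))

    T : Fin h → Fin h
    T i = proj₁ (step i)

    iterate-neighbour : ∀ n → n ℕ.≤ y → ∀ i → Neighbour b ((- P) ^ n) (F i) (F (iterate T n i))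
    -- The identity matrix, as multiplication by `1 + 0√k`.
    iterate-neighbour ℕ.zero    _    i = self-neighbour (F i) 1ℤ 0ℤ 1ℤ (discriminant (F i) - b * b) (norm (discriminant (F i))) (identity b) (sym (ℤ.*-identityˡ _))
      where
      norm : ∀ k → 1ℤ * 1ℤ - k * (0ℤ * 0ℤ) ≡ 1ℤ
      norm = solve-∀
      identity : ∀ b → 1ℤ - b * 0ℤ ≡ 1ℤ * 1ℤ
      identity = solve-∀
    iterate-neighbour (ℕ.suc n) 1+n≤y i = compose {F i} {F (T i)} {F (iterate T n (T i))} 1 n 1+n≤y (discriminant-F i) (proj₂ (step i)) (iterate-neighbour n (ℕ.<⇒≤ 1+n≤y) (T i))

    -- Both `F (iterate T y i)` and, by `self`, `F i` are neighbours of `F i` for `(−P)^y`.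
    -- Uniqueness makes them equivalent, and equivalent representatives have the same index.
    Tʸ≡id : ∀ i → iterate T y i ≡ i
    Tʸ≡id i = proj₁ (proj₂ (proj₂ class-number)) (iterate T y i) i (subst₂ Equiv (to-form-F (iterate T y i)) (to-form-F i)
      (equivalent {b} {F (iterate T y i)} {F i} (neighbour-unique {b} {(- P) ^ y} {F i} {F (iterate T y i)} {F i} {{power-nonzero y}} (comaximal-^ʳ y 2b-[-P])
        (iterate-neighbour y ℕ.≤-refl i) (self (F i) (discriminant-F i)))))

    T-free : ∀ i → T i ≢ i
    T-free i Ti≡i = free (F i) (discriminant-F i) (prim-F i) (subst₂ (λ D j → Neighbour b D (F i) (F j)) (ℤ.*-identityʳ (- P)) Ti≡i (proj₂ (step i)))

    class-number-divisible : y ∣ h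
    class-number-divisible = FreeAction.order-divides y-prime T Tʸ≡id T-free

-- Norms and division in ℤ[√k]

norm : ℤ → QZ → ℤ
norm k (a , b) = a * a - k * (b * b)

pair-≡ : ∀ {a b c d : ℤ} → a ≡ c → b ≡ d → (a , b) ≡ (c , d)
pair-≡ refl refl = refl

qmul-assoc : ∀ k α β γ → qmul k (qmul k α β) γ ≡ qmul k α (qmul k β γ)
qmul-assoc k (a , b) (c , d) (e , f) = pair-≡ (first (+ k) a b c d e f) (second (+ k) a b c d e f)
  where
  first : ∀ k a b c d e f → (a * c + k * (b * d)) * e + k * ((a * d + b * c) * f) ≡ a * (c * e + k * (d * f)) + k * (b * (c * f + d * e))
  first = solve-∀
  second : ∀ k a b c d e f → (a * c + k * (b * d)) * f + (a * d + b * c) * e ≡ a * (c * f + d * e) + b * (c * e + k * (d * f))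
  second = solve-∀

qmul-identityˡ : ∀ k α → qmul k (1ℤ , 0ℤ) α ≡ α
qmul-identityˡ k (a , b) = pair-≡ (first (+ k) a b) (second a b)
  where
  first : ∀ k a b → 1ℤ * a + k * (0ℤ * b) ≡ a
  first = solve-∀
  second : ∀ a b → 1ℤ * b + 0ℤ * a ≡ b
  second = solve-∀

norm-qmul : ∀ k α β → norm (+ k) (qmul k α β) ≡ norm (+ k) α * norm (+ k) β
norm-qmul k (a , b) (c , d) = identity (+ k) a b c d
  where
  identity : ∀ k a b c d → (a * c + k * (b * d)) * (a * c + k * (b * d)) - k * ((a * d + b * c) * (a * d + b * c)) ≡ (a * a - k * (b * b)) * (c * c - k * (d * d))
  identity = solve-∀

module Division {k P b X Y} .{{_ : ℤ.NonZero (- P)}} (norm-β : X * X - + k * (Y * Y) ≡ - P) (β-root : P divides X - b * Y) (b-root : P divides + k - b * b) where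
  β : QZ
  β = X , Y

  Root : QZ → Set
  Root (x , w) = P divides x - b * w × Comaximal w P

  -- First coordinate of `αβ̄`, the numerator of `α/β = αβ̄/(−P)`; the second one follows. Both
  -- vanish modulo `P` because `x ≡ bw`, `X ≡ bY` and `k ≡ b²`.
  numerator₁ : ∀ {k x w i j e} → x - b * w ≡ P * i → X - b * Y ≡ P * j → k - b * b ≡ P * e →
    x * X - k * (w * Y) ≡ - P * (e * w * Y - b * w * j - i * b * Y - P * (i * j))
  numerator₁ {k} {x} {w} {i} {j} {e} x≡ X≡ k≡ = combine (cong₂ _+_ (cong (w * Y *_) (sym k≡)) (cong₂ _+_ (cong (X *_) x≡) (cong ((b * w + P * i) *_) X≡)))
    (solve (b ∷ w ∷ P ∷ i ∷ Y ∷ j ∷ k ∷ e ∷ x ∷ X ∷ []))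

  numerator₂ : ∀ {x w i j} → x - b * w ≡ P * i → X - b * Y ≡ P * j → w * X - x * Y ≡ - P * (i * Y - w * j)
  numerator₂ {x} {w} {i} {j} x≡ X≡ = combine (cong₂ _+_ (cong (w *_) X≡) (cong (Y *_) (sym x≡))) (solve (b ∷ w ∷ P ∷ i ∷ Y ∷ j ∷ x ∷ X ∷ []))

  quotient : ∀ {n} α → norm (+ k) α ≡ (- P) ^ ℕ.suc n → Root α → Σ QZ λ γ → α ≡ qmul k β γ × norm (+ k) γ ≡ (- P) ^ n
  quotient {n} α@(x , w) norm-α ((i , x≡) , _) = go β-root b-root
    where
    go : P divides X - b * Y → P divides + k - b * b → Σ QZ λ γ → α ≡ qmul k β γ × norm (+ k) γ ≡ (- P) ^ n
    go (j , X≡) (e , k≡) = γ , α≡ , ℤ.*-cancelˡ-≡ (- P) _ _ (trans (cong (_* norm (+ k) γ) (sym norm-β)) (trans (sym (norm-qmul k β γ)) (trans (cong (norm (+ k)) (sym α≡)) norm-α)))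
      where
      x₁ = e * w * Y - b * w * j - i * b * Y - P * (i * j)
      w₁ = i * Y - w * j
      γ : QZ
      γ = x₁ , w₁
      first : ∀ {k x w i j e} → X * X - k * (Y * Y) ≡ - P → x - b * w ≡ P * i → X - b * Y ≡ P * j → k - b * b ≡ P * e →
        - P * x ≡ - P * (X * (e * w * Y - b * w * j - i * b * Y - P * (i * j)) + k * (Y * (i * Y - w * j)))
      first {k} {x} {w} {i} {j} {e} norm-β x≡ X≡ k≡ = trans (cong (_* x) (sym norm-β)) (trans (split k X Y x w)
        (trans (cong₂ (λ u v → X * u + k * (Y * v)) (numerator₁ {k} {x} {w} {i} {j} {e} x≡ X≡ k≡) (numerator₂ {x} {w} {i} {j} x≡ X≡)) (collect k P X Y (e * w * Y - b * w * j - i * b * Y - P * (i * j)) (i * Y - w * j))))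
        where
        split : ∀ k X Y x w → (X * X - k * (Y * Y)) * x ≡ X * (x * X - k * (w * Y)) + k * (Y * (w * X - x * Y))
        split = solve-∀
        collect : ∀ k P X Y x w → X * (- P * x) + k * (Y * (- P * w)) ≡ - P * (X * x + k * (Y * w))
        collect = solve-∀
      second : ∀ {k x w i j e} → X * X - k * (Y * Y) ≡ - P → x - b * w ≡ P * i → X - b * Y ≡ P * j → k - b * b ≡ P * e →
        - P * w ≡ - P * (X * (i * Y - w * j) + Y * (e * w * Y - b * w * j - i * b * Y - P * (i * j)))
      second {k} {x} {w} {i} {j} {e} norm-β x≡ X≡ k≡ = trans (cong (_* w) (sym norm-β)) (trans (split k X Y x w)
        (trans (cong₂ (λ u v → X * v + Y * u) (numerator₁ {k} {x} {w} {i} {j} {e} x≡ X≡ k≡) (numerator₂ {x} {w} {i} {j} x≡ X≡)) (collect P X Y (e * w * Y - b * w * j - i * b * Y - P * (i * j)) (i * Y - w * j))))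
        where
        split : ∀ k X Y x w → (X * X - k * (Y * Y)) * w ≡ X * (w * X - x * Y) + Y * (x * X - k * (w * Y))
        split = solve-∀
        collect : ∀ P X Y x w → X * (- P * w) + Y * (- P * x) ≡ - P * (X * w + Y * x)
        collect = solve-∀
      α≡ : α ≡ qmul k β γ
      α≡ = pair-≡ (ℤ.*-cancelˡ-≡ (- P) _ _ (first {+ k} {x} {w} {i} {j} {e} norm-β x≡ X≡ k≡))
        (ℤ.*-cancelˡ-≡ (- P) _ _ (second {+ k} {x} {w} {i} {j} {e} norm-β x≡ X≡ k≡))

  -- x₁ − b w₁ and x₁ + b w₁ have product divisible by P, and the latter is a unit since w is.
  quotient-root : ∀ {n} α γ → α ≡ qmul k β γ → norm (+ k) γ ≡ (- P) ^ ℕ.suc n → Root α → Root γ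
  quotient-root {n} _ (x , w) refl norm-γ (_ , w-unit) = go β-root b-root
    where
    D = (- P) ^ n
    norm-γ′ : x * x - + k * (w * w) ≡ - P * D
    norm-γ′ = norm-γ
    go : P divides X - b * Y → P divides + k - b * b → Root (x , w)
    go (j , X≡) (e , k≡) = root , w₁-unit
      where
      -- The second coordinate `Xw + Yx` of `βγ` is a unit modulo `P`, and it is congruent to
      -- `(x + bw)Y`.
      s-unit : Comaximal (x + b * w) P
      s-unit = comaximal-factor {x + b * w} {Y} (comaximal-cong (j * w , difference X≡) w-unit)
        where
        difference : X - b * Y ≡ P * j → X * w + Y * x - (x + b * w) * Y ≡ P * (j * w)
        difference e = combine (cong (w *_) e) (solve (X ∷ w ∷ Y ∷ x ∷ b ∷ P ∷ j ∷ []))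
      root : P divides x - b * w
      root = comaximal-cancel s-unit (- D + e * (w * w) , product (+ k) D norm-γ′ k≡)
        where
        product : ∀ k D → x * x - k * (w * w) ≡ - P * D → k - b * b ≡ P * e → (x + b * w) * (x - b * w) ≡ P * (- D + e * (w * w))
        product k D norm≡ k≡ = combine (cong₂ _+_ norm≡ (cong (w * w *_) k≡)) (solve (x ∷ b ∷ w ∷ P ∷ D ∷ e ∷ k ∷ []))
      w₁-unit : Comaximal w P
      w₁-unit = comaximal-factor {w} {+ 2 * b} (comaximal-cong (from-root root) s-unit)
        where
        from-root : P divides x - b * w → P divides x + b * w - w * (+ 2 * b)
        from-root (i , x≡) = i , trans (identity x b w) x≡
          where
          identity : ∀ x b w → x + b * w - w * (+ 2 * b) ≡ x - b * w
          identity = solve-∀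

  -- The root condition is demanded only while a factor `β` is left; the final quotient is a unit
  -- and need not satisfy it.
  divide : ∀ n α → norm (+ k) α ≡ (- P) ^ n → (∀ m → n ≡ ℕ.suc m → Root α) → Σ QZ λ η → norm (+ k) η ≡ 1ℤ × α ≡ qmul k (qpow k β n) η
  divide ℕ.zero    α norm-α _ = α , norm-α , sym (qmul-identityˡ k α)
  divide (ℕ.suc n) α norm-α root = from-quotient (quotient {n} α norm-α (root n refl))
    where
    from-quotient : (Σ QZ λ γ → α ≡ qmul k β γ × norm (+ k) γ ≡ (- P) ^ n) → Σ QZ λ η → norm (+ k) η ≡ 1ℤ × α ≡ qmul k (qpow k β (ℕ.suc n)) η
    from-quotient (γ , α≡ , norm-γ) = from-rest (divide n γ norm-γ λ m n≡ → quotient-root {m} α γ α≡ (trans norm-γ (cong ((- P) ^_) n≡)) (root n refl))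
      where
      from-rest : (Σ QZ λ η → norm (+ k) η ≡ 1ℤ × γ ≡ qmul k (qpow k β n) η) → Σ QZ λ η → norm (+ k) η ≡ 1ℤ × α ≡ qmul k (qpow k β (ℕ.suc n)) η
      from-rest (η , norm-η , γ≡) = η , norm-η , trans α≡ (trans (cong (qmul k β) γ≡) (sym (qmul-assoc k β (qpow k β n) η)))

-- Reduction by the fundamental unit

abs-square : ∀ i → + (∣ i ∣ ℕ.* ∣ i ∣) ≡ i * i
abs-square (+ n)        = ℤ.pos-* n n
abs-square (ℤ.-[1+ n ]) = refl

signed-abs : ∀ i → Σ ℤ λ σ → (σ ≡ 1ℤ ⊎ σ ≡ -1ℤ) × i ≡ σ * + ∣ i ∣
signed-abs (+ n)        = 1ℤ , inj₁ refl , sym (ℤ.*-identityˡ (+ n))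
signed-abs (ℤ.-[1+ n ]) = -1ℤ , inj₂ refl , sym (ℤ.-1*i≡-i (+ ℕ.suc n))

comaximal-abs : ∀ x {y} → Comaximal x y → Comaximal (+ ∣ x ∣) y
comaximal-abs x {y} c with signed-abs x
... | σ , _ , x≡ = comaximal-factor (subst (λ x → Comaximal x y) (trans x≡ (ℤ.*-comm σ (+ ∣ x ∣))) c)

-- With ε = u + v√k, the element β = X + Y√k of negative norm satisfies |β/β̄| < ε iff vX < (u − 1)Y.
-- Otherwise division by ε makes Y smaller.
module Reduction {k u v P : ℕ} (1<k : 1 ℕ.< k) (0<v : 0 ℕ.< v) (2<P : 2 ℕ.< P)
  (unit : u ℕ.* u ≡ 1 ℕ.+ k ℕ.* (v ℕ.* v)) (k-P : Comaximal (+ k) (+ P)) where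

  record Reduced (X Y : ℕ) : Set where
    constructor reduced
    field
      0<X : 0 ℕ.< X
      0<Y : 0 ℕ.< Y
      neg-norm : k ℕ.* (Y ℕ.* Y) ≡ X ℕ.* X ℕ.+ P
      coprime : Comaximal (+ X) (+ Y)
      bound : v ℕ.* X ℕ.+ Y ℕ.< u ℕ.* Y

  unitℤ : + u * + u ≡ 1ℤ + + k * (+ v * + v)
  unitℤ = trans (sym (ℤ.pos-* u u)) (trans (cong +_ unit) (trans (ℤ.pos-+ 1 (k ℕ.* (v ℕ.* v))) (cong (λ a → 1ℤ + a) (trans (ℤ.pos-* k (v ℕ.* v)) (cong (+ k *_) (ℤ.pos-* v v))))))

  neg-normℤ : ∀ {X Y} → k ℕ.* (Y ℕ.* Y) ≡ X ℕ.* X ℕ.+ P → + k * (+ Y * + Y) ≡ + X * + X + + P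
  neg-normℤ {X} {Y} e = trans (sym (trans (ℤ.pos-* k (Y ℕ.* Y)) (cong (+ k *_) (ℤ.pos-* Y Y)))) (trans (cong +_ e) (trans (ℤ.pos-+ (X ℕ.* X) P) (cong (λ a → a + + P) (ℤ.pos-* X X))))

  X≢0 : ∀ {Y} → k ℕ.* (Y ℕ.* Y) ≢ 0 ℕ.* 0 ℕ.+ P
  X≢0 {Y} e = ℕ.<⇒≢ 1<k (sym (abs-unit (+ k) _ (k-unit (+ k) (+ P) (+ Y) k-P (neg-normℤ {0} {Y} e))))
    where
    k-unit : ∀ k P Y → (c : Comaximal k P) → k * (Y * Y) ≡ 0ℤ + P → k * (proj₁ c + proj₁ (proj₂ c) * (Y * Y)) ≡ 1ℤ
    k-unit k P Y (r , s , e) P≡ = combine (cong₂ _+_ e (cong (s *_) P≡)) (solve (k ∷ P ∷ Y ∷ r ∷ s ∷ []))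

  -- From `v√k < u` and `X < Y√k`. It keeps the second coordinate positive when dividing by ε.
  vX<uY : ∀ {X Y} → 0 ℕ.< Y → k ℕ.* (Y ℕ.* Y) ≡ X ℕ.* X ℕ.+ P → v ℕ.* X ℕ.< u ℕ.* Y
  vX<uY {X} {Y} 0<Y e = ℕ.≰⇒> λ uY≤vX → ℕ.<⇒≱ squares (ℕ.*-mono-≤ uY≤vX uY≤vX)
    where
    open ℕ.≤-Reasoning
    expand : ∀ v X → v ℕ.* X ℕ.* (v ℕ.* X) ≡ v ℕ.* v ℕ.* (X ℕ.* X)
    expand = solveℕ-∀
    regroup : ∀ k v Y → Y ℕ.* Y ℕ.+ v ℕ.* v ℕ.* (k ℕ.* (Y ℕ.* Y)) ≡ (1 ℕ.+ k ℕ.* (v ℕ.* v)) ℕ.* (Y ℕ.* Y)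
    regroup = solveℕ-∀
    squares : v ℕ.* X ℕ.* (v ℕ.* X) ℕ.< u ℕ.* Y ℕ.* (u ℕ.* Y)
    squares = begin-strict
      v ℕ.* X ℕ.* (v ℕ.* X)                        ≡⟨ expand v X ⟩
      v ℕ.* v ℕ.* (X ℕ.* X)                        <⟨ ℕ.m<n+m _ (ℕ.*-mono-≤ 0<Y 0<Y) ⟩
      Y ℕ.* Y ℕ.+ v ℕ.* v ℕ.* (X ℕ.* X)            ≤⟨ ℕ.+-monoʳ-≤ (Y ℕ.* Y) (ℕ.*-monoʳ-≤ (v ℕ.* v) (ℕ.m≤m+n (X ℕ.* X) P)) ⟩
      Y ℕ.* Y ℕ.+ v ℕ.* v ℕ.* (X ℕ.* X ℕ.+ P)      ≡⟨ cong (λ n → Y ℕ.* Y ℕ.+ v ℕ.* v ℕ.* n) e ⟨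
      Y ℕ.* Y ℕ.+ v ℕ.* v ℕ.* (k ℕ.* (Y ℕ.* Y))    ≡⟨ regroup k v Y ⟩
      (1 ℕ.+ k ℕ.* (v ℕ.* v)) ℕ.* (Y ℕ.* Y)        ≡⟨ cong (ℕ._* (Y ℕ.* Y)) unit ⟨
      u ℕ.* u ℕ.* (Y ℕ.* Y)                        ≡⟨ expand u Y ⟨
      u ℕ.* Y ℕ.* (u ℕ.* Y)                        ∎

  -- Equality would give (u + 1)P = 2kY², and hence P ∣ 2.
  boundary-excluded : ∀ {X Y} → k ℕ.* (Y ℕ.* Y) ≡ X ℕ.* X ℕ.+ P → Comaximal (+ X) (+ Y) → v ℕ.* X ℕ.+ Y ≢ u ℕ.* Y
  boundary-excluded {X} {Y} e X-Y vX+Y≡uY = ℕ.<⇒≱ 2<P (ℕ.∣⇒≤ (P∣2 P|2))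
    where
    boundary : + v * + X ≡ (+ u - 1ℤ) * + Y
    boundary = transfer (+ v * + X) (+ u) (+ Y) (trans (sym (trans (ℤ.pos-+ (v ℕ.* X) Y) (cong (λ a → a + + Y) (ℤ.pos-* v X)))) (trans (cong +_ vX+Y≡uY) (ℤ.pos-* u Y)))
      where
      transfer : ∀ a u y → a + y ≡ u * y → a ≡ (u - 1ℤ) * y
      transfer a u y e = combine e (solve (a ∷ u ∷ y ∷ []))
    scaled : ∀ {k u v X Y P : ℤ} → v * X ≡ (u - 1ℤ) * Y → u * u ≡ 1ℤ + k * (v * v) → k * (Y * Y) ≡ X * X + P →
      v * v * ((u + 1ℤ) * P) ≡ v * v * (+ 2 * (k * (Y * Y)))
    scaled {k} {u} {v} {X} {Y} {P} vX uu kYY = trans (cong (λ P → v * v * ((u + 1ℤ) * P)) (P≡ kYY))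
      (trans (step₁ k u v X Y) (trans (cong₂ (λ a b → (u + 1ℤ) * (k * (v * v) * (Y * Y) - a * b)) vX vX)
      (trans (cong (λ a → (u + 1ℤ) * (a * (Y * Y) - (u - 1ℤ) * Y * ((u - 1ℤ) * Y))) kvv) (trans (step₂ u Y) (trans (cong (λ a → + 2 * (a * (Y * Y))) (sym kvv)) (step₃ k v Y))))))
      where
      P≡ : k * (Y * Y) ≡ X * X + P → P ≡ k * (Y * Y) - X * X
      P≡ e = combine (sym e) (solve (k ∷ X ∷ Y ∷ P ∷ []))
      kvv : k * (v * v) ≡ u * u - 1ℤ
      kvv = combine (sym uu) (solve (k ∷ u ∷ v ∷ []))
      step₁ : ∀ k u v X Y → v * v * ((u + 1ℤ) * (k * (Y * Y) - X * X)) ≡ (u + 1ℤ) * (k * (v * v) * (Y * Y) - v * X * (v * X))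
      step₁ = solve-∀
      step₂ : ∀ u Y → (u + 1ℤ) * ((u * u - 1ℤ) * (Y * Y) - (u - 1ℤ) * Y * ((u - 1ℤ) * Y)) ≡ + 2 * ((u * u - 1ℤ) * (Y * Y))
      step₂ = solve-∀
      step₃ : ∀ k v Y → + 2 * (k * (v * v) * (Y * Y)) ≡ v * v * (+ 2 * (k * (Y * Y)))
      step₃ = solve-∀
    [u+1]P≡2kY² : (+ u + 1ℤ) * + P ≡ + 2 * (+ k * (+ Y * + Y))
    [u+1]P≡2kY² = ℤ.*-cancelˡ-≡ (+ v * + v) _ _ {{subst ℤ.NonZero (ℤ.pos-* v v) (ℕ.>-nonZero (ℕ.*-mono-≤ 0<v 0<v))}}
      (scaled {+ k} {+ u} {+ v} {+ X} {+ Y} {+ P} boundary unitℤ (neg-normℤ {X} {Y} e))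
    Y-P : Comaximal (+ Y) (+ P)
    Y-P = comaximal-sym (negative (+ P) (comaximal-cong (+ k * + Y , difference (+ X) (+ Y) (+ P) (+ k) (neg-normℤ {X} {Y} e)) (comaximal-* X-Y X-Y)))
      where
      difference : ∀ X Y P k → k * (Y * Y) ≡ X * X + P → X * X - -1ℤ * P ≡ Y * (k * Y)
      difference X Y P k e = combine (sym e) (solve (X ∷ Y ∷ P ∷ k ∷ []))
      negative : ∀ P → Comaximal (-1ℤ * P) (+ Y) → Comaximal P (+ Y)
      negative P c = comaximal-factor (subst (λ z → Comaximal z (+ Y)) (ℤ.*-comm -1ℤ P) c)
    P|2 : + P divides + 2
    P|2 = comaximal-cancel (comaximal-* k-P (comaximal-* Y-P Y-P))
      (+ u + 1ℤ , trans (ℤ.*-comm (+ k * (+ Y * + Y)) (+ 2)) (trans (sym [u+1]P≡2kY²) (ℤ.*-comm (+ u + 1ℤ) (+ P))))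
    P∣2 : + P divides + 2 → P ℕ.∣ 2
    P∣2 (j , 2≡Pj) = ℕ.divides ∣ j ∣ (trans (cong ∣_∣ 2≡Pj) (trans (ℤ.abs-* (+ P) j) (ℕ.*-comm P ∣ j ∣)))

  record Reduction (X Y : ℕ) : Set where
    constructor reduction
    field
      {X₁ Y₁}   : ℕ
      {σ}       : ℤ
      {η}       : QZ
      is-reduced : Reduced X₁ Y₁
      sign      : σ ≡ 1ℤ ⊎ σ ≡ -1ℤ
      norm-η    : norm (+ k) η ≡ 1ℤ
      factored  : (+ X , + Y) ≡ qmul k (+ X₁ , σ * + Y₁) η

  -- `(−x, y)` is minus the conjugate of `(x, y)`, and it restores a positive first coordinate after
  -- a division by ε. The conjugation goes into the sign of `y₁`, which is the origin of λ, and the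
  -- minus sign into the unit.
  conjugate : ∀ {x y x₁ y₁ : ℤ} {η : QZ} → (x , y) ≡ qmul k (x₁ , y₁) η → (-1ℤ * x , y) ≡ qmul k (x₁ , -1ℤ * y₁) (- proj₁ η , proj₂ η)
  conjugate {x₁ = x₁} {y₁} {s , t} refl = pair-≡ (first (+ k) x₁ y₁ s t) (second x₁ y₁ s t)
    where
    first : ∀ k x y s t → -1ℤ * (x * s + k * (y * t)) ≡ x * - s + k * (-1ℤ * y * t)
    first = solve-∀
    second : ∀ x y s t → x * t + y * s ≡ x * t + -1ℤ * y * - s
    second = solve-∀

  reduce : ∀ X Y → Acc ℕ._<_ Y → 0 ℕ.< X → 0 ℕ.< Y → k ℕ.* (Y ℕ.* Y) ≡ X ℕ.* X ℕ.+ P → Comaximal (+ X) (+ Y) → Reduction X Y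
  reduce X Y (acc rec) 0<X 0<Y e X-Y with ℕ.<-cmp (v ℕ.* X ℕ.+ Y) (u ℕ.* Y)
  ... | tri< bound _ _ = reduction {σ = 1ℤ} {η = 1ℤ , 0ℤ} (reduced 0<X 0<Y e X-Y bound) (inj₁ refl) (norm-1 (+ k)) (pair-≡ (first (+ k) (+ X) (+ Y)) (second (+ X) (+ Y)))
    where
    norm-1 : ∀ k → 1ℤ * 1ℤ - k * (0ℤ * 0ℤ) ≡ 1ℤ
    norm-1 = solve-∀
    first : ∀ k X Y → X ≡ X * 1ℤ + k * (1ℤ * Y * 0ℤ)
    first = solve-∀
    second : ∀ X Y → Y ≡ X * 0ℤ + 1ℤ * Y * 1ℤ
    second = solve-∀
  ... | tri≈ _ vX+Y≡uY _ = ⊥-elim (boundary-excluded {X} {Y} e X-Y vX+Y≡uY)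
  ... | tri> _ _ uY<vX+Y = descend (ℕ.m≤n⇒∃[o]m+o≡n (ℕ.<⇒≤ (vX<uY {X} {Y} 0<Y e)))
    where
    -- `X′ + y√k = (X + Y√k)(u − v√k)`, where `y` is given by `vX + y = uY`. Only the sign of `X′`
    -- is undetermined.
    X′ = + u * + X - + k * (+ v * + Y)
    descend : (Σ ℕ λ y → v ℕ.* X ℕ.+ y ≡ u ℕ.* Y) → Reduction X Y
    descend (y , vX+y≡uY) = by-sign (signed-abs X′)
      where
      0<y : 0 ℕ.< y
      0<y = ℕ.+-cancelˡ-< (v ℕ.* X) 0 y (subst₂ ℕ._<_ (sym (ℕ.+-identityʳ _)) (sym vX+y≡uY) (vX<uY {X} {Y} 0<Y e))
      y<Y : y ℕ.< Y
      y<Y = ℕ.+-cancelˡ-< (v ℕ.* X) y Y (subst (ℕ._< v ℕ.* X ℕ.+ Y) (sym vX+y≡uY) uY<vX+Y)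
      y≡ : + y ≡ + u * + Y - + v * + X
      y≡ = transfer (+ v * + X) (+ y) (+ u * + Y) (trans (sym (trans (ℤ.pos-+ (v ℕ.* X) y) (cong (λ a → a + + y) (ℤ.pos-* v X)))) (trans (cong +_ vX+y≡uY) (ℤ.pos-* u Y)))
        where
        transfer : ∀ a y b → a + y ≡ b → y ≡ b - a
        transfer a y b e = combine e (solve (a ∷ y ∷ b ∷ []))
      e′ : + k * (+ y * + y) ≡ X′ * X′ + + P
      e′ = trans (cong (λ y → + k * (y * y)) y≡) (identity {+ k} {+ u} {+ v} {+ X} {+ Y} {+ P} unitℤ (neg-normℤ {X} {Y} e))
        where
        identity : ∀ {k u v X Y P} → u * u ≡ 1ℤ + k * (v * v) → k * (Y * Y) ≡ X * X + P →
          k * ((u * Y - v * X) * (u * Y - v * X)) ≡ (u * X - k * (v * Y)) * (u * X - k * (v * Y)) + P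
        identity {k} {u} {v} {X} {Y} {P} uu kYY = combine (cong₂ _+_ kYY (cong ((k * (Y * Y) - X * X) *_) uu)) (solve (k ∷ u ∷ v ∷ X ∷ Y ∷ P ∷ []))
      eℕ : k ℕ.* (y ℕ.* y) ≡ ∣ X′ ∣ ℕ.* ∣ X′ ∣ ℕ.+ P
      eℕ = ℤ.+-injective (trans (trans (ℤ.pos-* k (y ℕ.* y)) (cong (+ k *_) (ℤ.pos-* y y))) (trans e′ (sym (trans (ℤ.pos-+ (∣ X′ ∣ ℕ.* ∣ X′ ∣) P) (cong (λ a → a + + P) (abs-square X′))))))
      0<X′ : 0 ℕ.< ∣ X′ ∣
      0<X′ = ℕ.n≢0⇒n>0 λ X′≡0 → X≢0 {y} (trans eℕ (cong (λ x → x ℕ.* x ℕ.+ P) X′≡0))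
      X′-y : Comaximal X′ (+ y)
      X′-y = subst (Comaximal X′) (sym y≡) (rotate (+ k) (+ u) (+ v) (+ X) (+ Y) unitℤ X-Y)
        where
        rotate : ∀ k u v X Y → u * u ≡ 1ℤ + k * (v * v) → Comaximal X Y → Comaximal (u * X - k * (v * Y)) (u * Y - v * X)
        rotate k u v X Y uu (r , s , rX+sY) = r * u + s * v , r * (k * v) + s * u ,
          combine (cong₂ _+_ rX+sY (cong ((r * X + s * Y) *_) uu)) (solve (k ∷ u ∷ v ∷ X ∷ Y ∷ r ∷ s ∷ []))
      recursive : Reduction ∣ X′ ∣ y
      recursive = reduce ∣ X′ ∣ y (rec y<Y) 0<X′ 0<y eℕ (comaximal-abs X′ X′-y)
      step : (+ X , + Y) ≡ qmul k (X′ , + y) (+ u , + v)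
      step = trans (pair-≡ (first (+ k) (+ u) (+ v) (+ X) (+ Y) unitℤ) (second (+ k) (+ u) (+ v) (+ X) (+ Y) unitℤ)) (cong (λ y → qmul k (X′ , y) (+ u , + v)) (sym y≡))
        where
        first : ∀ k u v X Y → u * u ≡ 1ℤ + k * (v * v) → X ≡ (u * X - k * (v * Y)) * u + k * ((u * Y - v * X) * v)
        first k u v X Y uu = combine (cong (X *_) (sym uu)) (solve (k ∷ u ∷ v ∷ X ∷ Y ∷ []))
        second : ∀ k u v X Y → u * u ≡ 1ℤ + k * (v * v) → Y ≡ (u * X - k * (v * Y)) * v + (u * Y - v * X) * u
        second k u v X Y uu = combine (cong (Y *_) (sym uu)) (solve (k ∷ u ∷ v ∷ X ∷ Y ∷ []))
      norm-ε : norm (+ k) (+ u , + v) ≡ 1ℤ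
      norm-ε = difference unitℤ
        where
        difference : ∀ {a b} → a ≡ 1ℤ + b → a - b ≡ 1ℤ
        difference {a} {b} e = combine e (solve (a ∷ b ∷ []))
      norm-conjugate : ∀ η → norm (+ k) η ≡ 1ℤ → norm (+ k) (- proj₁ η , proj₂ η) ≡ 1ℤ
      norm-conjugate (s , t) e = trans (identity (+ k) s t) e
        where
        identity : ∀ k s t → - s * - s - k * (t * t) ≡ s * s - k * (t * t)
        identity = solve-∀
      times-ε : ∀ {x₁ y₁ η} → norm (+ k) η ≡ 1ℤ → (X′ , + y) ≡ qmul k (x₁ , y₁) η →
        norm (+ k) (qmul k η (+ u , + v)) ≡ 1ℤ × (+ X , + Y) ≡ qmul k (x₁ , y₁) (qmul k η (+ u , + v))
      times-ε {x₁} {y₁} {η} norm-η e = trans (norm-qmul k η (+ u , + v)) (cong₂ _*_ norm-η norm-ε) ,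
        trans step (trans (cong (λ γ → qmul k γ (+ u , + v)) e) (qmul-assoc k (x₁ , y₁) η (+ u , + v)))
      by-sign : (Σ ℤ λ σ → (σ ≡ 1ℤ ⊎ σ ≡ -1ℤ) × X′ ≡ σ * + ∣ X′ ∣) → Reduction X Y
      by-sign (_ , inj₁ refl , X′≡) = positive recursive
        where
        positive : Reduction ∣ X′ ∣ y → Reduction X Y
        positive (reduction {X₁} {Y₁} {σ} {η} red sgn norm-η f) = finish (times-ε {+ X₁} {σ * + Y₁} {η} norm-η (trans (pair-≡ (trans X′≡ (ℤ.*-identityˡ _)) refl) f))
          where
          finish : _ → Reduction X Y
          finish (n , f) = reduction red sgn n f
      by-sign (_ , inj₂ refl , X′≡) = negative recursive
        where
        negative : Reduction ∣ X′ ∣ y → Reduction X Y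
        negative (reduction {X₁} {Y₁} {σ} {η} red sgn norm-η f) = finish (times-ε {+ X₁} { -1ℤ * (σ * + Y₁)} { - proj₁ η , proj₂ η} (norm-conjugate η norm-η) (trans (pair-≡ X′≡ refl) (conjugate {+ ∣ X′ ∣} {+ y} {+ X₁} {σ * + Y₁} {η} f)))
          where
          flip : σ ≡ 1ℤ ⊎ σ ≡ -1ℤ → -1ℤ * σ ≡ 1ℤ ⊎ -1ℤ * σ ≡ -1ℤ
          flip (inj₁ refl) = inj₂ refl
          flip (inj₂ refl) = inj₁ refl
          finish : _ → Reduction X Y
          finish (n , f) = reduction {σ = -1ℤ * σ} red (flip sgn) n (trans f (cong (λ y → qmul k (+ X₁ , y) _) (sym (ℤ.*-assoc -1ℤ σ (+ Y₁)))))

-- Absolute values, the ratio bounds, and bounds for reduced elements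

comaximal⇒gcd≡1 : ∀ {m n} → Comaximal (+ m) (+ n) → gcd m n ≡ 1
comaximal⇒gcd≡1 {m} {n} (r , s , unit) = coprime⇒gcd≡1 λ { {d} (ℕ.divides q m≡ , ℕ.divides q′ n≡) →
  abs-unit (+ d) (r * + q + s * + q′) (trans (factor r s (+ q) (+ q′) (+ d))
    (trans (cong₂ (λ m n → r * m + s * n) (sym (trans (cong +_ m≡) (ℤ.pos-* q d))) (sym (trans (cong +_ n≡) (ℤ.pos-* q′ d)))) unit)) }
  where
  factor : ∀ r s q q′ d → d * (r * q + s * q′) ≡ r * (q * d) + s * (q′ * d)
  factor = solve-∀

qabs-negative : ∀ k α → Pos k (qneg α) → qabs k α ≡ qneg α
qabs-negative k α pos with pos? k (qneg α)
... | yes _   = refl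
... | no ¬pos = ⊥-elim (¬pos pos)

qabs-positive : ∀ k α → ¬ Pos k (qneg α) → qabs k α ≡ α
qabs-positive k α ¬pos with pos? k (qneg α)
... | yes pos = ⊥-elim (¬pos pos)
... | no _    = refl

module Ratio {k u v P : ℕ} (0<v : 0 ℕ.< v) (0<P : 0 ℕ.< P) (unit : + u * + u ≡ 1ℤ + + k * (+ v * + v)) where

  -- Negative norm means `X < Y√k`, so the absolute value of the conjugate is `−X + Y√k`. The ratio
  -- is compared with 1 and ε after clearing this denominator.
  conjugate-abs : ∀ X Y → k ℕ.* (ℕ.suc Y ℕ.* ℕ.suc Y) ≡ ℕ.suc X ℕ.* ℕ.suc X ℕ.+ P →
    qabs k (+ ℕ.suc X , - + ℕ.suc Y) ≡ (- + ℕ.suc X , + ℕ.suc Y)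
  conjugate-abs X Y e = qabs-negative k (+ ℕ.suc X , - + ℕ.suc Y) (inj₂ (inj₂ (ℤ.-<+ , ℤ.+<+ (ℕ.s≤s ℕ.z≤n) ,
    subst (+ (ℕ.suc X ℕ.* ℕ.suc X) ℤ.<_) (ℤ.pos-* k (ℕ.suc Y ℕ.* ℕ.suc Y)) (ℤ.+<+ (subst (ℕ.suc X ℕ.* ℕ.suc X ℕ.<_) (sym e) (ℕ.m<m+n _ 0<P))))))

  abs : ∀ X Y → qabs k (+ ℕ.suc X , + ℕ.suc Y) ≡ (+ ℕ.suc X , + ℕ.suc Y)
  abs X Y = qabs-positive k (+ ℕ.suc X , + ℕ.suc Y) λ { (inj₁ (() , _)) ; (inj₂ (inj₁ (() , _))) ; (inj₂ (inj₂ (_ , () , _))) }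

  ratio>1 : ∀ X Y → 0 ℕ.< X → 0 ℕ.< Y → k ℕ.* (Y ℕ.* Y) ≡ X ℕ.* X ℕ.+ P → QLt k (qabs k (+ X , - + Y)) (qabs k (+ X , + Y))
  ratio>1 (ℕ.suc X) (ℕ.suc Y) _ _ e = subst₂ (QLt k) (sym (conjugate-abs X Y e)) (sym (abs X Y))
    (inj₁ (ℤ.+≤+ ℕ.z≤n , ℤ.≤-reflexive (sym (ℤ.+-inverseʳ (+ ℕ.suc Y))) , inj₁ (ℤ.+<+ (ℕ.s≤s ℕ.z≤n))))

  ratio<ε : ∀ X Y → 0 ℕ.< X → 0 ℕ.< Y → k ℕ.* (Y ℕ.* Y) ≡ X ℕ.* X ℕ.+ P → v ℕ.* X ℕ.+ Y ℕ.< u ℕ.* Y →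
    QLt k (qabs k (+ X , + Y)) (qmul k (+ u , + v) (qabs k (+ X , - + Y)))
  ratio<ε (ℕ.suc X) (ℕ.suc Y) _ _ e bound = subst₂ (λ β γ → QLt k β (qmul k (+ u , + v) γ)) (sym (abs X Y)) (sym (conjugate-abs X Y e))
    (inj₁ (ℤ.<⇒≤ first-positive , ℤ.<⇒≤ second-positive , inj₁ first-positive))
    where
    x = + ℕ.suc X
    y = + ℕ.suc Y
    first = + u * - x + + k * (+ v * y) - x
    second = + u * y + + v * - x - y
    second≡ : ∀ {a b c d} → a + b + d ≡ c → d ≡ c - a - b
    second≡ {a} {b} {c} {d} e = combine e (solve (a ∷ b ∷ c ∷ d ∷ []))
    second-positive : 0ℤ ℤ.< second
    second-positive with o , vX+Y+1+o≡uY ← ℕ.m≤n⇒∃[o]m+o≡n bound = subst (0ℤ ℤ.<_)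
      (trans (second≡ {+ v * x} {y} {+ u * y} (trans (cong (λ a → a + y + + ℕ.suc o) (sym (ℤ.pos-* v (ℕ.suc X))))
        (trans (cong +_ (trans (ℕ.+-suc (v ℕ.* ℕ.suc X ℕ.+ ℕ.suc Y) o) vX+Y+1+o≡uY)) (ℤ.pos-* u (ℕ.suc Y))))) (regroup (+ u) (+ v) x y))
      (ℤ.+<+ (ℕ.s≤s ℕ.z≤n))
      where
      regroup : ∀ u v x y → u * y - v * x - y ≡ u * y + v * - x - y
      regroup = solve-∀
    -- By `u² − 1 = kv²` the two coordinates are linked by `(u + 1) · second = v · first`, so the
    -- integer bound makes both positive.
    v∙first : ∀ {k u v x y} → u * u ≡ 1ℤ + k * (v * v) → (u + 1ℤ) * (u * y + v * - x - y) ≡ v * (u * - x + k * (v * y) - x)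
    v∙first {k} {u} {v} {x} {y} e = combine (cong (y *_) e) (solve (k ∷ u ∷ v ∷ x ∷ y ∷ []))
    positive-product : ∀ n {i} → 0ℤ ℤ.< i → 0ℤ ℤ.< + ℕ.suc n * i
    positive-product n {ℤ.+[1+ _ ]} _ = ℤ.+<+ (ℕ.s≤s ℕ.z≤n)
    positive-product n {ℤ.+0} (ℤ.+<+ ())
    first-positive : 0ℤ ℤ.< first
    first-positive = ℤ.*-cancelˡ-<-nonNeg (+ v) (subst₂ ℤ._<_ (sym (ℤ.*-zeroʳ (+ v))) (trans (cong (_* second) (ℤ.+-comm 1ℤ (+ u))) (v∙first {+ k} {+ u} {+ v} {x} {y} unit)) (positive-product u second-positive))

-- Squaring uY = vX + Y + (1 + d) and using the two norm equations.
reduced-bound : ∀ {k u v X Y P} → 0 ℕ.< v → u ℕ.* u ≡ 1 ℕ.+ k ℕ.* (v ℕ.* v) → k ℕ.* (Y ℕ.* Y) ≡ X ℕ.* X ℕ.+ P → v ℕ.* X ℕ.+ Y ℕ.< u ℕ.* Y →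
  X ℕ.< v ℕ.* v ℕ.* P × Y ℕ.< v ℕ.* v ℕ.* P
reduced-bound {k} {u} {v} {X} {Y} {P} 0<v unit e bound with d , vX+Y+d≡uY ← ℕ.m≤n⇒∃[o]m+o≡n bound =
  ℕ.≤-<-trans (ℕ.m≤n*m X v {{ℕ.>-nonZero 0<v}}) (subst (v ℕ.* X ℕ.<_) (square d vX+Y+d≡uY) (ℕ.≤-trans (ℕ.m≤m+n _ _) (ℕ.≤-reflexive (split-A (v ℕ.* X) Y d)))) ,
  subst (Y ℕ.<_) (square d vX+Y+d≡uY) (ℕ.≤-trans (ℕ.m≤m+n _ _) (ℕ.≤-reflexive (split-Y (v ℕ.* X) Y d)))
  where
  Q : ℕ → ℕ → ℕ → ℕ
  Q A Y d = (1 ℕ.+ d) ℕ.* (1 ℕ.+ d) ℕ.+ 2 ℕ.* (A ℕ.* Y ℕ.+ A ℕ.* (1 ℕ.+ d) ℕ.+ Y ℕ.* (1 ℕ.+ d))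
  split-A : ∀ A Y d → 1 ℕ.+ A ℕ.+ (A ℕ.+ 2 ℕ.* d ℕ.+ d ℕ.* d ℕ.+ 2 ℕ.* (A ℕ.* Y ℕ.+ A ℕ.* d ℕ.+ Y ℕ.* (1 ℕ.+ d))) ≡
    (1 ℕ.+ d) ℕ.* (1 ℕ.+ d) ℕ.+ 2 ℕ.* (A ℕ.* Y ℕ.+ A ℕ.* (1 ℕ.+ d) ℕ.+ Y ℕ.* (1 ℕ.+ d))
  split-A = solveℕ-∀
  split-Y : ∀ A Y d → 1 ℕ.+ Y ℕ.+ (Y ℕ.+ 2 ℕ.* d ℕ.+ d ℕ.* d ℕ.+ 2 ℕ.* (A ℕ.* Y ℕ.+ A ℕ.* (1 ℕ.+ d) ℕ.+ Y ℕ.* d)) ≡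
    (1 ℕ.+ d) ℕ.* (1 ℕ.+ d) ℕ.+ 2 ℕ.* (A ℕ.* Y ℕ.+ A ℕ.* (1 ℕ.+ d) ℕ.+ Y ℕ.* (1 ℕ.+ d))
  split-Y = solveℕ-∀
  square : ∀ d → ℕ.suc (v ℕ.* X ℕ.+ Y) ℕ.+ d ≡ u ℕ.* Y → Q (v ℕ.* X) Y d ≡ v ℕ.* v ℕ.* P
  square d eq = ℕ.+-cancelʳ-≡ (Y ℕ.* Y ℕ.+ v ℕ.* X ℕ.* (v ℕ.* X)) _ _ (trans (expand (v ℕ.* X) Y d) (trans (cong₂ ℕ._*_ eq eq)
    (trans (regroup u Y) (trans (cong (ℕ._* (Y ℕ.* Y)) unit) (trans (regroup′ k v Y) (trans (cong (λ n → Y ℕ.* Y ℕ.+ v ℕ.* v ℕ.* n) e) (regroup″ v X Y P)))))))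
    where
    expand : ∀ A Y d → (1 ℕ.+ d) ℕ.* (1 ℕ.+ d) ℕ.+ 2 ℕ.* (A ℕ.* Y ℕ.+ A ℕ.* (1 ℕ.+ d) ℕ.+ Y ℕ.* (1 ℕ.+ d)) ℕ.+ (Y ℕ.* Y ℕ.+ A ℕ.* A) ≡ (1 ℕ.+ (A ℕ.+ Y) ℕ.+ d) ℕ.* (1 ℕ.+ (A ℕ.+ Y) ℕ.+ d)
    expand = solveℕ-∀
    regroup : ∀ u Y → u ℕ.* Y ℕ.* (u ℕ.* Y) ≡ u ℕ.* u ℕ.* (Y ℕ.* Y)
    regroup = solveℕ-∀
    regroup′ : ∀ k v Y → (1 ℕ.+ k ℕ.* (v ℕ.* v)) ℕ.* (Y ℕ.* Y) ≡ Y ℕ.* Y ℕ.+ v ℕ.* v ℕ.* (k ℕ.* (Y ℕ.* Y))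
    regroup′ = solveℕ-∀
    regroup″ : ∀ v X Y P → Y ℕ.* Y ℕ.+ v ℕ.* v ℕ.* (X ℕ.* X ℕ.+ P) ≡ v ℕ.* v ℕ.* P ℕ.+ (Y ℕ.* Y ℕ.+ v ℕ.* X ℕ.* (v ℕ.* X))
    regroup″ = solveℕ-∀

-- The case of odd z

square-^ : ∀ i → i ^ 2 ≡ i * i
square-^ i = cong (i *_) (ℤ.*-identityʳ i)

pos-^ : ∀ m n → + (m ℕ.^ n) ≡ (+ m) ^ n
pos-^ m ℕ.zero    = refl
pos-^ m (ℕ.suc n) = trans (ℤ.pos-* m (m ℕ.^ n)) (cong (+ m *_) (pos-^ m n))

neg-^-odd : ∀ i {n} → n ≡ 3 ⊎ n ≡ 5 → (- i) ^ n ≡ - (i ^ n)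
neg-^-odd i (inj₁ refl) = identity i
  where
  identity : ∀ i → - i * (- i * (- i * 1ℤ)) ≡ - (i * (i * (i * 1ℤ)))
  identity = solve-∀
neg-^-odd i (inj₂ refl) = identity i
  where
  identity : ∀ i → - i * (- i * (- i * (- i * (- i * 1ℤ)))) ≡ - (i * (i * (i * (i * (i * 1ℤ)))))
  identity = solve-∀

norm-of-naturals : ∀ {k X Y P} → k ℕ.* (Y ℕ.* Y) ≡ X ℕ.* X ℕ.+ P → + X * + X - + k * (+ Y * + Y) ≡ - + P
norm-of-naturals {k} {X} {Y} {P} e = difference {+ X * + X} {+ k * (+ Y * + Y)} {+ P}
  (trans (sym (trans (ℤ.pos-* k (Y ℕ.* Y)) (cong (+ k *_) (ℤ.pos-* Y Y)))) (trans (cong +_ e) (trans (ℤ.pos-+ (X ℕ.* X) P) (cong (λ a → a + + P) (ℤ.pos-* X X)))))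
  where
  difference : ∀ {a b c} → b ≡ a + c → a - b ≡ - c
  difference {a} {b} {c} e = combine (sym e) (solve (a ∷ b ∷ c ∷ []))

divides⇒∣ : ∀ {p i} → + p divides i → p ℕ.∣ ∣ i ∣
divides⇒∣ {p} {i} (j , i≡) = ℕ.divides ∣ j ∣ (trans (cong ∣_∣ i≡) (trans (ℤ.abs-* (+ p) j) (ℕ.*-comm p ∣ j ∣)))

∣⇒divides : ∀ {p i} → p ℕ.∣ ∣ i ∣ → + p divides i
∣⇒divides {p} {i} p∣i = ℤ._∣_.quotient (ℤ.∣ᵤ⇒∣ {+ p} {i} p∣i) , trans (ℤ._∣_.equality (ℤ.∣ᵤ⇒∣ {+ p} {i} p∣i)) (ℤ.*-comm _ (+ p))

Conclusion : (k p y u₁ v₁ x w : ℕ) → Set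
Conclusion k p y u₁ v₁ x w =
  Σ ℕ λ X₁ → Σ ℕ λ Y₁ → Σ ℕ λ Z₁ → Σ ℕ λ t → Σ ℤ λ lam → Σ ℤ λ u → Σ ℤ λ v →
    0 ℕ.< X₁ × 0 ℕ.< Y₁ × 0 ℕ.< Z₁ × 0 ℕ.< t ×
    (lam ≡ 1ℤ ⊎ lam ≡ -1ℤ) ×
    (u ^ 2 - (+ k) * v ^ 2 ≡ 1ℤ) ×
    ((+ X₁) ^ 2 - (+ k) * (+ Y₁) ^ 2 ≡ (- (+ p)) ^ Z₁) ×
    gcd X₁ Y₁ ≡ 1 ×
    (∀ h → IsClassNumber (+ (4 ℕ.* k)) h → Z₁ ∣ h) ×
    QLt k (qabs k ((+ X₁) +√k· (- (+ Y₁)))) (qabs k ((+ X₁) +√k· (+ Y₁))) ×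
    QLt k (qabs k ((+ X₁) +√k· (+ Y₁))) (qmul k ((+ u₁) +√k· (+ v₁)) (qabs k ((+ X₁) +√k· (- (+ Y₁))))) ×
    y ≡ Z₁ ℕ.* t ×
    ((+ x) +√k· (+ w) ≡ qmul k (qpow k ((+ X₁) +√k· (lam * (+ Y₁))) t) (u +√k· v))

module OddExponent {k p y u v x m : ℕ} (1<k : 1 ℕ.< k) (0<x : 0 ℕ.< x) (p+1≡2k : p ℕ.+ 1 ≡ 2 ℕ.* k) (3∨5 : y ≡ 3 ⊎ y ≡ 5)
  (equation : k ℕ.* (k ℕ.^ m ℕ.* k ℕ.^ m) ≡ x ℕ.* x ℕ.+ p ℕ.^ y)
  (0<v : 0 ℕ.< v) (unit : u ℕ.* u ≡ 1 ℕ.+ k ℕ.* (v ℕ.* v)) where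

  w = k ℕ.^ m
  P = + p
  D = (- P) ^ y
  N = p ℕ.^ y

  2<p : 2 ℕ.< p
  2<p = ℕ.+-cancelʳ-≤ 1 3 p (subst (4 ℕ.≤_) (sym p+1≡2k) (ℕ.*-monoʳ-≤ 2 1<k))

  instance
    p≢0 : ℕ.NonZero p
    p≢0 = ℕ.>-nonZero (ℕ.<-trans (ℕ.s≤s ℕ.z≤n) 2<p)
    -P≢0 : ℤ.NonZero (- P)
    -P≢0 = subst ℕ.NonZero (sym (ℤ.∣-i∣≡∣i∣ P)) p≢0

  y-prime : Prime y
  y-prime = is-prime 3∨5
    where
    is-prime : ∀ {y} → y ≡ 3 ⊎ y ≡ 5 → Prime y
    is-prime (inj₁ refl) = from-yes (prime? 3)
    is-prime (inj₂ refl) = from-yes (prime? 5)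

  1≤y : 1 ℕ.≤ y
  1≤y = ℕ.>-nonZero⁻¹ y {{prime⇒nonZero y-prime}}

  2<N : 2 ℕ.< N
  2<N = ℕ.<-≤-trans 2<p (subst (ℕ._≤ N) (ℕ.^-identityʳ p) (ℕ.^-monoʳ-≤ p 1≤y))

  0<w : 0 ℕ.< w
  0<w = ℕ.m^n>0 k {{ℕ.>-nonZero (ℕ.<⇒≤ 1<k)}} m

  unitℤ : + u * + u ≡ 1ℤ + + k * (+ v * + v)
  unitℤ = trans (sym (ℤ.pos-* u u)) (trans (cong +_ unit) (trans (ℤ.pos-+ 1 (k ℕ.* (v ℕ.* v))) (cong (λ a → 1ℤ + a) (trans (ℤ.pos-* k (v ℕ.* v)) (cong (+ k *_) (ℤ.pos-* v v))))))

  D≡-N : D ≡ - + N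
  D≡-N = trans (neg-^-odd P 3∨5) (cong -_ (sym (pos-^ p y)))

  P+1≡2k : P + 1ℤ ≡ + 2 * + k
  P+1≡2k = trans (sym (ℤ.pos-+ p 1)) (trans (cong +_ p+1≡2k) (ℤ.pos-* 2 k))

  k-P : Comaximal (+ k) P
  k-P = + 2 , -1ℤ , bezout-2k (+ k) P P+1≡2k
    where
    bezout-2k : ∀ k P → P + 1ℤ ≡ + 2 * k → + 2 * k + -1ℤ * P ≡ 1ℤ
    bezout-2k k P e = combine (sym e) (solve (k ∷ P ∷ []))

  2-P : Comaximal (+ 2) P
  2-P = + k , -1ℤ , bezout-2k (+ k) P P+1≡2k
    where
    bezout-2k : ∀ k P → P + 1ℤ ≡ + 2 * k → k * + 2 + -1ℤ * P ≡ 1ℤ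
    bezout-2k k P e = combine (sym e) (solve (k ∷ P ∷ []))

  k-N : Comaximal (+ k) (+ N)
  k-N = subst (Comaximal (+ k)) (sym (pos-^ p y)) (comaximal-^ʳ y k-P)

  w-N : Comaximal (+ w) (+ N)
  w-N = subst (λ w → Comaximal w (+ N)) (sym (pos-^ k m)) (comaximal-^ m k-N)

  w-P : Comaximal (+ w) P
  w-P = subst (λ w → Comaximal w P) (sym (pos-^ k m)) (comaximal-^ m k-P)

  norm-α : + x * + x - + k * (+ w * + w) ≡ - + N
  norm-α = norm-of-naturals {k} {x} {w} {N} equation

  x-w : Comaximal (+ x) (+ w)
  x-w = subst (Comaximal (+ x)) (sym (pos-^ k m)) (comaximal-^ʳ m (from-norm (+ x) (+ w) (+ k) (+ N) norm-α k-N))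
    where
    from-norm : ∀ x w k N → x * x - k * (w * w) ≡ - N → Comaximal k N → Comaximal x k
    from-norm x w k N e (r , s , unit) = - (s * x) , r + s * (w * w) , combine (cong₂ _+_ unit (cong (s *_) (sym e))) (solve (x ∷ w ∷ k ∷ N ∷ r ∷ s ∷ []))

  -- b is the residue x/w, a square root of k modulo pʸ.
  b : ℤ
  b = + x * proj₁ w-N

  x-bw : Σ ℤ λ i → + x - b * + w ≡ D * i
  x-bw = from-unit (+ x) (+ w) (+ N) D w-N D≡-N
    where
    from-unit : ∀ x w N D → (c : Comaximal w N) → D ≡ - N → Σ ℤ λ i → x - x * proj₁ c * w ≡ D * i
    from-unit x w N D (r , s , unit) refl = - (x * s) , combine (cong (x *_) (sym unit)) (solve (x ∷ w ∷ N ∷ r ∷ s ∷ []))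

  -- As `w` is a unit modulo `D`, the congruence may be multiplied by `w²`, which turns it into the
  -- norm equation of α.
  k-b² : D divides + k - b * b
  k-b² = comaximal-cancel w²-D (scaled (+ x) (+ w) (+ k) (+ N) D b x-bw norm-α D≡-N)
    where
    w-D : Comaximal (+ w) D
    w-D = subst (Comaximal (+ w)) (sym D≡-N) (comaximal-neg w-N)
    w²-D : Comaximal (+ w * + w) D
    w²-D = comaximal-* w-D w-D
    scaled : ∀ x w k N D b → (Σ ℤ λ i → x - b * w ≡ D * i) → x * x - k * (w * w) ≡ - N → D ≡ - N → D divides w * w * (k - b * b)
    scaled x w k N D b (i , e) norm≡ D≡ = -1ℤ + i * (x + b * w) ,
      combine (cong₂ _+_ (cong₂ _+_ (sym norm≡) D≡) (cong ((x + b * w) *_) e)) (solve (x ∷ w ∷ k ∷ N ∷ D ∷ b ∷ i ∷ []))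

  neg-power-divides : ∀ {a} → D divides a → P divides a
  neg-power-divides {a} d = flip-sign (power-divides { - P} {a} 1 y 1≤y d)
    where
    flip-sign : (- P) ^ 1 divides a → P divides a
    flip-sign (j , a≡) = - j , trans a≡ (identity P j)
      where
      identity : ∀ n j → - n * 1ℤ * j ≡ n * - j
      identity = solve-∀

  b-root : P divides + k - b * b
  b-root = neg-power-divides k-b²

  α-root : P divides + x - b * + w
  α-root = neg-power-divides x-bw

  2b-P : Comaximal (+ 2 * b) P
  2b-P = comaximal-* 2-P (comaximal-factor {b} {b} (comaximal-cong b-root k-P))

  -- The bound of `reduced-bound` for norm -p: all reduced elements have coordinates below it, so
  -- the search is exhaustive.
  M = v ℕ.* v ℕ.* p

  -- Reduced elements `X ± Y√k` of norm -p lying over `b`. The root condition is stated as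
  -- divisibility of absolute values in ℕ, where it can be decided.
  Solution : ℕ → ℕ → Set
  Solution Y X = k ℕ.* (Y ℕ.* Y) ≡ X ℕ.* X ℕ.+ p × v ℕ.* X ℕ.+ Y ℕ.< u ℕ.* Y × 0 ℕ.< X × 0 ℕ.< Y × gcd X Y ≡ 1 ×
    (p ℕ.∣ ∣ + X - b * (1ℤ * + Y) ∣ ⊎ p ℕ.∣ ∣ + X - b * (-1ℤ * + Y) ∣)

  solution? : ∀ Y X → Dec (Solution Y X)
  solution? Y X = (_ ℕ.≟ _) ×-dec (_ ℕ.<? _) ×-dec (_ ℕ.<? _) ×-dec (_ ℕ.<? _) ×-dec (_ ℕ.≟ _) ×-dec ((_ ℕ.∣? _) ⊎-dec (_ ℕ.∣? _))

  BoundedSolution : Set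
  BoundedSolution = Σ ℕ λ Y → Y ℕ.< M × Σ ℕ λ X → X ℕ.< M × Solution Y X

  search : Dec BoundedSolution
  search = ℕ.anyUpTo? (λ Y → ℕ.anyUpTo? (solution? Y) M) M

  norm-^ : ∀ a c → a * a - + k * (c * c) ≡ 1ℤ → a ^ 2 - + k * c ^ 2 ≡ 1ℤ
  norm-^ a c e = trans (cong₂ (λ a c → a - + k * c) (square-^ a) (square-^ c)) e

  neg-norm-^ : ∀ {X Y P} → k ℕ.* (Y ℕ.* Y) ≡ X ℕ.* X ℕ.+ P → (+ X) ^ 2 - + k * (+ Y) ^ 2 ≡ - + P
  neg-norm-^ {X} {Y} e = trans (cong₂ (λ a c → a - + k * c) (square-^ (+ X)) (square-^ (+ Y))) (norm-of-naturals {k} {X} {Y} e)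

  principal : ∀ {X Y c} → c ≡ 1ℤ ⊎ c ≡ -1ℤ → k ℕ.* (Y ℕ.* Y) ≡ X ℕ.* X ℕ.+ p → v ℕ.* X ℕ.+ Y ℕ.< u ℕ.* Y → 0 ℕ.< X → 0 ℕ.< Y →
    gcd X Y ≡ 1 → P divides + X - b * (c * + Y) → Conclusion k p y u v x w
  principal {X} {Y} {c} sign e bound 0<X 0<Y coprime root =
    from-division (Division.divide {k} {P} {b} {+ X} {c * + Y} norm-β root b-root y (+ x , + w) (trans norm-α (sym D≡-N)) (λ _ _ → α-root , w-P))
    where
    norm-β : + X * + X - + k * (c * + Y * (c * + Y)) ≡ - P
    norm-β = trans (cong (λ s → + X * + X - + k * s) (sign-square sign)) (norm-of-naturals {k} {X} {Y} e)
      where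
      sign-square : c ≡ 1ℤ ⊎ c ≡ -1ℤ → c * + Y * (c * + Y) ≡ + Y * + Y
      sign-square (inj₁ refl) = cong₂ _*_ (ℤ.*-identityˡ (+ Y)) (ℤ.*-identityˡ (+ Y))
      sign-square (inj₂ refl) = identity (+ Y)
        where
        identity : ∀ a → -1ℤ * a * (-1ℤ * a) ≡ a * a
        identity = solve-∀
    from-division : (Σ QZ λ η → norm (+ k) η ≡ 1ℤ × (+ x , + w) ≡ qmul k (qpow k (+ X , c * + Y) y) η) → Conclusion k p y u v x w
    from-division ((s , t) , norm-η , α≡) = X , Y , 1 , y , c , s , t , 0<X , 0<Y , ℕ.s≤s ℕ.z≤n , 1≤y , sign , norm-^ s t norm-η ,
      trans (neg-norm-^ {X} {Y} e) (sym (ℤ.*-identityʳ (- P))) , coprime , (λ h _ → ℕ.1∣ h) ,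
      Ratio.ratio>1 {k} {u} {v} {p} 0<v 0<p unitℤ X Y 0<X 0<Y e , Ratio.ratio<ε {k} {u} {v} {p} 0<v 0<p unitℤ X Y 0<X 0<Y e bound , sym (ℕ.*-identityˡ y) , α≡
      where
      0<p : 0 ℕ.< p
      0<p = ℕ.>-nonZero⁻¹ p

  from-solution : BoundedSolution → Conclusion k p y u v x w
  from-solution (Y , _ , X , _ , e , bound , 0<X , 0<Y , coprime , inj₁ p∣) = principal {X} {Y} (inj₁ refl) e bound 0<X 0<Y coprime (∣⇒divides p∣)
  from-solution (Y , _ , X , _ , e , bound , 0<X , 0<Y , coprime , inj₂ p∣) = principal {X} {Y} (inj₂ refl) e bound 0<X 0<Y coprime (∣⇒divides p∣)

  -- The residue X/Y modulo p of a reduced associate is ± that of the original element.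
  solution-of-norm-[-p] : ∀ {X Y} → X * X - + k * (Y * Y) ≡ - P → P divides X - b * Y → BoundedSolution
  solution-of-norm-[-p] {X} {Y} norm-β root = from-signs (signed-abs X) (signed-abs Y)
    where
    -- `β` divides `α`, so the coordinates of `α` are combinations of `X` and `Y`; they are coprime,
    -- hence so are `X` and `Y`.
    X-Y : Comaximal X Y
    X-Y = from-quotient (Division.quotient {k} {P} {b} {X} {Y} norm-β root b-root {ℕ.pred y} (+ x , + w)
      (trans norm-α (trans (sym D≡-N) (cong ((- P) ^_) (sym (ℕ.suc-pred y {{prime⇒nonZero y-prime}}))))) (α-root , w-P))
      where
      from-quotient : (Σ QZ λ γ → (+ x , + w) ≡ qmul k (X , Y) γ × norm (+ k) γ ≡ (- P) ^ ℕ.pred y) → Comaximal X Y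
      from-quotient ((c , d) , α≡ , _) = ideal {+ x} {+ w} {+ k} {X} {Y} {c} {d} x-w (cong proj₁ α≡) (cong proj₂ α≡)
        where
        ideal : ∀ {x w k X Y c d} → Comaximal x w → x ≡ X * c + k * (Y * d) → w ≡ X * d + Y * c → Comaximal X Y
        ideal {k = k} {X} {Y} {c} {d} (r , s , unit) refl refl = r * c + s * d , r * (k * d) + s * c ,
          combine unit (solve (k ∷ X ∷ Y ∷ c ∷ d ∷ r ∷ s ∷ []))
    e : k ℕ.* (∣ Y ∣ ℕ.* ∣ Y ∣) ≡ ∣ X ∣ ℕ.* ∣ X ∣ ℕ.+ p
    e = ℤ.+-injective (trans (trans (ℤ.pos-* k _) (cong (+ k *_) (abs-square Y))) (trans (rearrange (X * X) (+ k * (Y * Y)) P norm-β)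
      (sym (trans (ℤ.pos-+ _ p) (cong (λ a → a + P) (abs-square X))))))
      where
      rearrange : ∀ a b c → a - b ≡ - c → b ≡ a + c
      rearrange a b c e = combine (sym e) (solve (a ∷ b ∷ c ∷ []))
    0<Y : 0 ℕ.< ∣ Y ∣
    0<Y = ℕ.n≢0⇒n>0 λ Y≡0 → ℕ.≢-nonZero⁻¹ p (ℕ.m+n≡0⇒n≡0 (∣ X ∣ ℕ.* ∣ X ∣) (trans (sym e) (trans (cong (λ Y → k ℕ.* (Y ℕ.* Y)) Y≡0) (ℕ.*-zeroʳ k))))
    0<X : 0 ℕ.< ∣ X ∣
    0<X = ℕ.n≢0⇒n>0 λ X≡0 → Reduction.X≢0 {k} {u} {v} {p} 1<k 0<v 2<p unit k-P {∣ Y ∣} (trans e (cong (λ X → X ℕ.* X ℕ.+ p) X≡0))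
    |X|-|Y| : Comaximal (+ ∣ X ∣) (+ ∣ Y ∣)
    |X|-|Y| = comaximal-sym (comaximal-abs Y (comaximal-sym (comaximal-abs X X-Y)))
    from-signs : (Σ ℤ λ τ → (τ ≡ 1ℤ ⊎ τ ≡ -1ℤ) × X ≡ τ * + ∣ X ∣) → (Σ ℤ λ ρ → (ρ ≡ 1ℤ ⊎ ρ ≡ -1ℤ) × Y ≡ ρ * + ∣ Y ∣) → BoundedSolution
    from-signs (τ , τ-sign , X≡) (ρ , ρ-sign , Y≡) = from-reduction (Reduction.reduce {k} {u} {v} {p} 1<k 0<v 2<p unit k-P ∣ X ∣ ∣ Y ∣ (<-wellFounded _) 0<X 0<Y e |X|-|Y|)
      where
      square-of-sign : ∀ {τ} → τ ≡ 1ℤ ⊎ τ ≡ -1ℤ → τ * τ ≡ 1ℤ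
      square-of-sign (inj₁ refl) = refl
      square-of-sign (inj₂ refl) = refl
      product-of-signs : ∀ {σ τ} → σ ≡ 1ℤ ⊎ σ ≡ -1ℤ → τ ≡ 1ℤ ⊎ τ ≡ -1ℤ → σ * τ ≡ 1ℤ ⊎ σ * τ ≡ -1ℤ
      product-of-signs (inj₁ refl) (inj₁ refl) = inj₁ refl
      product-of-signs (inj₁ refl) (inj₂ refl) = inj₂ refl
      product-of-signs (inj₂ refl) (inj₁ refl) = inj₂ refl
      product-of-signs (inj₂ refl) (inj₂ refl) = inj₁ refl
      abs-root : P divides + ∣ X ∣ - τ * ρ * b * + ∣ Y ∣
      abs-root = scale {X} {Y} {+ ∣ X ∣} {+ ∣ Y ∣} root X≡ Y≡ (square-of-sign τ-sign)
        where
        scale : ∀ {X Y x y} → P divides X - b * Y → X ≡ τ * x → Y ≡ ρ * y → τ * τ ≡ 1ℤ → P divides x - τ * ρ * b * y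
        scale {x = x} {y} (j , e) refl refl ττ = τ * j , move b P τ ρ j x y e ττ
          where
          move : ∀ b P τ ρ j x y → τ * x - b * (ρ * y) ≡ P * j → τ * τ ≡ 1ℤ → x - τ * ρ * b * y ≡ P * (τ * j)
          move b P τ ρ j x y e ττ = combine (cong₂ _+_ (cong (τ *_) e) (cong (x *_) (sym ττ))) (solve (b ∷ P ∷ τ ∷ ρ ∷ j ∷ x ∷ y ∷ []))
      -- Since `c² ≡ k`, `x − cy ≡ (x₁ − cy₁)(s − ct)`. Multiplying by `s + ct` turns the last
      -- factor into the norm 1 of the unit.
      transfer-root : ∀ {x y x₁ y₁ s t c k : ℤ} → P divides x - c * y → P divides k - c * c → x ≡ x₁ * s + k * (y₁ * t) → y ≡ x₁ * t + y₁ * s →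
        s * s - k * (t * t) ≡ 1ℤ → P divides x₁ - c * y₁
      transfer-root {x₁ = x₁} {y₁} {s} {t} {c} {k} (i , e₁) (j , e₂) refl refl norm≡ = i * (s + c * t) - j * (t * (x₁ * t + y₁ * s)) ,
        move P i j x₁ y₁ s t c k e₁ e₂ norm≡
        where
        move : ∀ P i j x₁ y₁ s t c k → x₁ * s + k * (y₁ * t) - c * (x₁ * t + y₁ * s) ≡ P * i → k - c * c ≡ P * j → s * s - k * (t * t) ≡ 1ℤ →
          x₁ - c * y₁ ≡ P * (i * (s + c * t) - j * (t * (x₁ * t + y₁ * s)))
        move P i j x₁ y₁ s t c k e₁ e₂ norm≡ = combine (cong₂ _+_ (cong₂ _+_ (cong ((s + c * t) *_) e₁) (cong (t * (x₁ * t + y₁ * s) *_) (sym e₂))) (cong ((x₁ - c * y₁) *_) (sym norm≡)))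
          (solve (P ∷ i ∷ j ∷ x₁ ∷ y₁ ∷ s ∷ t ∷ c ∷ k ∷ []))
      signed-root : P divides + k - τ * ρ * b * (τ * ρ * b)
      signed-root = subst (λ s → P divides + k - s) (sym (trans (regroup (τ * ρ) b) (trans (cong (_* (b * b)) (square-of-sign (product-of-signs τ-sign ρ-sign))) (ℤ.*-identityˡ (b * b))))) b-root
        where
        regroup : ∀ c b → c * b * (c * b) ≡ c * c * (b * b)
        regroup = solve-∀
      from-reduction : Reduction.Reduction {k} {u} {v} {p} 1<k 0<v 2<p unit k-P ∣ X ∣ ∣ Y ∣ → BoundedSolution
      from-reduction (Reduction.reduction {X₁} {Y₁} {σ} {η} (Reduction.reduced 0<X₁ 0<Y₁ e₁ X₁-Y₁ bound) σ-sign norm-η factored) =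
        Y₁ , proj₂ bounds , X₁ , proj₁ bounds , e₁ , bound , 0<X₁ , 0<Y₁ , comaximal⇒gcd≡1 X₁-Y₁ , by-sign (product-of-signs (product-of-signs τ-sign ρ-sign) σ-sign) reduced-root
        where
        bounds = reduced-bound {k} {u} {v} {X₁} {Y₁} {p} 0<v unit e₁ bound
        reduced-root : P divides + X₁ - b * (τ * ρ * σ * + Y₁)
        reduced-root = subst (λ a → P divides + X₁ - a) (regroup τ ρ b σ (+ Y₁))
          (transfer-root {+ ∣ X ∣} {+ ∣ Y ∣} {+ X₁} {σ * + Y₁} {proj₁ η} {proj₂ η} {τ * ρ * b} {+ k} abs-root signed-root (cong proj₁ factored) (cong proj₂ factored) norm-η)
          where
          regroup : ∀ τ ρ b σ y → τ * ρ * b * (σ * y) ≡ b * (τ * ρ * σ * y)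
          regroup = solve-∀
        by-sign : ∀ {c} → c ≡ 1ℤ ⊎ c ≡ -1ℤ → P divides + X₁ - b * (c * + Y₁) → p ℕ.∣ ∣ + X₁ - b * (1ℤ * + Y₁) ∣ ⊎ p ℕ.∣ ∣ + X₁ - b * (-1ℤ * + Y₁) ∣
        by-sign (inj₁ refl) d = inj₁ (divides⇒∣ d)
        by-sign (inj₂ refl) d = inj₂ (divides⇒∣ d)

  free : ¬ BoundedSolution → ∀ f → discriminant f ≡ + k → Prim f → ¬ Neighbour b (- P) f f
  free none f disc≡ prim-f f-f = from-fixed-point (fixed-point f prim-f f-f)
    where
    from-fixed-point : ¬ (Σ ℤ λ X → Σ ℤ λ Y → X * X - discriminant f * (Y * Y) ≡ - P × - P divides X - b * Y)
    from-fixed-point (X , Y , norm≡ , (j , root)) = none (solution-of-norm-[-p] {X} {Y} (subst (λ k → X * X - k * (Y * Y) ≡ - P) disc≡ norm≡) (- j , trans root (identity P j)))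
      where
      identity : ∀ P j → - P * j ≡ P * - j
      identity = solve-∀

  self : ∀ f → discriminant f ≡ + k → Neighbour b D f f
  self f disc≡ = self-neighbour f (+ x) (+ w) (proj₁ x-bw) (proj₁ k-b²) (subst (λ k → + x * + x - k * (+ w * + w) ≡ D) (sym disc≡) (trans norm-α (sym D≡-N)))
    (proj₂ x-bw) (subst (λ k → k - b * b ≡ D * proj₁ k-b²) (sym disc≡) (proj₂ k-b²))

  non-principal : ¬ BoundedSolution → Conclusion k p y u v x w
  -- Here the reduced element is an associate of `α` or of its conjugate, of norm `−p^y = (−p)^y`,
  -- so that `Z₁ = y` and `t = 1`.
  non-principal none = from-reduction (Reduction.reduce {k} {u} {v} {N} 1<k 0<v 2<N unit k-N x w (<-wellFounded w) 0<x 0<w equation x-w)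
    where
    0<N : 0 ℕ.< N
    0<N = ℕ.<-trans (ℕ.s≤s ℕ.z≤n) 2<N
    from-reduction : Reduction.Reduction {k} {u} {v} {N} 1<k 0<v 2<N unit k-N x w → Conclusion k p y u v x w
    from-reduction (Reduction.reduction {X₁} {Y₁} {σ} {s , t} (Reduction.reduced 0<X₁ 0<Y₁ e₁ X₁-Y₁ bound) σ-sign norm-η factored) =
      X₁ , Y₁ , y , 1 , σ , s , t , 0<X₁ , 0<Y₁ , 1≤y , ℕ.s≤s ℕ.z≤n , σ-sign , norm-^ s t norm-η , trans (neg-norm-^ {X₁} {Y₁} e₁) (sym D≡-N) ,
      comaximal⇒gcd≡1 X₁-Y₁ ,
      (λ h class-number → ClassAction.class-number-divisible {y} {+ k} {P} {b} y-prime (coprime-part p) 2b-P k-b² self (free none) (subst (λ d → IsClassNumber d h) (ℤ.pos-* 4 k) class-number)) ,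
      Ratio.ratio>1 {k} {u} {v} {N} 0<v 0<N unitℤ X₁ Y₁ 0<X₁ 0<Y₁ e₁ , Ratio.ratio<ε {k} {u} {v} {N} 0<v 0<N unitℤ X₁ Y₁ 0<X₁ 0<Y₁ e₁ bound , sym (ℕ.*-identityʳ y) ,
      trans factored (cong (λ β → qmul k β (s , t)) (sym (qmul-identityʳ (+ X₁ , σ * + Y₁))))
      where
      qmul-identityʳ : ∀ α → qmul k α (1ℤ , 0ℤ) ≡ α
      qmul-identityʳ (a , c) = pair-≡ (first (+ k) a c) (second a c)
        where
        first : ∀ k a c → a * 1ℤ + k * (c * 0ℤ) ≡ a
        first = solve-∀
        second : ∀ a c → a * 0ℤ + c * 1ℤ ≡ c
        second = solve-∀

  conclusion : Conclusion k p y u v x w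
  conclusion = by-search search
    where
    by-search : Dec BoundedSolution → Conclusion k p y u v x w
    by-search (yes solution) = from-solution solution
    by-search (no none)      = non-principal none

theorem1p3 : (k : ℕ) → 1 ℕ.< k → (∀ m → m ℕ.* m ≢ k) →
    (x y z : ℕ) → 0 ℕ.< x → 0 ℕ.< y → 0 ℕ.< z →
    x ℕ.^ 2 ℕ.+ (2 ℕ.* k ∸ 1) ℕ.^ y ≡ k ℕ.^ z →
    (y ≡ 3 ⊎ y ≡ 5) →
    (u₁ v₁ : ℕ) → 0 ℕ.< u₁ → 0 ℕ.< v₁ →
    (+ u₁) ^ 2 - (+ k) * (+ v₁) ^ 2 ≡ 1ℤ →
    (∀ u v → 0 ℕ.< u → 0 ℕ.< v → (+ u) ^ 2 - (+ k) * (+ v) ^ 2 ≡ 1ℤ →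
    ¬ QLt k ((+ u) +√k· (+ v)) ((+ u₁) +√k· (+ v₁))) →
    z % 2 ≡ 1 ×
    Σ ℕ λ X₁ → Σ ℕ λ Y₁ → Σ ℕ λ Z₁ → Σ ℕ λ t → Σ ℤ λ lam → Σ ℤ λ u → Σ ℤ λ v →
    0 ℕ.< X₁ × 0 ℕ.< Y₁ × 0 ℕ.< Z₁ × 0 ℕ.< t ×
    (lam ≡ 1ℤ ⊎ lam ≡ -1ℤ) ×
    (u ^ 2 - (+ k) * v ^ 2 ≡ 1ℤ) ×
    ((+ X₁) ^ 2 - (+ k) * (+ Y₁) ^ 2 ≡ (- (+ (2 ℕ.* k ∸ 1))) ^ Z₁) ×
    gcd X₁ Y₁ ≡ 1 ×
    (∀ h → IsClassNumber (+ (4 ℕ.* k)) h → Z₁ ∣ h) ×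
    QLt k (qabs k ((+ X₁) +√k· (- (+ Y₁)))) (qabs k ((+ X₁) +√k· (+ Y₁))) ×
    QLt k (qabs k ((+ X₁) +√k· (+ Y₁)))
    (qmul k ((+ u₁) +√k· (+ v₁)) (qabs k ((+ X₁) +√k· (- (+ Y₁))))) ×
    y ≡ Z₁ ℕ.* t ×
    ((+ x) +√k· (+ (k ℕ.^ ((z ∸ 1) / 2)))
    ≡ qmul k (qpow k ((+ X₁) +√k· (lam * (+ Y₁))) t) (u +√k· v))
theorem1p3 k 1<k _ x y z 0<x 0<y 0<z equation 3∨5 u₁ v₁ 0<u₁ 0<v₁ unit _ = by-parity (even⊎odd z)
  where
  p = 2 ℕ.* k ∸ 1
  p+1≡2k : p ℕ.+ 1 ≡ 2 ℕ.* k
  p+1≡2k = ℕ.m∸n+n≡m (ℕ.≤-trans (ℕ.<⇒≤ 1<k) (ℕ.m≤m+n k (k ℕ.+ 0)))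
  unitℕ : u₁ ℕ.* u₁ ≡ 1 ℕ.+ k ℕ.* (v₁ ℕ.* v₁)
  unitℕ = ℤ.+-injective (trans (ℤ.pos-* u₁ u₁) (trans (rearrange {+ u₁ * + u₁} {+ k * (+ v₁ * + v₁)} (trans (cong₂ (λ a c → a - + k * c) (sym (square-^ (+ u₁))) (sym (square-^ (+ v₁)))) unit))
    (sym (trans (ℤ.pos-+ 1 (k ℕ.* (v₁ ℕ.* v₁))) (cong (λ a → 1ℤ + a) (trans (ℤ.pos-* k (v₁ ℕ.* v₁)) (cong (+ k *_) (ℤ.pos-* v₁ v₁))))))))
    where
    rearrange : ∀ {a b} → a - b ≡ 1ℤ → a ≡ 1ℤ + b
    rearrange {a} {b} e = combine e (solve (a ∷ b ∷ []))
  Result : ℕ → Set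
  Result z = z % 2 ≡ 1 × Conclusion k p y u₁ v₁ x (k ℕ.^ ((z ∸ 1) / 2))
  odd-case : ∀ m → x ℕ.^ 2 ℕ.+ p ℕ.^ y ≡ k ℕ.^ (1 ℕ.+ 2 ℕ.* m) → Result (1 ℕ.+ 2 ℕ.* m)
  odd-case m eq = trans (cong (λ n → (1 ℕ.+ n) % 2) (ℕ.*-comm 2 m)) ([m+kn]%n≡m%n 1 m 2) ,
    subst (λ n → Conclusion k p y u₁ v₁ x (k ℕ.^ n)) (sym (trans (cong (_/ 2) (ℕ.*-comm 2 m)) (m*n/n≡m m 2)))
      (OddExponent.conclusion {k} {p} {y} {u₁} {v₁} {x} {m} 1<k 0<x p+1≡2k 3∨5
        (trans (cong (k ℕ.*_) (trans (sym (ℕ.^-distribˡ-+-* k m m)) (cong (λ n → k ℕ.^ (m ℕ.+ n)) (sym (ℕ.+-identityʳ m)))))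
          (trans (sym eq) (cong (λ n → x ℕ.* n ℕ.+ p ℕ.^ y) (ℕ.*-identityʳ x)))) 0<v₁ unitℕ)
  by-parity : (Σ ℕ λ i → z ≡ 2 ℕ.* i) ⊎ (Σ ℕ λ i → z ≡ 1 ℕ.+ 2 ℕ.* i) → Result z
  by-parity (inj₁ (m , z≡)) = ⊥-elim (exponent-not-even {k} {p} x y m 1<k 0<x p+1≡2k 3∨5 (trans equation (cong (k ℕ.^_) z≡)))
  by-parity (inj₂ (m , z≡)) = subst Result (sym z≡) (odd-case m (trans equation (cong (k ℕ.^_) z≡)))
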